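{- (1) The production problem for Petri nets is polynomial-time reducible to robot reachability (1-player, multi-robot) with the symmetric self-closing door and a spawner. (2) The configuration reachability problem for Petri nets is polynomial-time reducible to multi-robot targeted reconfiguration (1-player, multi-robot) with the symmetric self-closing door and a spawner.
   Context: A Petri net $\{D,R\}$ consists of a finite set $D$ of dishes and a finite set $R$ of rules. A configuration is a vector of nonnegative integers indexed by $D$ (numbers of tokens). A rule is a pair $(u,v)$ of nonnegative integer vectors over $D$; it can be applied to configuration $d_0$ if $d_0-u$ has no negative entries, yielding $d_0-u+v$. Production: given a Petri net, an initial configuration and a target dish, is there a reachable configuration with at least one token in the target dish? Configuration reachability: given a Petri net, an initial and a target configuration, is the target configuration reachable from the initial one? A gadget consists of finitely many locations and states, with transitions: a transition from $(Q,a)$ to $(Q',b)$ means a robot can enter at location $a$ when the gadget is in state $Q$, exit at $b$, changing the state to $Q'$. A system of gadgets consists of finitely many gadgets, their initial states, and an undirected connection graph on their locations; robots move freely between locations joined by a path in the connection graph (such locations are identified). In 1-player multi-robot motion planning, a single player controls a set of robots, moving any one robot at a time; any number of robots may be at a location. A spawner is a 1-location gadget which the player can use to produce new robots at its location, without limit. Symmetric self-closing door: the 2-state gadget with locations $A,B,C,D$ (tunnels $\{A,B\}$ and $\{C,D\}$) whose only transitions are: in state 1, from $A$ to $B$, changing the state to 2; in state 2, from $C$ to $D$, changing the state to 1. "With the symmetric self-closing door and a spawner" means that the systems of gadgets consist of copies of the symmetric self-closing door together with a spawner. Robot reachability: given a system, the starting locations of the robots, and a win location, is there a sequence of moves after which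 some robot reaches the win location? Multi-robot targeted reconfiguration: given a system, the starting locations of the robots, and a target configuration (a state for every gadget and a number of robots for every location), is there a sequence of moves reaching exactly the target configuration?
   Formalization: The spawner's location is an inexhaustible supply that robots may also rejoin, and the target configuration gives no number for it. If robots there were counted exactly, (2) would fail: robots never vanish, so the problem would be in PSPACE, but Petri reachability is EXPSPACE-hard. -}

module Defs where

open import Data.Fin.Base using (Fin; zero; suc; toℕ)
open import Data.List.Base as List using (List; []; _∷_; _++_; length; concatMap)
open import Data.List.Membership.Propositional using (_∈_)
open import Data.Maybe.Base using (Maybe; just; nothing)
open import Data.Nat.Base using (ℕ; zero; suc; pred; _+_; _*_; _∸_; _≤_)
open import Data.Nat.Binary.Base as Bin using (ℕᵇ; 2[1+_]; 1+[2_])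
open import Data.Product.Base using (Σ; ∃; ∃-syntax; _×_; _,_; proj₁; proj₂)
open import Data.Sum.Base using (_⊎_)
open import Data.Unit.Base using (⊤)
open import Data.Vec.Base as Vec using (Vec; []; _∷_; zipWith; replicate; lookup; updateAt; _[_]≔_; toList)
open import Data.Vec.Relation.Binary.Pointwise.Inductive using (Pointwise)
open import Function.Bundles using (_⇔_; _↔_)
open import Relation.Binary.Construct.Closure.ReflexiveTransitive using (Star)
open import Relation.Binary.PropositionalEquality.Core using (_≡_)

Counts : ℕ → Set
Counts = Vec ℕ

Rule : ℕ → Set
Rule n = Counts n × Counts n

-- The dishes are the elements of Fin dishes.
record PetriNet : Set where
  field
    dishes : ℕ
    rules  : List (Rule dishes)

module _ (N : PetriNet) where
  open PetriNet N

  data Fires : Counts dishes → Counts dishes → Set where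
    fire : ∀ {u v d} → (u , v) ∈ rules → Pointwise _≤_ u d →
           Fires d (zipWith _+_ (zipWith _∸_ d u) v)

record Gadget : Set where
  field
    locations   : ℕ
    states      : ℕ
    -- ((Q , a) , (Q′ , b)): enter at a in state Q, exit at b leaving state Q′.
    transitions : List ((Fin states × Fin locations) × (Fin states × Fin locations))

-- Locations A, B, C, D are 0, 1, 2, 3; states 1 and 2 are 0 and 1.
symmetricSelfClosingDoor : Gadget
symmetricSelfClosingDoor = record
  { locations   = 4
  ; states      = 2
  ; transitions = ((s₁ , A) , (s₂ , B)) ∷ ((s₂ , C) , (s₁ , D)) ∷ []
  }
  where
  s₁ s₂ : Fin 2
  s₁ = zero
  s₂ = suc zero
  A B C D : Fin 4
  A = zero
  B = suc zero
  C = suc (suc zero)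
  D = suc (suc (suc zero))

-- Systems made of copies of G together with one spawner.
module _ (G : Gadget) where
  open Gadget G

  data Location (n : ℕ) : Set where
    port    : Fin n → Fin locations → Location n
    spawner : Location n

  record System : Set where
    field
      copies        : ℕ
      initialStates : Vec (Fin states) copies
      connections   : List (Location copies × Location copies)

  -- The spawner's location holds an inexhaustible supply of robots: any number
  -- can be taken from it, and robots returning to it rejoin the supply.  The
  -- number of robots there is thus infinite in every configuration, so only
  -- the numbers at the other locations are recorded.
  Robots : ℕ → Set
  Robots n = Vec (Vec ℕ locations) n

  record Configuration (n : ℕ) : Set where
    constructor ⟨_,_⟩
    field
      gadgetStates : Vec (Fin states) n
      robots       : Robots n

  noRobots : ∀ n → Robots n
  noRobots n = replicate n (replicate locations 0)

  Occupied : ∀ {n} → Location n → Robots n → Set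
  Occupied (port i a) r = 1 ≤ lookup (lookup r i) a
  Occupied spawner    r = ⊤

  addRobot : ∀ {n} → Location n → Robots n → Robots n
  addRobot (port i a) r = updateAt r i λ w → updateAt w a suc
  addRobot spawner    r = r

  removeRobot : ∀ {n} → Location n → Robots n → Robots n
  removeRobot (port i a) r = updateAt r i λ w → updateAt w a pred
  removeRobot spawner    r = r

  placeRobots : ∀ {n} → List (Location n) → Robots n
  placeRobots = List.foldr addRobot (noRobots _)

  module _ (S : System) where
    open System S

    -- The connection graph is undirected.
    Adjacent : Location copies → Location copies → Set
    Adjacent l l′ = (l , l′) ∈ connections ⊎ (l′ , l) ∈ connections

    -- Locations joined by a path are identified by letting robots walk along
    -- connections freely in both directions.
    data Move : Configuration copies → Configuration copies → Set where
      walk : ∀ {q r l l′} → Adjacent l l′ → Occupied l r →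
             Move ⟨ q , r ⟩ ⟨ q , addRobot l′ (removeRobot l r) ⟩
      traverse : ∀ {q r i a q′ b} → ((lookup q i , a) , (q′ , b)) ∈ transitions →
                 Occupied (port i a) r →
                 Move ⟨ q , r ⟩
                      ⟨ q [ i ]≔ q′ , addRobot (port i b) (removeRobot (port i a) r) ⟩

    initialConfiguration : List (Location copies) → Configuration copies
    initialConfiguration starts = ⟨ initialStates , placeRobots starts ⟩

-- Words describing instances: digits, and terminators for three depths of
-- nesting.
data Symbol : Set where
  digit₁ digit₂ comma semicolon bar : Symbol

Word : Set
Word = List Symbol

record Problem : Set₁ where
  field
    Instance : Set
    encode   : Instance → Word
    Yes      : Instance → Set

Cell : Set
Cell = Maybe Symbol

blank : Cell
blank = nothing

-- A two-way infinite tape; both lists start next to the head, and all cells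
-- beyond them are blank.
record Tape : Set where
  constructor tape
  field
    left  : List Cell
    head  : Cell
    right : List Cell

data Direction : Set where
  leftwards stay rightwards : Direction

move : Direction → Tape → Tape
move leftwards  (tape []      h r)       = tape [] blank (h ∷ r)
move leftwards  (tape (c ∷ l) h r)       = tape l c (h ∷ r)
move stay       t                        = t
move rightwards (tape l       h [])      = tape (h ∷ l) blank []
move rightwards (tape l       h (c ∷ r)) = tape (h ∷ l) c r

writeAndMove : Cell × Direction → Tape → Tape
writeAndMove (c , m) t = move m (record t { head = c })

emptyTape : Tape
emptyTape = tape [] blank []

wordTape : Word → Tape
wordTape []      = emptyTape
wordTape (s ∷ w) = tape [] (just s) (List.map just w)

-- The word from the head rightwards to the first blank.
readWord : Tape → Word
readWord (tape _ h r) = go (h ∷ r)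
  where
  go : List Cell → Word
  go (just s ∷ cs) = s ∷ go cs
  go _             = []

-- Deterministic Turing machines with an input tape, an output tape and
-- workTapes further tapes.  The machine halts where δ is undefined.
record TuringMachine : Set₁ where
  field
    State      : Set
    finite     : ∃[ n ] (State ↔ Fin n)
    start      : State
    workTapes  : ℕ
  tapes : ℕ
  tapes = 2 + workTapes
  field
    δ : State → Vec Cell tapes → Maybe (State × Vec (Cell × Direction) tapes)

module _ (M : TuringMachine) where
  open TuringMachine M

  record Snapshot : Set where
    constructor snapshot
    field
      state    : State
      contents : Vec Tape tapes

  initialSnapshot : Word → Snapshot
  initialSnapshot w = snapshot start (wordTape w ∷ emptyTape ∷ replicate workTapes emptyTape)

  output : Snapshot → Word
  output (snapshot _ (_ ∷ t ∷ _)) = readWord t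

  -- Run c k c′: from c the machine halts after exactly k steps, in c′.
  data Run : Snapshot → ℕ → Snapshot → Set where
    halt : ∀ {q ts} → δ q (Vec.map Tape.head ts) ≡ nothing →
           Run (snapshot q ts) 0 (snapshot q ts)
    step : ∀ {q ts q′ as k c} → δ q (Vec.map Tape.head ts) ≡ just (q′ , as) →
           Run (snapshot q′ (zipWith writeAndMove as ts)) k c →
           Run (snapshot q ts) (suc k) c

-- Coefficients of a polynomial, constant term first.
Polynomial : Set
Polynomial = List ℕ

eval : Polynomial → ℕ → ℕ
eval []      n = 0
eval (a ∷ p) n = a + n * eval p n

PolynomialTime : {A B : Set} → (A → Word) → (B → Word) → (A → B) → Set₁
PolynomialTime encA encB f =
  Σ TuringMachine λ M → ∃[ p ] ∀ x → ∃[ k ] ∃[ c ]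
    Run M (initialSnapshot M (encA x)) k c ×
    k ≤ eval p (length (encA x)) ×
    output M c ≡ encB (f x)

infix 4 _≤ₚ_

_≤ₚ_ : Problem → Problem → Set₁
P ≤ₚ Q = Σ (P.Instance → Q.Instance) λ f →
    (∀ x → P.Yes x ⇔ Q.Yes (f x)) × PolynomialTime P.encode Q.encode f
  where
  module P = Problem P
  module Q = Problem Q

-- Binary, least significant digit first, with digits 1 and 2 (bijective
-- base 2), as in ℕᵇ; zero has no digits.
digits : ℕᵇ → Word
digits Bin.zero  = []
digits 1+[2 b ]  = digit₁ ∷ digits b
digits 2[1+ b ]  = digit₂ ∷ digits b

number : ℕ → Word
number k = digits (Bin.fromℕ k) ++ comma ∷ []

index : ∀ {n} → Fin n → Word
index i = number (toℕ i)

numbers : ∀ {n} → Vec ℕ n → Word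
numbers v = concatMap number (toList v) ++ semicolon ∷ []

indices : ∀ {m n} → Vec (Fin m) n → Word
indices v = concatMap index (toList v) ++ semicolon ∷ []

sequence : {A : Set} → (A → Word) → List A → Word
sequence enc xs = concatMap enc xs ++ bar ∷ []

rule : ∀ {n} → Rule n → Word
rule (u , v) = numbers u ++ numbers v

module _ (G : Gadget) where
  open Gadget G

  location : ∀ {n} → Location G n → Word
  location (port i a) = index i ++ index a ++ semicolon ∷ []
  location spawner    = semicolon ∷ []

  connection : ∀ {n} → Location G n × Location G n → Word
  connection (l , l′) = location l ++ location l′

  -- The number of copies is the length of the first list.
  system : System G → Word
  system S = indices initialStates ++ sequence connection connections
    where open System S

  configuration : ∀ {n} → Configuration G n → Word
  configuration ⟨ q , r ⟩ = indices q ++ sequence numbers (toList r)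

record ProductionInstance : Set where
  field
    net : PetriNet
  open PetriNet net public
  field
    initial : Counts dishes
    target  : Fin dishes

-- The number of dishes is the length of the initial configuration.
Production : Problem
Production = record
  { Instance = ProductionInstance
  ; encode   = λ x → let open ProductionInstance x in
                 sequence rule rules ++ numbers initial ++ index target
  ; Yes      = λ x → let open ProductionInstance x in
                 ∃[ d ] Star (Fires net) initial d × 1 ≤ lookup d target
  }

record ConfigurationReachabilityInstance : Set where
  field
    net : PetriNet
  open PetriNet net public
  field
    initial : Counts dishes
    target  : Counts dishes

ConfigurationReachability : Problem
ConfigurationReachability = record
  { Instance = ConfigurationReachabilityInstance
  ; encode   = λ x → let open ConfigurationReachabilityInstance x in
                 sequence rule rules ++ numbers initial ++ numbers target
  ; Yes      = λ x → let open ConfigurationReachabilityInstance x in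
                 Star (Fires net) initial target
  }

module _ (G : Gadget) where

  record RobotReachabilityInstance : Set where
    field
      sys : System G
    open System sys public
    field
      starts : List (Location G copies)
      win    : Location G copies

  RobotReachability : Problem
  RobotReachability = record
    { Instance = RobotReachabilityInstance
    ; encode   = λ x → let open RobotReachabilityInstance x in
                   system G sys ++ sequence (location G) starts ++ location G win
    ; Yes      = λ x → let open RobotReachabilityInstance x in
                   ∃[ c ] Star (Move G sys) (initialConfiguration G sys starts) c ×
                          Occupied G win (Configuration.robots c)
    }

  record TargetedReconfigurationInstance : Set where
    field
      sys : System G
    open System sys public
    field
      starts : List (Location G copies)
      target : Configuration G copies

  TargetedReconfiguration : Problem
  TargetedReconfiguration = record
    { Instance = TargetedReconfigurationInstance
    ; encode   = λ x → let open TargetedReconfigurationInstance x in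
                   system G sys ++ sequence (location G) starts ++ configuration G target
    ; Yes      = λ x → let open TargetedReconfigurationInstance x in
                   Star (Move G sys) (initialConfiguration G sys starts) target
    }

{-# OPTIONS --safe #-}
-- A robot stands for a vector of tokens, and two robots meeting at a door turn
-- x + y into z, or x into y + z, where the spawner supplies and swallows robots
-- that stand for nothing.  Tokens are traded for tokens worth twice as much along
-- the digits of every number, so that a rule with binary coefficients needs one
-- door per digit to pay and one to trade: a control robot collects the left side of
-- the rule, becomes a robot that owes the right side at a single one-way door, and
-- hands that out.  Every walk and every passage preserves the total weight, except
-- the passage through that one door, which fires the rule; hence the robots can
-- do no more than the net.  The doors are indexed by the positions in the encoding
-- of the net, so a machine that scans it with a few binary counters writes the
-- system down.
module Submission where

open import Defs
open import Data.Bool.Base using (Bool; true; false; if_then_else_)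
open import Data.Fin.Base using (Fin; zero; suc; toℕ)
open import Data.Fin.Patterns using (0F; 1F; 2F; 3F; 4F; 5F)
open import Data.Fin.Properties using (+↔⊎; 1↔⊤; _≟_; toℕ-fromℕ<; toℕ<n)
open import Data.List.Base as List using (List; []; _∷_; [_]; _++_; _ʳ++_; length; reverse; concatMap; replicate; foldr)
open import Data.List.Membership.Propositional using (_∈_)
open import Data.List.Membership.Propositional.Properties using (∈-++⁺ˡ; ∈-++⁺ʳ; ∈-map⁺)
open import Data.List.Properties using (++-assoc; ++-identityʳ; length-map; length-++; length-reverse; map-ʳ++; ʳ++-ʳ++; ʳ++-defn; ++-ʳ++; concatMap-++; foldr-++)
open import Data.List.Relation.Binary.Permutation.Propositional using (_↭_; prep; swap; ↭-sym; ↭-reflexive) renaming (refl to unchanged; trans to transitive)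
open import Data.List.Relation.Binary.Permutation.Propositional.Properties using (++-comm; ++⁺ˡ; ++⁺; shifts)
open import Data.List.Relation.Unary.All as All using (All; []; _∷_)
open import Data.List.Relation.Unary.All.Properties using (map⁺) renaming (++⁺ to all-++)
open import Data.List.Relation.Unary.Any using (here; there)
open import Data.Maybe.Base using (Maybe; just; nothing)
open import Data.Nat.Base using (ℕ; zero; suc; pred; _+_; _*_; _∸_; _≤_; _<_; z≤n; s≤s; _≡ᵇ_)
open import Data.Nat.Binary.Base as Bin using (ℕᵇ; 2[1+_]; 1+[2_])
open import Data.Nat.Binary.Properties using (fromℕ≡fromℕ'; fromℕ-toℕ; toℕ-fromℕ)
open import Data.Nat.DivMod using (_mod_; m<n⇒m%n≡m)
open import Data.Nat.Properties hiding (_≟_)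
open import Data.Nat.Solver using (module +-*-Solver)
open import Data.Product.Base using (Σ; ∃-syntax; _×_; _,_; proj₁; proj₂)
open import Data.Sum.Base using (_⊎_; inj₁; inj₂; map₁)
open import Data.Sum.Function.Propositional using (_⊎-↔_)
open import Data.Unit.Base using (⊤; tt)
open import Data.Vec.Base as Vec using (Vec; []; _∷_; zipWith; lookup; toList; updateAt; _[_]≔_)
open import Data.Vec.Properties using (lookup-map; lookup-zipWith; lookup-replicate; lookup∘update; lookup∘updateAt; lookup∘updateAt′; []≔-idempotent; []≔-lookup; tabulate∘lookup; tabulate-cong)
open import Data.Vec.Relation.Binary.Pointwise.Inductive using (Pointwise; []; _∷_)
open import Function.Base using (_∘_; id)
open import Function.Bundles using (_↔_; mk↔ₛ′; mk⇔)
open import Function.Properties.Inverse using (↔-sym; ↔-trans)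
open import Relation.Binary.Construct.Closure.ReflexiveTransitive using (Star; ε; _◅_; _◅◅_)
open import Relation.Binary.PropositionalEquality hiding ([_])
open import Relation.Nullary.Decidable.Core using (yes; no)

open +-*-Solver using (solve; _:+_; _:*_; con; _:=_)

-- Structured programs for Turing machines

-- Counts are written in binary, whereas starting robots are listed one by one, so the tokens of the
-- initial configuration cannot be listed as robots in polynomial time. Hence a single starting
-- robot stands for the whole initial vector and scatters it like the right side of a rule. Dually
-- the target vector is gathered into one robot at `end`, so the target configuration depends on the
-- length of the input only.
--
-- The player may run several control robots at once, abandon a rule half-way, walk backwards or
-- leave doors open, so no invariant can describe what the robots are up to. A weight for each dish,
-- attached to every location and to every open door, is indifferent to all of this. Firing is sound
-- because payment comes first: a robot that stands at the one-way door carries the whole left side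
-- alone, so the net owns at least these tokens. In the converse direction each door is operated
-- through both of its passages in turn; every completed manoeuvre therefore leaves all doors in
-- their initial state, and manoeuvres can be chained freely.

Finite : Set → Set
Finite A = ∃[ n ] (A ↔ Fin n)

finite-⊤ : Finite ⊤
finite-⊤ = 1 , ↔-sym 1↔⊤

finite-⊎ : ∀ {A B} → Finite A → Finite B → Finite (A ⊎ B)
finite-⊎ (m , f) (n , g) = m + n , ↔-trans (f ⊎-↔ g) (↔-sym +↔⊎)

pattern cell₁ = just digit₁
pattern cell₂ = just digit₂
pattern cell₃ = just comma
pattern cell₄ = just semicolon
pattern cell₅ = just bar

module _ (F : Cell → Set) where

  private
    Branches : Set
    Branches = F nothing ⊎ (F cell₁ ⊎ (F cell₂ ⊎ (F cell₃ ⊎ (F cell₄ ⊎ F cell₅))))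

    to : Σ Cell F → Branches
    to (nothing , s) = inj₁ s
    to (cell₁ , s)   = inj₂ (inj₁ s)
    to (cell₂ , s)   = inj₂ (inj₂ (inj₁ s))
    to (cell₃ , s)   = inj₂ (inj₂ (inj₂ (inj₁ s)))
    to (cell₄ , s)   = inj₂ (inj₂ (inj₂ (inj₂ (inj₁ s))))
    to (cell₅ , s)   = inj₂ (inj₂ (inj₂ (inj₂ (inj₂ s))))

    from : Branches → Σ Cell F
    from (inj₁ s)                             = nothing , s
    from (inj₂ (inj₁ s))                      = cell₁ , s
    from (inj₂ (inj₂ (inj₁ s)))               = cell₂ , s
    from (inj₂ (inj₂ (inj₂ (inj₁ s))))        = cell₃ , s
    from (inj₂ (inj₂ (inj₂ (inj₂ (inj₁ s))))) = cell₄ , s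
    from (inj₂ (inj₂ (inj₂ (inj₂ (inj₂ s))))) = cell₅ , s

    to∘from : ∀ b → to (from b) ≡ b
    to∘from (inj₁ s)                             = refl
    to∘from (inj₂ (inj₁ s))                      = refl
    to∘from (inj₂ (inj₂ (inj₁ s)))               = refl
    to∘from (inj₂ (inj₂ (inj₂ (inj₁ s))))        = refl
    to∘from (inj₂ (inj₂ (inj₂ (inj₂ (inj₁ s))))) = refl
    to∘from (inj₂ (inj₂ (inj₂ (inj₂ (inj₂ s))))) = refl

    from∘to : ∀ a → from (to a) ≡ a
    from∘to (nothing , s) = refl
    from∘to (cell₁ , s)   = refl
    from∘to (cell₂ , s)   = refl
    from∘to (cell₃ , s)   = refl
    from∘to (cell₄ , s)   = refl
    from∘to (cell₅ , s)   = refl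

  finite-cells : (∀ c → Finite (F c)) → Finite (Σ Cell F)
  finite-cells fin =
    let n , f = finite-⊎ (fin nothing) (finite-⊎ (fin cell₁) (finite-⊎ (fin cell₂)
                  (finite-⊎ (fin cell₃) (finite-⊎ (fin cell₄) (fin cell₅)))))
    in n , ↔-trans (mk↔ₛ′ to from to∘from from∘to) f

infixr 5 _⨾_

data Program (t : ℕ) : Set where
  on     : Fin t → (Cell → Cell × Direction) → Program t
  _⨾_    : Program t → Program t → Program t
  switch : Fin t → (Cell → Program t) → Program t
  while  : Fin t → (Cell → Bool) → Program t → Program t

module _ {t : ℕ} where

  scan : Fin t → Vec Tape t → Cell
  scan i ts = Tape.head (lookup ts i)

  -- The number is an upper bound on the number of steps.
  data Exec : Program t → Vec Tape t → ℕ → Vec Tape t → Set where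
    on     : ∀ {i f ts} → Exec (on i f) ts 1 (ts [ i ]≔ writeAndMove (f (scan i ts)) (lookup ts i))
    _⨾_    : ∀ {P Q ts ts′ ts″ k l} → Exec P ts k ts′ → Exec Q ts′ l ts″ →
             Exec (P ⨾ Q) ts (k + l) ts″
    switch : ∀ {i f ts ts′ k} → Exec (f (scan i ts)) ts k ts′ → Exec (switch i f) ts (suc k) ts′
    again  : ∀ {i b P ts ts′ ts″ k l} → b (scan i ts) ≡ true → Exec P ts k ts′ →
             Exec (while i b P) ts′ l ts″ → Exec (while i b P) ts (suc (k + l)) ts″
    done   : ∀ {i b P ts} → b (scan i ts) ≡ false → Exec (while i b P) ts 1 ts
    weaken : ∀ {P ts ts′ k l} → k ≤ l → Exec P ts k ts′ → Exec P ts l ts′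

  -- The states are the points of the syntax tree. Inside a `switch` the state keeps the cell that
  -- selected the branch, because the type of the points depends on it.
  State : Program t → Set
  State (on i f)      = ⊤
  State (P ⨾ Q)       = State P ⊎ State Q
  State (switch i f)  = ⊤ ⊎ Σ Cell λ c → State (f c)
  State (while i b P) = ⊤ ⊎ State P

  finite-State : ∀ P → Finite (State P)
  finite-State (on i f)      = finite-⊤
  finite-State (P ⨾ Q)       = finite-⊎ (finite-State P) (finite-State Q)
  finite-State (switch i f)  = finite-⊎ finite-⊤ (finite-cells _ λ c → finite-State (f c))
  finite-State (while i b P) = finite-⊎ finite-⊤ (finite-State P)

  entry : ∀ P → State P
  entry (on i f)      = tt
  entry (P ⨾ Q)       = inj₁ (entry P)
  entry (switch i f)  = inj₁ tt
  entry (while i b P) = inj₁ tt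

  Heads Actions : Set
  Heads   = Vec Cell t
  Actions = Vec (Cell × Direction) t

  idle : Heads → Actions
  idle = Vec.map (_, stay)

  -- A subprogram ends together with its last action, and control passes on within that same step.
  -- Sequencing is thus free and time bounds add up; only tests cost a step of their own.
  resume : {A B : Set} → (A → B) → B → (A ⊎ ⊤) × Actions → (B ⊎ ⊤) × Actions
  resume f b (inj₁ a , as) = inj₁ (f a) , as
  resume f b (inj₂ _ , as) = inj₁ b , as

  next : ∀ P → State P → Heads → (State P ⊎ ⊤) × Actions
  next (on i f)      _                hs = inj₂ tt , idle hs [ i ]≔ f (lookup hs i)
  next (P ⨾ Q)       (inj₁ s)         hs = resume inj₁ (inj₂ (entry Q)) (next P s hs)
  next (P ⨾ Q)       (inj₂ s)         hs = let s′ , as = next Q s hs in map₁ inj₂ s′ , as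
  next (switch i f)  (inj₁ _)         hs = inj₁ (inj₂ (lookup hs i , entry (f (lookup hs i)))) , idle hs
  next (switch i f)  (inj₂ (c , s))   hs = let s′ , as = next (f c) s hs in map₁ (λ s → inj₂ (c , s)) s′ , as
  next (while i b P) (inj₁ _)         hs =
    (if b (lookup hs i) then inj₁ (inj₂ (entry P)) else inj₂ tt) , idle hs
  next (while i b P) (inj₂ s)         hs = resume inj₂ (inj₁ tt) (next P s hs)

  act : Actions → Vec Tape t → Vec Tape t
  act = zipWith writeAndMove

  heads : Vec Tape t → Heads
  heads = Vec.map Tape.head

  data Path (P : Program t) : State P → Vec Tape t → ℕ → Vec Tape t → Set where
    exit : ∀ {s ts as} → next P s (heads ts) ≡ (inj₂ tt , as) → Path P s ts 1 (act as ts)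
    step : ∀ {s ts s′ as k ts′} → next P s (heads ts) ≡ (inj₁ s′ , as) →
           Path P s′ (act as ts) k ts′ → Path P s ts (suc k) ts′

act-idle : ∀ {t} (ts : Vec Tape t) → act (idle (heads ts)) ts ≡ ts
act-idle []       = refl
act-idle (t ∷ ts) = cong (t ∷_) (act-idle ts)

act-on : ∀ {t} (i : Fin t) (f : Cell → Cell × Direction) (ts : Vec Tape t) →
         act (idle (heads ts) [ i ]≔ f (lookup (heads ts) i)) ts
           ≡ ts [ i ]≔ writeAndMove (f (scan i ts)) (lookup ts i)
act-on zero    f (t ∷ ts) = cong (writeAndMove (f (Tape.head t)) t ∷_) (act-idle ts)
act-on (suc i) f (t ∷ ts) = cong (t ∷_) (act-on i f ts)

module _ {t : ℕ} where

  private
    variable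
      P Q : Program t
      ts ts′ ts″ : Vec Tape t
      k l : ℕ

  path-⨾ʳ : ∀ {s} → Path Q s ts k ts′ → Path (P ⨾ Q) (inj₂ s) ts k ts′
  path-⨾ʳ (exit e)   = exit (cong (λ (s , as) → map₁ inj₂ s , as) e)
  path-⨾ʳ (step e p) = step (cong (λ (s , as) → map₁ inj₂ s , as) e) (path-⨾ʳ p)

  path-⨾ : ∀ {s} → Path P s ts k ts′ → Path Q (entry Q) ts′ l ts″ →
           Path (P ⨾ Q) (inj₁ s) ts (k + l) ts″
  path-⨾ (exit e)   q = step (cong (resume _ _) e) (path-⨾ʳ q)
  path-⨾ (step e p) q = step (cong (resume _ _) e) (path-⨾ p q)

  path-switch : ∀ {i f c s} → Path (f c) s ts k ts′ → Path (switch i f) (inj₂ (c , s)) ts k ts′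
  path-switch (exit e)   = exit (cong (λ (s , as) → map₁ (λ s → inj₂ (_ , s)) s , as) e)
  path-switch (step e p) = step (cong (λ (s , as) → map₁ (λ s → inj₂ (_ , s)) s , as) e) (path-switch p)

  path-while : ∀ {i b s} → Path P s ts k ts′ → Path (while i b P) (inj₁ tt) ts′ l ts″ →
               Path (while i b P) (inj₂ s) ts (k + l) ts″
  path-while (exit e)   q = step (cong (resume _ _) e) q
  path-while (step e p) q = step (cong (resume _ _) e) (path-while p q)

  path-idle : ∀ {s} → Path P s ts k ts′ → Path P s (act (idle (heads ts)) ts) k ts′
  path-idle {P = P} {ts} {k} {ts′} {s} = subst (λ ts → Path P s ts k ts′) (sym (act-idle ts))

  -- Because of `weaken`, `Exec` knows time only up to an upper bound, while a machine run counts
  -- exactly; the true count is recovered along the derivation.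
  exec-path : Exec P ts k ts′ → ∃[ l ] l ≤ k × Path P (entry P) ts l ts′
  exec-path (on {i} {f} {ts}) = 1 , ≤-refl , subst (Path _ _ _ _) (act-on i f ts) (exit refl)
  exec-path (p ⨾ q) =
    let k , k≤ , p′ = exec-path p
        l , l≤ , q′ = exec-path q
    in k + l , +-mono-≤ k≤ l≤ , path-⨾ p′ q′
  exec-path {ts = ts} (switch {i} {f} p) =
    let k , k≤ , p′ = exec-path p
    in suc k , s≤s k≤ ,
       step (cong (λ c → inj₁ (inj₂ (c , entry (f c))) , idle (heads ts)) (lookup-map i Tape.head ts))
            (path-idle (path-switch p′))
  exec-path {ts = ts} (again {i} {b} {P} e p q) =
    let k , k≤ , p′ = exec-path p
        l , l≤ , q′ = exec-path q
    in suc (k + l) , s≤s (+-mono-≤ k≤ l≤) ,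
       step (cong (λ c → (if c then inj₁ (inj₂ (entry P)) else inj₂ tt) , idle (heads ts))
                  (trans (cong b (lookup-map i Tape.head ts)) e))
            (path-idle (path-while p′ q′))
  exec-path {ts = ts} (done {i} {b} {P} e) =
    1 , ≤-refl ,
    subst (Path _ _ _ _) (act-idle ts)
      (exit (cong (λ c → (if c then inj₁ (inj₂ (entry P)) else inj₂ tt) , idle (heads ts))
                  (trans (cong b (lookup-map i Tape.head ts)) e)))
  exec-path (weaken k≤l p) = let j , j≤k , p′ = exec-path p in j , ≤-trans j≤k k≤l , p′

module _ {n : ℕ} (P : Program (2 + n)) where

  private
    continue : (State P ⊎ ⊤) × Actions → Maybe (State P) × Vec (Cell × Direction) (2 + n)
    continue (inj₁ s , as) = just s , as
    continue (inj₂ _ , as) = nothing , as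

  machine : TuringMachine
  machine = record
    { State     = Maybe (State P)
    ; finite    = let m , f = finite-⊎ finite-⊤ (finite-State P) in
                  m , ↔-trans (mk↔ₛ′ (λ { nothing → inj₁ tt ; (just s) → inj₂ s })
                                     (λ { (inj₁ _) → nothing ; (inj₂ s) → just s })
                                     (λ { (inj₁ _) → refl ; (inj₂ _) → refl })
                                     (λ { nothing → refl ; (just _) → refl })) f
    ; start     = just (entry P)
    ; workTapes = n
    ; δ         = λ { nothing _ → nothing ; (just s) hs → just (continue (next P s hs)) }
    }

  path-run : ∀ {s ts k ts′} → Path P s ts k ts′ →
             Run machine (snapshot (just s) ts) k (snapshot nothing ts′)
  path-run (exit e)   = step (cong (λ r → just (continue r)) e) (halt refl)
  path-run (step e p) = step (cong (λ r → just (continue r)) e) (path-run p)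

-- Numbers on tapes

all-ʳ++ : ∀ {A : Set} {P : A → Set} {xs ys} → All P xs → All P ys → All P (xs ʳ++ ys)
all-ʳ++ []         qs = qs
all-ʳ++ (p ∷ ps) qs = all-ʳ++ ps (p ∷ qs)

put : ∀ {t} → Fin t → Cell → Direction → Program t
put i c d = on i λ _ → c , d

shift : ∀ {t} → Fin t → Direction → Program t
shift i d = on i (_, d)

copyHead : ∀ {t} → Fin t → Fin t → Program t
copyHead i o = switch i λ c → put o c rightwards

nonblank notBar notComma isDigit₂ : Cell → Bool
nonblank (just _) = true
nonblank nothing  = false
notBar (just bar) = false
notBar _          = true
notComma (just comma) = false
notComma _            = true
isDigit₂ (just digit₂) = true
isDigit₂ _             = false

rewind : ∀ {t} → Fin t → (Cell → Bool) → Program t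
rewind i b = while i b (shift i leftwards) ⨾ shift i rightwards

returnHome : ∀ {t} → Fin t → Program t
returnHome i = shift i leftwards ⨾ rewind i nonblank

settleCarry : ∀ {t} → Fin t → Cell → Program t
settleCarry i (just digit₁) = put i cell₂ stay
settleCarry i _             = put i cell₁ rightwards ⨾ put i cell₃ stay

increment : ∀ {t} → Fin t → Program t
increment i =
  while i isDigit₂ (put i cell₁ rightwards) ⨾
  switch i (settleCarry i) ⨾
  rewind i notBar

printCounter : ∀ {t} → Fin t → Fin t → Program t
printCounter i o =
  while i notComma (copyHead i o ⨾ shift i rightwards) ⨾
  copyHead i o ⨾
  rewind i notBar

-- One name for the tape reached by a step to the right, whether or not the recorded cells have run
-- out.
zipper : List Cell → List Cell → Tape
zipper l []      = tape l blank []
zipper l (c ∷ r) = tape l c r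

cells : Word → List Cell
cells = List.map just

-- A bar to the left of the digits, a comma after them, and anything beyond.
counterCells : ℕᵇ → List Cell → List Cell
counterCells b junk = cells (digits b) ++ cell₃ ∷ junk

counterᵇ : ℕᵇ → List Cell → Tape
counterᵇ b junk = zipper [ cell₅ ] (counterCells b junk)

outputTape : Word → Tape
outputTape os = tape (cells os) blank []

size : ℕᵇ → ℕ
size b = length (digits b)

right-zipper : ∀ l c r → move rightwards (tape l c r) ≡ zipper (c ∷ l) r
right-zipper l c []      = refl
right-zipper l c (_ ∷ _) = refl

module _ {t : ℕ} where

  reaching : ∀ {P : Program t} {ts ts′ ts″ k} → ts′ ≡ ts″ → Exec P ts k ts′ → Exec P ts k ts″
  reaching refl e = e

  starting : ∀ {P : Program t} {ts ts′ ts″ k} → ts ≡ ts′ → Exec P ts′ k ts″ → Exec P ts k ts″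
  starting refl e = e

  -- With all tapes displayed, reading and writing one of them computes, so both laws hold by
  -- `refl`. A routine on one tape is then verified once and used on several.
  record Lens (i : Fin t) (plug : Tape → Vec Tape t) : Set where
    field
      get : ∀ x → lookup (plug x) i ≡ x
      set : ∀ x y → plug x [ i ]≔ y ≡ plug y

  module Focus {i plug} (lens : Lens i plug) where
    open Lens lens

    focus-on : ∀ {f x} → Exec (on i f) (plug x) 1 (plug (writeAndMove (f (Tape.head x)) x))
    focus-on {f} {x} = subst (Exec (on i f) (plug x) 1) eq on
      where
      eq : plug x [ i ]≔ writeAndMove (f (scan i (plug x))) (lookup (plug x) i)
             ≡ plug (writeAndMove (f (Tape.head x)) x)
      eq rewrite get x = set x _

    focus-switch : ∀ {f x k ts} → Exec (f (Tape.head x)) (plug x) k ts →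
                   Exec (switch i f) (plug x) (suc k) ts
    focus-switch {f} {x} {k} {ts} e = switch (subst (λ y → Exec (f (Tape.head y)) (plug x) k ts) (sym (get x)) e)

    focus-again : ∀ {b P x ts ts′ k l} → b (Tape.head x) ≡ true → Exec P (plug x) k ts →
                  Exec (while i b P) ts l ts′ → Exec (while i b P) (plug x) (suc (k + l)) ts′
    focus-again {b} {x = x} e = again (trans (cong (b ∘ Tape.head) (get x)) e)

    focus-done : ∀ {b P x} → b (Tape.head x) ≡ false → Exec (while i b P) (plug x) 1 (plug x)
    focus-done {b} {x = x} e = done (trans (cong (b ∘ Tape.head) (get x)) e)

    focus-right : ∀ {l c r} → Exec (shift i rightwards) (plug (tape l c r)) 1 (plug (zipper (c ∷ l) r))
    focus-right {l} {c} {r} =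
      subst (λ y → Exec (shift i rightwards) (plug (tape l c r)) 1 (plug y)) (right-zipper l c r) focus-on

    focus-put-right : ∀ {l c c′ r} → Exec (put i c′ rightwards) (plug (tape l c r)) 1 (plug (zipper (c′ ∷ l) r))
    focus-put-right {l} {c} {c′} {r} =
      subst (λ y → Exec (put i c′ rightwards) (plug (tape l c r)) 1 (plug y)) (right-zipper l c′ r) focus-on

    -- The marker `m` at which the loop stops may be a recorded cell or, if it is blank, lie beyond
    -- the recorded cells; `∙left` covers both.
    rewind-exec : ∀ {b m l₀} (∙left : ∀ x r → move leftwards (tape l₀ x r) ≡ tape [] m (x ∷ r)) →
                  b m ≡ false → ∀ {ls c r} → All (λ c → b c ≡ true) ls → b c ≡ true →
                  Exec (rewind i b) (plug (tape (ls ++ l₀) c r)) (length ls * 2 + 4)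
                       (plug (zipper [ m ] (ls ʳ++ c ∷ r)))
    rewind-exec {b} {m} {l₀} ∙left bm {ls} {c} {r} all bc =
      weaken (≤-reflexive (+-assoc (length ls * 2) 3 1)) (loop all bc ⨾ focus-right)
      where
      loop : ∀ {ls c r} → All (λ c → b c ≡ true) ls → b c ≡ true →
             Exec (while i b (shift i leftwards)) (plug (tape (ls ++ l₀) c r)) (length ls * 2 + 3)
                  (plug (tape [] m (ls ʳ++ c ∷ r)))
      loop {c = c} {r} [] bc = focus-again bc
        (subst (λ y → Exec (shift i leftwards) (plug (tape l₀ c r)) 1 (plug y)) (∙left c r) focus-on)
        (focus-done bm)
      loop (b∷ ∷ all) bc = focus-again bc focus-on (loop all b∷)

    rewind-bar : ∀ {ls c r} → All (λ c → notBar c ≡ true) ls → notBar c ≡ true →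
                 Exec (rewind i notBar) (plug (tape (ls ++ [ cell₅ ]) c r)) (length ls * 2 + 4)
                      (plug (zipper [ cell₅ ] (ls ʳ++ c ∷ r)))
    rewind-bar = rewind-exec (λ _ _ → refl) refl

    returnHome-exec : ∀ {l₀} → (∀ x r → move leftwards (tape l₀ x r) ≡ tape [] blank (x ∷ r)) → ∀ w →
                      Exec (returnHome i) (plug (tape (cells w ++ l₀) blank [])) (length w * 2 + 5)
                           (plug (zipper [ blank ] (cells w ʳ++ [ blank ])))
    returnHome-exec {l₀} ∙left [] = weaken (s≤s (s≤s (s≤s z≤n)))
      (subst (λ y → Exec (shift i leftwards) (plug (tape l₀ blank [])) 1 (plug y)) (∙left blank []) focus-on
       ⨾ (focus-done refl ⨾ focus-right))
    returnHome-exec {l₀} ∙left (s ∷ w) =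
      weaken (≤-trans (≤-reflexive (cong (λ n → suc (n * 2 + 4)) (length-map just w)))
                      (≤-trans (n≤1+n _) (s≤s (s≤s (+-monoʳ-≤ (length w * 2) (s≤s (s≤s (s≤s (s≤s z≤n)))))))))
        (focus-on ⨾ rewind-exec ∙left refl {ls = cells w} (nonblank-cells w) refl)
      where
      nonblank-cells : ∀ w → All (λ c → nonblank c ≡ true) (cells w)
      nonblank-cells []      = []
      nonblank-cells (_ ∷ w) = refl ∷ nonblank-cells w

    notBar-digits : ∀ b → All (λ c → notBar c ≡ true) (cells (digits b))
    notBar-digits Bin.zero  = []
    notBar-digits 1+[2 b ]  = refl ∷ notBar-digits b
    notBar-digits 2[1+ b ]  = refl ∷ notBar-digits b

    -- The successor in bijective base 2 turns the low-order 2s into 1s, and then a 1 into a 2 or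
    -- the terminator into a 1 with a fresh terminator behind it. The fresh terminator may overwrite
    -- a cell of `junk`, hence `junk′`. The cells in `ls` have been rippled over already.
    record Carried (ls : List Cell) (b : ℕᵇ) (junk : List Cell) : Set where
      field
        {mid}           : Vec Tape t
        {ls′ r′ junk′}  : List Cell
        {c′}            : Cell
        ripple          : Exec (while i isDigit₂ (put i cell₁ rightwards))
                               (plug (zipper (ls ++ [ cell₅ ]) (counterCells b junk)))
                               (size b * 2 + 1) mid
        settle          : Exec (switch i (settleCarry i)) mid 3 (plug (tape (ls′ ++ [ cell₅ ]) c′ r′))
        no-bar          : All (λ c → notBar c ≡ true) ls′
        no-bar′         : notBar c′ ≡ true
        short           : length ls′ ≤ length ls + suc (size b)
        result          : ls′ ʳ++ c′ ∷ r′ ≡ ls ʳ++ counterCells (Bin.suc b) junk′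

    carry : ∀ {ls} b junk → All (λ c → notBar c ≡ true) ls → Carried ls b junk
    carry {ls} Bin.zero [] all = record
      { ripple = focus-done refl ; settle = focus-switch (focus-on ⨾ focus-on) ; no-bar = refl ∷ all
      ; no-bar′ = refl ; short = ≤-reflexive (+-comm 1 (length ls)) ; result = refl }
    carry {ls} Bin.zero (_ ∷ junk) all = record
      { ripple = focus-done refl ; settle = focus-switch (focus-on ⨾ focus-on) ; no-bar = refl ∷ all
      ; no-bar′ = refl ; short = ≤-reflexive (+-comm 1 (length ls)) ; result = refl }
    carry 1+[2 b ] junk all = record
      { ripple = weaken (s≤s z≤n) (focus-done refl)
      ; settle = weaken (s≤s (s≤s z≤n)) (focus-switch focus-on) ; no-bar = all
      ; no-bar′ = refl ; short = m≤m+n _ _ ; result = refl }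
    carry {ls} 2[1+ b ] junk all =
      let open Carried (carry {cell₁ ∷ ls} b junk (refl ∷ all)) in record
      { ripple = focus-again refl focus-put-right ripple ; settle = settle ; no-bar = no-bar
      ; no-bar′ = no-bar′ ; short = ≤-trans short (≤-reflexive (sym (+-suc (length ls) _))) ; result = result }

    increment-exec : ∀ b junk → ∃[ junk′ ] Exec (increment i) (plug (counterᵇ b junk)) (size b * 4 + 10)
                                                (plug (counterᵇ (Bin.suc b) junk′))
    increment-exec b junk =
      let open Carried (carry {[]} b junk []) in
      junk′ , weaken (bound short)
        (ripple ⨾ settle ⨾ reaching (cong (plug ∘ zipper [ cell₅ ]) result) (rewind-bar no-bar no-bar′))
      where
      bound : ∀ {n} → n ≤ suc (size b) → size b * 2 + 1 + (3 + (n * 2 + 4)) ≤ size b * 4 + 10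
      bound n≤ = ≤-trans (+-monoʳ-≤ (size b * 2 + 1) (+-monoʳ-≤ 3 (+-monoˡ-≤ 4 (*-monoˡ-≤ 2 n≤))))
        (≤-reflexive (solve 1 (λ z → z :* con 2 :+ con 1 :+ (con 3 :+ ((con 1 :+ z) :* con 2 :+ con 4))
                                     := z :* con 4 :+ con 10) refl (size b)))

  module Focus₂ {i o : Fin t} {plug : Tape → Tape → Vec Tape t}
                (lensᵢ : ∀ y → Lens i λ x → plug x y) (lensₒ : ∀ x → Lens o (plug x)) where

    private
      module I y = Focus (lensᵢ y)
      module O x = Focus (lensₒ x)

    copyHead-exec : ∀ {l s r os} → Exec (copyHead i o) (plug (tape l (just s) r) (outputTape os)) 2
                                        (plug (tape l (just s) r) (outputTape (s ∷ os)))
    copyHead-exec = I.focus-switch _ (O.focus-on _)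

    printCounter-exec : ∀ b {junk os} →
      Exec (printCounter i o) (plug (counterᵇ b junk) (outputTape os)) (size b * 6 + 7)
           (plug (counterᵇ b junk) (outputTape ((digits b ++ [ comma ]) ʳ++ os)))
    printCounter-exec b {junk} {os} =
      weaken (≤-reflexive bound)
        (loop b
         ⨾ copyHead-exec
         ⨾ reaching (cong₂ (λ r os → plug (zipper [ cell₅ ] r) (outputTape os))
                           (ʳ++-ʳ++ ds) (sym (++-ʳ++ (digits b))))
             (subst (λ l → Exec (rewind i notBar) (plug (tape l cell₃ junk) (outputTape (comma ∷ digits b ʳ++ os)))
                                (length (reverse ds) * 2 + 4)
                                (plug (zipper [ cell₅ ] (reverse ds ʳ++ cell₃ ∷ junk))
                                      (outputTape (comma ∷ digits b ʳ++ os))))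
                    (sym (ʳ++-defn ds))
                    (I.rewind-bar _ (all-ʳ++ (notBar-digits b) []) refl)))
      where
      ds : List Cell
      ds = cells (digits b)
      notBar-digits : ∀ b → All (λ c → notBar c ≡ true) (cells (digits b))
      notBar-digits = I.notBar-digits (outputTape [])
      bound : size b * 4 + 1 + (2 + (length (reverse ds) * 2 + 4)) ≡ size b * 6 + 7
      bound rewrite length-reverse ds | length-map {B = Cell} just (digits b) =
        solve 1 (λ z → z :* con 4 :+ con 1 :+ (con 2 :+ (z :* con 2 :+ con 4)) := z :* con 6 :+ con 7)
              refl (size b)
      loop : ∀ b {l os} →
        Exec (while i notComma (copyHead i o ⨾ shift i rightwards))
             (plug (zipper l (counterCells b junk)) (outputTape os)) (size b * 4 + 1)
             (plug (tape (cells (digits b) ʳ++ l) cell₃ junk) (outputTape (digits b ʳ++ os)))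
      loop Bin.zero = I.focus-done _ refl
      loop 1+[2 b ] = I.focus-again _ refl (copyHead-exec ⨾ I.focus-right _) (loop b)
      loop 2[1+ b ] = I.focus-again _ refl (copyHead-exec ⨾ I.focus-right _) (loop b)

-- Scanning an instance with counters

data Stage : Set where
  loop once : Stage

-- The left sides of the rules are read in mode gathers loop, the right sides in
-- mode scatters loop, the initial configuration in mode scatters once, and the
-- target in mode gathers once.
data Mode : Set where
  gathers scatters : Stage → Mode

nextMode : Symbol → Mode → Mode
nextMode semicolon (gathers loop)  = scatters loop
nextMode semicolon (scatters loop) = gathers loop
nextMode semicolon (scatters once) = gathers once
nextMode bar       (gathers loop)  = scatters once
nextMode _         m               = m

nextDish : Symbol → ℕ → ℕ
nextDish digit₁    a = a
nextDish digit₂    a = a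
nextDish comma     a = suc a
nextDish semicolon a = 0
nextDish bar       a = 0

nextLevel : Symbol → ℕ → ℕ
nextLevel digit₁ v = v + v
nextLevel digit₂ v = v + v
nextLevel _      v = 1

at : ℕ → ℕ → ℕ → ℕ
at a v x = if a ≡ᵇ x then v else 0

nextConsumed : Symbol → ℕ → ℕ → (ℕ → ℕ) → ℕ → ℕ
nextConsumed digit₁ a v u x = u x + at a v x
nextConsumed digit₂ a v u x = u x + at a (v + v) x
nextConsumed comma  a v u x = u x
nextConsumed _      a v u x = 0

-- Where a scan of the instance stands: the next digit has the given
-- weight in the entry of dish, and the part of the vector already read is
-- consumed.
record Cursor : Set where
  constructor cursor
  field
    mode     : Mode
    position : ℕ
    dish     : ℕ
    weight   : ℕ
    consumed : ℕ → ℕ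

open Cursor

advance : Symbol → Cursor → Cursor
advance x (cursor m p a v u) =
  cursor (nextMode x m) (suc p) (nextDish x a) (nextLevel x v) (nextConsumed x a v u)

origin : Cursor
origin = cursor (gathers loop) 0 0 1 (λ _ → 0)

sweep : {A : Set} → (Cursor → Symbol → List A) → Cursor → Word → List A
sweep f c []      = []
sweep f c (x ∷ w) = f c x ++ sweep f (advance x c) w

-- A link names only gadgets of the current position, of the next one, or of the current dish.
-- Separate counters for a position and its successor spare the machine any arithmetic while
-- printing.
data Emit : Set where
  print               : Symbol → Emit
  here-no next-no dish-no : Emit

emitted : ℕ → ℕ → Emit → Word
emitted p a (print s) = s ∷ []
emitted p a here-no   = number p
emitted p a next-no   = number (suc p)
emitted p a dish-no   = number a

expand : ℕ → ℕ → List Emit → Word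
expand p a = concatMap (emitted p a)

Table : Set
Table = Mode → Symbol → List Emit

entryWord : Table → Cursor → Symbol → Word
entryWord tbl c x = expand (position c) (nextDish x (dish c)) (tbl (mode c) x)

fromℕ-suc : ∀ n → Bin.fromℕ (suc n) ≡ Bin.suc (Bin.fromℕ n)
fromℕ-suc n rewrite fromℕ≡fromℕ' (suc n) | fromℕ≡fromℕ' n = refl

size-suc : ∀ b → size (Bin.suc b) ≤ suc (size b)
size-suc Bin.zero  = ≤-refl
size-suc 1+[2 b ]  = n≤1+n _
size-suc 2[1+ b ]  = s≤s (size-suc b)

-- The size is in fact logarithmic, but the counters exceed the input length by at most one, so this
-- crude bound already keeps the running time polynomial.
size-fromℕ : ∀ n → size (Bin.fromℕ n) ≤ n
size-fromℕ zero    = z≤n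
size-fromℕ (suc n) rewrite fromℕ-suc n = ≤-trans (size-suc (Bin.fromℕ n)) (s≤s (size-fromℕ n))

counterTape : ℕ → List Cell → Tape
counterTape n = counterᵇ (Bin.fromℕ n)

-- The mode lives on a tape of its own, which makes a whole sweep a single loop instead of one loop
-- per mode.
modeSymbol : Mode → Symbol
modeSymbol (gathers loop)  = digit₁
modeSymbol (scatters loop) = digit₂
modeSymbol (scatters once) = comma
modeSymbol (gathers once)  = semicolon

cellMode : Cell → Mode
cellMode (just digit₁) = gathers loop
cellMode (just digit₂) = scatters loop
cellMode (just comma)  = scatters once
cellMode _             = gathers once

cellMode-modeSymbol : ∀ m → cellMode (just (modeSymbol m)) ≡ m
cellMode-modeSymbol (gathers loop)  = refl
cellMode-modeSymbol (scatters loop) = refl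
cellMode-modeSymbol (scatters once) = refl
cellMode-modeSymbol (gathers once)  = refl

pattern inputTape  = 0F
pattern outTape    = 1F
pattern hereTape   = 2F
pattern nextTape   = 3F
pattern dishTape   = 4F
pattern modeTape   = 5F

Tapes : Set
Tapes = Vec Tape 6

data Memory (i : Tape) (os : Word) (p q a : ℕ) (m : Mode) : Tapes → Set where
  memory : ∀ {j₁ j₂ j₃} →
           Memory i os p q a m (i ∷ outputTape os ∷ counterTape p j₁ ∷ counterTape q j₂ ∷
                                counterTape a j₃ ∷ tape [] (just (modeSymbol m)) [] ∷ [])

-- What remains between two sweeps: the heads of the counters are back behind their bars, and the
-- contents are forgotten until `reset` overwrites them.
data Parked (i : Tape) (os : Word) : Tapes → Set where
  parked : ∀ {h₁ r₁ h₂ r₂ h₃ r₃ c} →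
           Parked i os (i ∷ outputTape os ∷ tape [ cell₅ ] h₁ r₁ ∷ tape [ cell₅ ] h₂ r₂ ∷
                        tape [ cell₅ ] h₃ r₃ ∷ tape [] c [] ∷ [])

Computes : Program 6 → ℕ → (Tapes → Set) → (Tapes → Set) → Set
Computes P k A B = ∀ {ts} → A ts → ∃[ ts′ ] Exec P ts k ts′ × B ts′

infixr 5 _⨾ᶜ_

_⨾ᶜ_ : ∀ {P Q k l A B C} → Computes P k A B → Computes Q l B C → Computes (P ⨾ Q) (k + l) A C
(f ⨾ᶜ g) a = let _ , e , b = f a ; _ , e′ , c = g b in _ , e ⨾ e′ , c

weakenᶜ : ∀ {P k l A B} → k ≤ l → Computes P k A B → Computes P l A B
weakenᶜ k≤l f a = let _ , e , b = f a in _ , weaken k≤l e , b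

inputLens : ∀ {b c d e f} → Lens inputTape λ x → x ∷ b ∷ c ∷ d ∷ e ∷ f ∷ []
inputLens = record { get = λ _ → refl ; set = λ _ _ → refl }

outputLens : ∀ {a c d e f} → Lens outTape λ x → a ∷ x ∷ c ∷ d ∷ e ∷ f ∷ []
outputLens = record { get = λ _ → refl ; set = λ _ _ → refl }

hereLens : ∀ {a b d e f} → Lens hereTape λ x → a ∷ b ∷ x ∷ d ∷ e ∷ f ∷ []
hereLens = record { get = λ _ → refl ; set = λ _ _ → refl }

nextLens : ∀ {a b c e f} → Lens nextTape λ x → a ∷ b ∷ c ∷ x ∷ e ∷ f ∷ []
nextLens = record { get = λ _ → refl ; set = λ _ _ → refl }

dishLens : ∀ {a b c d f} → Lens dishTape λ x → a ∷ b ∷ c ∷ d ∷ x ∷ f ∷ []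
dishLens = record { get = λ _ → refl ; set = λ _ _ → refl }

modeLens : ∀ {a b c d e} → Lens modeTape λ x → a ∷ b ∷ c ∷ d ∷ e ∷ x ∷ []
modeLens = record { get = λ _ → refl ; set = λ _ _ → refl }

module Input {b c d e f : Tape} = Focus (inputLens {b} {c} {d} {e} {f})
module Output {a c d e f : Tape} = Focus (outputLens {a} {c} {d} {e} {f})
module Here {a b d e f : Tape} = Focus (hereLens {a} {b} {d} {e} {f})
module Next {a b c e f : Tape} = Focus (nextLens {a} {b} {c} {e} {f})
module Dish {a b c d f : Tape} = Focus (dishLens {a} {b} {c} {d} {f})
module ModeT {a b c d e : Tape} = Focus (modeLens {a} {b} {c} {d} {e})

module PrintHere {a d e f : Tape} =
  Focus₂ (λ y → hereLens {a} {y} {d} {e} {f}) (λ x → outputLens {a} {x} {d} {e} {f})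
module PrintNext {a c e f : Tape} =
  Focus₂ (λ y → nextLens {a} {y} {c} {e} {f}) (λ x → outputLens {a} {c} {x} {e} {f})
module PrintDish {a c d f : Tape} =
  Focus₂ (λ y → dishLens {a} {y} {c} {d} {f}) (λ x → outputLens {a} {c} {d} {x} {f})

emit : Emit → Program 6
emit (print s) = put outTape (just s) rightwards
emit here-no   = printCounter hereTape outTape
emit next-no   = printCounter nextTape outTape
emit dish-no   = printCounter dishTape outTape

skip : Program 6
skip = shift modeTape stay

emitAll : List Emit → Program 6
emitAll []       = skip
emitAll (e ∷ es) = emit e ⨾ emitAll es

abstract

  -- The cost of any operation on numbers up to z.
  unit : ℕ → ℕ
  unit z = z * 6 + 10

  unit-def : ∀ z → unit z ≡ z * 6 + 10
  unit-def z = refl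

  print-cost : ∀ {n z} → n ≤ z → size (Bin.fromℕ n) * 6 + 7 ≤ unit z
  print-cost {n} n≤z =
    +-mono-≤ (*-monoˡ-≤ 6 (≤-trans (size-fromℕ n) n≤z)) (m≤m+n 7 3)

  increment-cost : ∀ {n z} → n ≤ z → size (Bin.fromℕ n) * 4 + 10 ≤ unit z
  increment-cost {n} n≤z =
    +-monoˡ-≤ 10 (*-mono-≤ (≤-trans (size-fromℕ n) n≤z) (m≤m+n 4 2))

  small-cost : ∀ {k z} → k ≤ 10 → k ≤ unit z
  small-cost {z = z} k≤ = ≤-trans k≤ (m≤n+m 10 (z * 6))

module _ {z : ℕ} {i : Tape} {p a : ℕ} {m : Mode} (q≤z : suc p ≤ z) (a≤z : a ≤ z) where

  emit-computes : ∀ e {os} → Computes (emit e) (unit z)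
                                      (Memory i os p (suc p) a m) (Memory i (emitted p a e ʳ++ os) p (suc p) a m)
  emit-computes (print s) memory = _ , weaken (small-cost (s≤s z≤n)) Output.focus-on , memory
  emit-computes here-no memory =
    _ , weaken (print-cost (≤-trans (n≤1+n p) q≤z))
               (PrintHere.printCounter-exec (Bin.fromℕ p)) , memory
  emit-computes next-no memory =
    _ , weaken (print-cost q≤z) (PrintNext.printCounter-exec (Bin.fromℕ (suc p))) , memory
  emit-computes dish-no memory =
    _ , weaken (print-cost a≤z) (PrintDish.printCounter-exec (Bin.fromℕ a)) , memory

  emitAll-computes : ∀ es {os} → Computes (emitAll es) (suc (length es) * unit z)
                       (Memory i os p (suc p) a m) (Memory i (expand p a es ʳ++ os) p (suc p) a m)
  emitAll-computes [] memory =
    _ , weaken (≤-trans (small-cost (s≤s z≤n)) (m≤m+n _ 0)) ModeT.focus-on , memory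
  emitAll-computes (e ∷ es) {os} =
    subst (λ os → Computes _ _ _ (Memory i os p (suc p) a m)) (sym (++-ʳ++ (emitted p a e)))
          (emit-computes e ⨾ᶜ emitAll-computes es)

-- Zero has no digits, so a terminator in the first cell is zero; the old digits behind it become
-- junk.
clear : Fin 6 → Program 6
clear i = put i cell₃ stay

updateDish : Symbol → Program 6
updateDish digit₁    = skip
updateDish digit₂    = skip
updateDish comma     = increment dishTape
updateDish semicolon = clear dishTape
updateDish bar       = clear dishTape

visit : Table → Mode → Symbol → Program 6
visit tbl m x =
  -- The dish changes before the links are printed, since a terminator links its level to the dish
  -- that comes next; the position changes only afterwards.
  updateDish x ⨾
  emitAll (tbl m x) ⨾
  increment hereTape ⨾
  increment nextTape ⨾
  put modeTape (just (modeSymbol (nextMode x m))) stay ⨾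
  shift inputTape rightwards

visitCell : Table → Mode → Cell → Program 6
visitCell tbl m nothing  = skip
visitCell tbl m (just x) = visit tbl m x

sweeper : Table → Program 6
sweeper tbl = while inputTape nonblank (switch modeTape λ c → switch inputTape (visitCell tbl (cellMode c)))

inputZipper : Word → Word → Tape
inputZipper ls rs = zipper (cells ls ++ [ blank ]) (cells rs ++ [ blank ])

counterᵇ-shape : ∀ b j → ∃[ h ] ∃[ r ] counterᵇ b j ≡ tape [ cell₅ ] h r
counterᵇ-shape Bin.zero  j = _ , _ , refl
counterᵇ-shape 1+[2 b ]  j = _ , _ , refl
counterᵇ-shape 2[1+ b ]  j = _ , _ , refl

park : ∀ {i os p q a m ts} → Memory i os p q a m ts → Parked i os ts
park {p = p} {q} {a} (memory {j₁} {j₂} {j₃})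
  with counterTape p j₁ | counterᵇ-shape (Bin.fromℕ p) j₁
     | counterTape q j₂ | counterᵇ-shape (Bin.fromℕ q) j₂
     | counterTape a j₃ | counterᵇ-shape (Bin.fromℕ a) j₃
... | _ | _ , _ , refl | _ | _ , _ , refl | _ | _ , _ , refl = parked

module _ {z : ℕ} {i : Tape} {os : Word} {p q a : ℕ} {m : Mode} where

  increment-here : p ≤ z → Computes (increment hereTape) (unit z)
                                    (Memory i os p q a m) (Memory i os (suc p) q a m)
  increment-here p≤z (memory {j₁}) with Here.increment-exec (Bin.fromℕ p) j₁
  ... | _ , e rewrite sym (fromℕ-suc p) = _ , weaken (increment-cost p≤z) e , memory

  increment-next : q ≤ z → Computes (increment nextTape) (unit z)
                                    (Memory i os p q a m) (Memory i os p (suc q) a m)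
  increment-next q≤z (memory {j₂ = j₂}) with Next.increment-exec (Bin.fromℕ q) j₂
  ... | _ , e rewrite sym (fromℕ-suc q) = _ , weaken (increment-cost q≤z) e , memory

  increment-dish : a ≤ z → Computes (increment dishTape) (unit z)
                                    (Memory i os p q a m) (Memory i os p q (suc a) m)
  increment-dish a≤z (memory {j₃ = j₃}) with Dish.increment-exec (Bin.fromℕ a) j₃
  ... | _ , e rewrite sym (fromℕ-suc a) = _ , weaken (increment-cost a≤z) e , memory

  clear-dish : Computes (clear dishTape) (unit z) (Memory i os p q a m) (Memory i os p q 0 m)
  clear-dish (memory {j₃ = j₃}) with counterTape a j₃ | counterᵇ-shape (Bin.fromℕ a) j₃
  ... | _ | _ , _ , refl = _ , weaken (small-cost (s≤s z≤n)) Dish.focus-on , memory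

  skip-computes : Computes skip (unit z) (Memory i os p q a m) (Memory i os p q a m)
  skip-computes memory = _ , weaken (small-cost (s≤s z≤n)) ModeT.focus-on , memory

  updateDish-computes : a ≤ z → ∀ x → Computes (updateDish x) (unit z)
                          (Memory i os p q a m) (Memory i os p q (nextDish x a) m)
  updateDish-computes a≤z digit₁    = skip-computes
  updateDish-computes a≤z digit₂    = skip-computes
  updateDish-computes a≤z comma     = increment-dish a≤z
  updateDish-computes a≤z semicolon = clear-dish
  updateDish-computes a≤z bar       = clear-dish

  setMode : ∀ m′ → Computes (put modeTape (just (modeSymbol m′)) stay) (unit z)
                            (Memory i os p q a m) (Memory i os p q a m′)
  setMode m′ memory = _ , weaken (small-cost (s≤s z≤n)) ModeT.focus-on , memory

-- Every symbol advances the position and only a comma advances the dish, so one bound on positions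
-- serves all counters.
nextDish-≤ : ∀ x {a p} → a ≤ p → nextDish x a ≤ suc p
nextDish-≤ digit₁    a≤p = ≤-trans a≤p (n≤1+n _)
nextDish-≤ digit₂    a≤p = ≤-trans a≤p (n≤1+n _)
nextDish-≤ comma     a≤p = s≤s a≤p
nextDish-≤ semicolon a≤p = z≤n
nextDish-≤ bar       a≤p = z≤n

advance-right : ∀ {z os p q a m} ls x rs →
  Computes (shift inputTape rightwards) (unit z)
           (Memory (inputZipper ls (x ∷ rs)) os p q a m) (Memory (inputZipper (x ∷ ls) rs) os p q a m)
advance-right ls x rs memory = _ , weaken (small-cost (s≤s z≤n)) Input.focus-right , memory

MemoryAt : Word → Word → Word → Cursor → Tapes → Set
MemoryAt ls rs os c = Memory (inputZipper ls rs) os (position c) (suc (position c)) (dish c) (mode c)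

module _ (tbl : Table) (L : ℕ) (bounded : ∀ m x → length (tbl m x) ≤ L) (z : ℕ) where

  visitCost : ℕ
  visitCost = (L + 7) * unit z

  visit-computes : ∀ {ls rs os} c x → dish c ≤ position c → suc (position c) ≤ z →
    Computes (visit tbl (mode c) x) ((L + 6) * unit z)
             (MemoryAt ls (x ∷ rs) os c) (MemoryAt (x ∷ ls) rs (entryWord tbl c x ʳ++ os) (advance x c))
  visit-computes {ls} {rs} c x a≤p q≤z =
    weakenᶜ bound
      (updateDish-computes a≤z x ⨾ᶜ
       emitAll-computes q≤z (≤-trans (nextDish-≤ x a≤p) q≤z) (tbl (mode c) x) ⨾ᶜ
       increment-here p≤z ⨾ᶜ
       increment-next q≤z ⨾ᶜ
       setMode (nextMode x (mode c)) ⨾ᶜ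
       advance-right ls x rs)
    where
    u : ℕ
    u = unit z
    p≤z : position c ≤ z
    p≤z = ≤-trans (n≤1+n _) q≤z
    a≤z : dish c ≤ z
    a≤z = ≤-trans a≤p p≤z
    bound : u + (suc (length (tbl (mode c) x)) * u + (u + (u + (u + u)))) ≤ (L + 6) * u
    bound = ≤-trans
      (+-monoʳ-≤ u (+-monoˡ-≤ (u + (u + (u + u))) (*-monoˡ-≤ u (s≤s (bounded (mode c) x)))))
      (≤-reflexive (solve 2 (λ L u → u :+ ((con 1 :+ L) :* u :+ (u :+ (u :+ (u :+ u)))) := (L :+ con 6) :* u)
                          refl L u))

  sweeper-computes : ∀ rs {ls os} c → dish c ≤ position c → position c + length rs ≤ z →
    Computes (sweeper tbl) (length rs * visitCost + 1)
             (MemoryAt ls rs os c) (Parked (inputZipper (rs ʳ++ ls) []) (sweep (entryWord tbl) c rs ʳ++ os))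
  sweeper-computes [] c a≤p p≤z m@memory = _ , Input.focus-done refl , park m
  sweeper-computes (x ∷ rs) {ls} {os} c a≤p p≤z m@memory =
    let q≤z = ≤-trans (m≤m+n (suc (position c)) (length rs))
                      (≤-trans (≤-reflexive (sym (+-suc (position c) (length rs)))) p≤z)
        ts , e , m′ = subst (λ m → Computes (visit tbl m x) ((L + 6) * unit z)
                                            (MemoryAt ls (x ∷ rs) os c)
                                            (MemoryAt (x ∷ ls) rs (entryWord tbl c x ʳ++ os) (advance x c)))
                            (sym (cellMode-modeSymbol (mode c))) (visit-computes c x a≤p q≤z) m
        ts′ , e′ , m″ = sweeper-computes rs (advance x c) (nextDish-≤ x a≤p)
                          (≤-trans (≤-reflexive (sym (+-suc (position c) (length rs)))) p≤z) m′
    in ts′ ,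
       weaken bound (Input.focus-again refl (ModeT.focus-switch (Input.focus-switch e)) e′) ,
       subst (λ os → Parked _ os ts′) (sym (++-ʳ++ (entryWord tbl c x))) m″
    where
    bound : suc (2 + (L + 6) * unit z + (length rs * visitCost + 1)) ≤ visitCost + length rs * visitCost + 1
    bound = ≤-trans (+-monoˡ-≤ (length rs * visitCost + 1)
                      (≤-trans (+-monoˡ-≤ ((L + 6) * unit z) (small-cost {3} {z} (m≤m+n 3 7)))
                               (≤-reflexive (cong (_* unit z) (sym (+-suc L 6))))))
                    (≤-reflexive (sym (+-assoc visitCost _ 1)))

-- Polynomial running time

infixl 6 _⊕_
infixl 7 _⊗_

_⊕_ : Polynomial → Polynomial → Polynomial
[]      ⊕ q       = q
(a ∷ p) ⊕ []      = a ∷ p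
(a ∷ p) ⊕ (b ∷ q) = (a + b) ∷ (p ⊕ q)

scale : ℕ → Polynomial → Polynomial
scale a []      = []
scale a (b ∷ q) = a * b ∷ scale a q

_⊗_ : Polynomial → Polynomial → Polynomial
[]      ⊗ q = []
(a ∷ p) ⊗ q = scale a q ⊕ (0 ∷ p ⊗ q)

eval-⊕ : ∀ p q n → eval (p ⊕ q) n ≡ eval p n + eval q n
eval-⊕ []      q       n = refl
eval-⊕ (a ∷ p) []      n = sym (+-identityʳ _)
eval-⊕ (a ∷ p) (b ∷ q) n rewrite eval-⊕ p q n =
  solve 5 (λ a b n p q → a :+ b :+ n :* (p :+ q) := a :+ n :* p :+ (b :+ n :* q)) refl
        a b n (eval p n) (eval q n)

eval-scale : ∀ a q n → eval (scale a q) n ≡ a * eval q n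
eval-scale a []      n = sym (*-zeroʳ a)
eval-scale a (b ∷ q) n rewrite eval-scale a q n =
  solve 4 (λ a b n q → a :* b :+ n :* (a :* q) := a :* (b :+ n :* q)) refl a b n (eval q n)

eval-⊗ : ∀ p q n → eval (p ⊗ q) n ≡ eval p n * eval q n
eval-⊗ []      q n = refl
eval-⊗ (a ∷ p) q n rewrite eval-⊕ (scale a q) (0 ∷ p ⊗ q) n | eval-scale a q n | eval-⊗ p q n =
  solve 4 (λ a n p q → a :* q :+ n :* (p :* q) := (a :+ n :* p) :* q) refl a n (eval p n) (eval q n)

IsPolynomial : (ℕ → ℕ) → Set
IsPolynomial f = ∃[ p ] ∀ n → eval p n ≡ f n

poly-const : ∀ a → IsPolynomial λ _ → a
poly-const a = a ∷ [] , λ n → trans (cong (a +_) (*-zeroʳ n)) (+-identityʳ a)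

poly-id : IsPolynomial λ n → n
poly-id = 0 ∷ 1 ∷ [] , λ n → trans (cong (λ k → n * suc k) (*-zeroʳ n)) (*-identityʳ n)

poly-+ : ∀ {f g} → IsPolynomial f → IsPolynomial g → IsPolynomial λ n → f n + g n
poly-+ (p , e) (q , e′) = p ⊕ q , λ n → trans (eval-⊕ p q n) (cong₂ _+_ (e n) (e′ n))

poly-* : ∀ {f g} → IsPolynomial f → IsPolynomial g → IsPolynomial λ n → f n * g n
poly-* (p , e) (q , e′) = p ⊗ q , λ n → trans (eval-⊗ p q n) (cong₂ _*_ (e n) (e′ n))

-- Writing a word in several passes over the input

readWord-zipper : ∀ w l → readWord (zipper l (cells w ++ [ blank ])) ≡ w
readWord-zipper []          l = refl
readWord-zipper (s ∷ [])    l = refl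
readWord-zipper (s ∷ t ∷ w) l = cong (s ∷_) (readWord-zipper (t ∷ w) [])

-- Each list in the output needs its own pass over the input. A bound on the number of emits per
-- symbol is what turns the cost of a pass into a polynomial.
record Phase : Set where
  field
    preamble : List Emit
    table    : Table
    width    : ℕ
    bounded  : ∀ m x → length (table m x) ≤ width

  phaseWord : Word → Word
  phaseWord w = expand 0 0 preamble ++ sweep (entryWord table) origin w

open Phase using (preamble; table; width; phaseWord)

phasesWord : List Phase → Word → Word
phasesWord phs w = concatMap (λ ph → phaseWord ph w) phs

reset : Program 6
reset = clear hereTape ⨾ clear nextTape ⨾ clear dishTape ⨾
        -- The counter of the next position has to start one ahead.
        put modeTape (just (modeSymbol (gathers loop))) stay ⨾ increment nextTape

runPhase : Phase → Program 6
runPhase ph = returnHome inputTape ⨾ reset ⨾ emitAll (preamble ph) ⨾ sweeper (table ph)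

phaseCost : Phase → ℕ → ℕ
phaseCost ph n =
  n * 2 + 5 + (4 + unit (suc n) +
    (suc (length (preamble ph)) * unit (suc n) + (n * ((width ph + 7) * unit (suc n)) + 1)))

poly-unit : IsPolynomial λ n → unit (suc n)
poly-unit =
  let p , e = poly-+ (poly-* (poly-+ (poly-const 1) poly-id) (poly-const 6)) (poly-const 10)
  in p , λ n → trans (e n) (sym (unit-def (suc n)))

poly-phaseCost : ∀ ph → IsPolynomial (phaseCost ph)
poly-phaseCost ph =
  poly-+ (poly-+ (poly-* poly-id (poly-const 2)) (poly-const 5))
         (poly-+ (poly-+ (poly-const 4) poly-unit)
                 (poly-+ (poly-* (poly-const (suc (length (preamble ph)))) poly-unit)
                         (poly-+ (poly-* poly-id (poly-* (poly-const (width ph + 7)) poly-unit))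
                                 (poly-const 1))))

-- Before the first pass nothing is recorded to the left of the input, after it a blank is. `left₀`
-- states the behaviour that the two tapes share.
record AtEnd (w os : Word) (ts : Tapes) : Set where
  constructor at-end
  field
    {l₀}  : List Cell
    left₀ : ∀ x r → move leftwards (tape l₀ x r) ≡ tape [] blank (x ∷ r)
    rest  : Parked (tape (cells (reverse w) ++ l₀) blank []) os ts

home-input : ∀ w {os} → Computes (returnHome inputTape) (length w * 2 + 5)
                                 (AtEnd w os) (Parked (inputZipper [] w) os)
home-input w (at-end left₀ parked) =
  _ , weaken (≤-reflexive (cong (λ n → n * 2 + 5) (length-reverse w)))
        (reaching (cong (λ y → zipper [ blank ] y ∷ _)
                        (trans (cong (_ʳ++ [ blank ]) (map-ʳ++ just w)) (ʳ++-ʳ++ (cells w))))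
                  (Input.returnHome-exec left₀ (reverse w))) , parked

reset-computes : ∀ {i os z} → Computes reset (4 + unit z) (Parked i os) (Memory i os 0 1 0 (gathers loop))
reset-computes {i} {os} {z} (parked {r₁ = r₁} {r₂ = r₂} {r₃ = r₃}) =
  let _ , e , m = increment-next {z} z≤n (memory {j₁ = r₁} {r₂} {r₃})
  in _ , Here.focus-on ⨾ Next.focus-on ⨾ Dish.focus-on ⨾ ModeT.focus-on ⨾ e , m

phase-computes : ∀ ph w {os} → Computes (runPhase ph) (phaseCost ph (length w))
                                        (AtEnd w os) (AtEnd w (phaseWord ph w ʳ++ os))
phase-computes ph w {os} a =
  let ts , e , p = (home-input w ⨾ᶜ reset-computes ⨾ᶜ
                   emitAll-computes (s≤s z≤n) z≤n (preamble ph) ⨾ᶜ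
                   sweeper-computes (table ph) (width ph) (Phase.bounded ph) (suc (length w)) w {ls = []} origin
                     z≤n (n≤1+n _)) a
  in ts , e , at-end (λ _ _ → refl)
       (subst (λ os → Parked (inputZipper (w ʳ++ []) []) os ts) (sym (++-ʳ++ (expand 0 0 (preamble ph)))) p)

runPhases : List Phase → Program 6
runPhases []         = skip
runPhases (ph ∷ phs) = runPhase ph ⨾ runPhases phs

phasesCost : List Phase → ℕ → ℕ
phasesCost []         n = 1
phasesCost (ph ∷ phs) n = phaseCost ph n + phasesCost phs n

poly-phasesCost : ∀ phs → IsPolynomial (phasesCost phs)
poly-phasesCost []         = poly-const 1
poly-phasesCost (ph ∷ phs) = poly-+ (poly-phaseCost ph) (poly-phasesCost phs)

phases-compute : ∀ phs w {os} → Computes (runPhases phs) (phasesCost phs (length w))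
                                         (AtEnd w os) (AtEnd w (phasesWord phs w ʳ++ os))
phases-compute [] w (at-end l₀ parked) = _ , ModeT.focus-on , at-end l₀ parked
phases-compute (ph ∷ phs) w {os} =
  subst (λ os → Computes _ _ _ (AtEnd w os)) (sym (++-ʳ++ (phaseWord ph w)))
        (phase-computes ph w ⨾ᶜ phases-compute phs w)

-- The bars are written once and for all, as every later operation on a counter rewinds to its bar.
-- The input is crossed so that the first pass starts where each pass ends.
setup : Program 6
setup = put hereTape cell₅ rightwards ⨾ put nextTape cell₅ rightwards ⨾ put dishTape cell₅ rightwards ⨾
        while inputTape nonblank (shift inputTape rightwards)

setup-exec : ∀ w → ∃[ ts ] Exec setup (wordTape w ∷ emptyTape ∷ Vec.replicate 4 emptyTape)
                                (length w * 2 + 4) ts × AtEnd w [] ts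
setup-exec w =
  _ , weaken (≤-reflexive (solve 1 (λ n → con 3 :+ (n :* con 2 :+ con 1) := n :* con 2 :+ con 4) refl (length w)))
        (Here.focus-on ⨾ Next.focus-on ⨾ Dish.focus-on ⨾
         reaching (cong (λ l → tape l blank [] ∷ marked)
                        (trans (sym (map-ʳ++ just w)) (sym (++-identityʳ _))))
                  (starting (cong (_∷ marked) (wordTape-zipper w)) (run w))) ,
  at-end {l₀ = []} (λ _ _ → refl) parked
  where
  toEnd : Program 6
  toEnd = while inputTape nonblank (shift inputTape rightwards)
  markedTape : Tape
  markedTape = tape [ cell₅ ] blank []
  marked : Vec Tape 5
  marked = emptyTape ∷ markedTape ∷ markedTape ∷ markedTape ∷ emptyTape ∷ []
  wordTape-zipper : ∀ w → wordTape w ≡ zipper [] (cells w)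
  wordTape-zipper []      = refl
  wordTape-zipper (_ ∷ _) = refl
  run : ∀ w {l b c d e f} → Exec toEnd (zipper l (cells w) ∷ b ∷ c ∷ d ∷ e ∷ f ∷ []) (length w * 2 + 1)
                                 (tape (cells w ʳ++ l) blank [] ∷ b ∷ c ∷ d ∷ e ∷ f ∷ [])
  run []      = Input.focus-done refl
  run (s ∷ w) = Input.focus-again refl Input.focus-right (run w)

writer : List Phase → Program 6
writer phs = setup ⨾ runPhases phs ⨾ returnHome outTape

-- Returning over the output takes no longer than writing it, up to a factor.
reach : Tape → ℕ
reach t = length (Tape.left t)

reach-writeAndMove : ∀ a t → reach (writeAndMove a t) ≤ suc (reach t)
reach-writeAndMove (c , leftwards)  (tape [] h r)      = z≤n
reach-writeAndMove (c , leftwards)  (tape (_ ∷ l) h r) = ≤-trans (n≤1+n _) (n≤1+n _)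
reach-writeAndMove (c , stay)       t                  = n≤1+n _
reach-writeAndMove (c , rightwards) (tape l h [])      = ≤-refl
reach-writeAndMove (c , rightwards) (tape l h (_ ∷ r)) = ≤-refl

reach-exec : ∀ {t} {P : Program t} {ts k ts′} (i : Fin t) → Exec P ts k ts′ →
             reach (lookup ts′ i) ≤ k + reach (lookup ts i)
reach-exec i (on {j} {f} {ts}) with i ≟ j
... | yes refl rewrite lookup∘updateAt i {f = λ _ → writeAndMove (f (scan i ts)) (lookup ts i)} ts =
      reach-writeAndMove (f (scan i ts)) (lookup ts i)
... | no i≢j rewrite lookup∘updateAt′ i j {f = λ _ → writeAndMove (f (scan j ts)) (lookup ts j)} i≢j ts = n≤1+n _
reach-exec i (_⨾_ {k = k} {l} p q) =
  ≤-trans (reach-exec i q) (≤-trans (+-monoʳ-≤ l (reach-exec i p)) (≤-reflexive (rearrange l k _)))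
  where
  rearrange : ∀ l k r → l + (k + r) ≡ k + l + r
  rearrange = solve 3 (λ l k r → l :+ (k :+ r) := k :+ l :+ r) refl
reach-exec i (switch p) = ≤-trans (reach-exec i p) (n≤1+n _)
reach-exec i (again {k = k} {l} _ p q) =
  ≤-trans (reach-exec i q) (≤-trans (+-monoʳ-≤ l (reach-exec i p))
                                    (≤-trans (≤-reflexive (rearrange l k _)) (n≤1+n _)))
  where
  rearrange : ∀ l k r → l + (k + r) ≡ k + l + r
  rearrange = solve 3 (λ l k r → l :+ (k :+ r) := k :+ l :+ r) refl
reach-exec i (done _) = n≤1+n _
reach-exec i (weaken k≤l p) = ≤-trans (reach-exec i p) (+-monoˡ-≤ _ k≤l)

home-output : ∀ {w os ts k} → AtEnd w os ts → length os ≤ k →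
              ∃[ ts′ ] Exec (returnHome outTape) ts (k * 2 + 5) ts′ ×
                       lookup ts′ outTape ≡ zipper [ blank ] (cells os ʳ++ [ blank ])
home-output {os = os} {k = k} (at-end _ parked) os≤k =
  _ , weaken (+-monoˡ-≤ 5 (*-monoˡ-≤ 2 os≤k))
        (starting (cong (λ l → _ ∷ tape l blank [] ∷ _) (sym (++-identityʳ (cells os))))
               (Output.returnHome-exec {l₀ = []} (λ _ _ → refl) os)) , refl

writerCost : List Phase → ℕ → ℕ
writerCost phs n = n * 2 + 4 + (phasesCost phs n + ((n * 2 + 4 + phasesCost phs n) * 2 + 5))

poly-writerCost : ∀ phs → IsPolynomial (writerCost phs)
poly-writerCost phs =
  poly-+ poly-setup (poly-+ (poly-phasesCost phs)
    (poly-+ (poly-* (poly-+ poly-setup (poly-phasesCost phs)) (poly-const 2)) (poly-const 5)))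
  where
  poly-setup : IsPolynomial λ n → n * 2 + 4
  poly-setup = poly-+ (poly-* poly-id (poly-const 2)) (poly-const 4)

output-length : ∀ {w os ts} → AtEnd w os ts → reach (lookup ts outTape) ≡ length os
output-length {os = os} (at-end _ parked) = length-map just os

writer-exec : ∀ phs w → ∃[ ts ] Exec (writer phs) (wordTape w ∷ emptyTape ∷ Vec.replicate 4 emptyTape)
                                     (writerCost phs (length w)) ts ×
                                readWord (lookup ts outTape) ≡ phasesWord phs w
writer-exec phs w =
  let _ , e , a    = setup-exec w
      _ , e′ , a′  = phases-compute phs w a
      written      = ≤-trans (reach-exec outTape (e ⨾ e′)) (≤-reflexive (+-identityʳ _))
      _ , e″ , out = home-output a′ (≤-trans (≤-reflexive (sym (output-length a′))) written)
  in _ , e ⨾ e′ ⨾ e″ ,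
     trans (cong readWord out)
           (trans (cong (λ y → readWord (zipper [ blank ] y))
                        (trans (cong (_ʳ++ [ blank ]) (map-ʳ++ just (phasesWord phs w)))
                               (ʳ++-ʳ++ (cells (phasesWord phs w)))))
                  (readWord-zipper (phasesWord phs w) [ blank ]))

phases-polynomialTime : ∀ {A B : Set} (encA : A → Word) (encB : B → Word) (f : A → B) phs →
  (∀ x → phasesWord phs (encA x) ≡ encB (f x)) → PolynomialTime encA encB f
phases-polynomialTime encA encB f phs correct =
  let p , e = poly-writerCost phs in
  machine (writer phs) , p , λ x →
    let ts , run , out = writer-exec phs (encA x)
        k , k≤ , path  = exec-path run
    in k , snapshot nothing ts , path-run (writer phs) path ,
       ≤-trans k≤ (≤-reflexive (sym (e (length (encA x))))) ,
       trans (read-output ts) (trans out (correct x))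
  where
  read-output : ∀ ts → output (machine (writer phs)) (snapshot nothing ts) ≡ readWord (lookup ts outTape)
  read-output (_ ∷ _ ∷ _) = refl

-- The network of doors and its encoding

Door : Gadget
Door = symmetricSelfClosingDoor

data Gate : Set where
  toll exchange : Gate

data Tag : Set where
  dishTag placeTag : Tag
  gateTag         : Gate → Tag

-- The digits of the index of a gadget tell its kind before its number, so that
-- printing the index is printing a constant and a counter.
tagged : Tag → ℕᵇ → ℕᵇ
tagged dishTag           b = 1+[2 b ]
tagged placeTag           b = 2[1+ 1+[2 b ] ]
tagged (gateTag toll)     b = 2[1+ 2[1+ 1+[2 b ] ] ]
tagged (gateTag exchange) b = 2[1+ 2[1+ 2[1+ b ] ] ]

tagWord : Tag → Word
tagWord t = digits (tagged t Bin.zero)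

gadgetNo : Tag → ℕ → ℕ
gadgetNo t n = Bin.toℕ (tagged t (Bin.fromℕ n))

digits-tagged : ∀ t b → digits (tagged t b) ≡ tagWord t ++ digits b
digits-tagged dishTag           b = refl
digits-tagged placeTag           b = refl
digits-tagged (gateTag toll)     b = refl
digits-tagged (gateTag exchange) b = refl

number-gadgetNo : ∀ t n → number (gadgetNo t n) ≡ tagWord t ++ number n
number-gadgetNo t n
  rewrite fromℕ-toℕ (tagged t (Bin.fromℕ n)) | digits-tagged t (Bin.fromℕ n) =
  ++-assoc (tagWord t) (digits (Bin.fromℕ n)) _

-- A tag takes up to three digits, hence the factor 8: the largest number in use is 14 + 8(N + 1),
-- that of an `exchange` at position N + 1. No tagged number is 0, so gadget 0 is free to carry
-- `start` and `end`.
copiesFor : ℕ → ℕ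
copiesFor N = 24 + N * 8

gadgetNo-< : ∀ t {n N} → n ≤ suc N → gadgetNo t n < copiesFor N
gadgetNo-< t {n} {N} n≤ =
  ≤-trans (s≤s (largest t)) (≤-trans (s≤s (+-monoʳ-≤ 14 (*-monoˡ-≤ 8 n≤))) (n≤1+n _))
  where
  largest : ∀ t → gadgetNo t n ≤ 14 + n * 8
  largest dishTag rewrite toℕ-fromℕ n = ≤-trans (≤-reflexive
    (solve 1 (λ n → con 1 :+ con 2 :* n := con 1 :+ n :* con 2) refl n))
    (+-mono-≤ (m≤m+n 1 13) (*-monoʳ-≤ n (m≤m+n 2 6)))
  largest placeTag rewrite toℕ-fromℕ n = ≤-trans (≤-reflexive
    (solve 1 (λ n → con 2 :* (con 1 :+ (con 1 :+ con 2 :* n)) := con 4 :+ n :* con 4) refl n))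
    (+-mono-≤ (m≤m+n 4 10) (*-monoʳ-≤ n (m≤m+n 4 4)))
  largest (gateTag toll) rewrite toℕ-fromℕ n = ≤-trans (≤-reflexive
    (solve 1 (λ n → con 2 :* (con 1 :+ con 2 :* (con 1 :+ (con 1 :+ con 2 :* n))) := con 10 :+ n :* con 8) refl n))
    (+-monoˡ-≤ (n * 8) (m≤m+n 10 4))
  largest (gateTag exchange) rewrite toℕ-fromℕ n = ≤-reflexive
    (solve 1 (λ n → con 2 :* (con 1 :+ con 2 :* (con 1 :+ con 2 :* (con 1 :+ n))) := con 14 :+ n :* con 8) refl n)

data When : Set where
  now later : When

shifted : When → ℕ → ℕ
shifted now   p = p
shifted later p = suc p

data Node : Set where
  control level           : When → Node
  dishNode void start end : Node

Wiring : Set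
Wiring = Vec Node 4

-- x + y → z, and x → y + z: in state 1 the first robot passes from A to B, which
-- opens the passage from C to D for the second one and closes the first.  The
-- void is the spawner, where robots come from and go to.
merge split : Node → Node → Node → Wiring
merge x y z = x ∷ void ∷ y ∷ z ∷ []
split x y z = x ∷ y ∷ void ∷ z ∷ []

unused : Wiring
unused = void ∷ void ∷ void ∷ void ∷ []

-- A digit d of weight 2^j in the entry of a dish has a place (level now) where
-- every robot stands for 2^j tokens, and the exchange trades two of these for one
-- at the place of the next digit, or back.  The toll makes the control robot pay
-- d·2^j tokens when it gathers and hands them out when it scatters; at the end of a
-- left side it is the one-way door that fires the rule.
wiring : Gate → Mode → Symbol → Wiring
wiring toll     (gathers _)    digit₁    = merge (level now) (control now) (control later)
wiring toll     (gathers _)    digit₂    = merge (level later) (control now) (control later)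
wiring toll     (gathers loop) semicolon = split (control now) (control later) void
wiring toll     (scatters _)   digit₁    = split (control now) (control later) (level now)
wiring toll     (scatters _)   digit₂    = split (control now) (control later) (level later)
wiring exchange (gathers _)    digit₁    = merge (level now) (level now) (level later)
wiring exchange (gathers _)    digit₂    = merge (level now) (level now) (level later)
wiring exchange (scatters _)   digit₁    = split (level later) (level now) (level now)
wiring exchange (scatters _)   digit₂    = split (level later) (level now) (level now)
wiring _        _              _         = unused

data Terminal : Set where
  plain    : Node → Terminal
  gatePort : Gate → Fin 4 → Terminal

Link : Set
Link = Terminal × Node

-- Control robots walk on at a comma. After a right side the spent robot and the one about to gather
-- the next left side both stand for nothing, so their places may touch the spawner. After the left
-- side of a rule there is no such link, which leaves the toll as the only way on. At the bar,
-- `start` leads into the initial vector.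
directLinks : Mode → Symbol → List Link
directLinks _              digit₁    = []
directLinks _              digit₂    = []
directLinks _              comma     = (plain (level later) , dishNode) ∷ (plain (control now) , control later) ∷ []
directLinks (gathers loop) semicolon = (plain (level later) , dishNode) ∷ []
directLinks (gathers once) semicolon = (plain (level later) , dishNode) ∷ (plain (control now) , end) ∷ []
directLinks (scatters _)   semicolon = (plain (level later) , dishNode) ∷ (plain (control now) , void) ∷ (plain (control later) , void) ∷ []
directLinks (gathers loop) bar       = (plain (level later) , dishNode) ∷ (plain (control later) , start) ∷ []
directLinks _              bar       = (plain (level later) , dishNode) ∷ []

wireLinks : Gate → Wiring → List Link
wireLinks g (a ∷ b ∷ c ∷ d ∷ []) =
  (gatePort g 0F , a) ∷ (gatePort g 1F , b) ∷ (gatePort g 2F , c) ∷ (gatePort g 3F , d) ∷ []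

links : Mode → Symbol → List Link
links m x = wireLinks toll (wiring toll m x) ++ wireLinks exchange (wiring exchange m x) ++ directLinks m x

firstLinks : List Link
firstLinks = (plain (control now) , void) ∷ (plain (level now) , dishNode) ∷ []

module _ (N : ℕ) where

  Place : Set
  Place = Location Door (copiesFor N)

  gadget : Tag → ℕ → Fin (copiesFor N)
  gadget t n = gadgetNo t n mod copiesFor N

  -- The reduction `mod` makes `gadget` total; by `gadgetNo-<` it has no effect on the numbers that
  -- occur.
  toℕ-gadget : ∀ t {n} → n ≤ suc N → toℕ (gadget t n) ≡ gadgetNo t n
  toℕ-gadget t n≤ = trans (toℕ-fromℕ< _) (m<n⇒m%n≡m (gadgetNo-< t n≤))

  -- Ports B and D are exits, so robots there cannot pass the door of their gadget,
  -- and nothing is linked to its entrances.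
  node : ℕ → ℕ → Node → Place
  node p a (control w)    = port (gadget placeTag (shifted w p)) 1F
  node p a (level w)      = port (gadget placeTag (shifted w p)) 3F
  node p a dishNode       = port (gadget dishTag a) 1F
  node p a void           = spawner
  node p a start          = port zero 3F
  node p a end            = port zero 1F

  terminal : ℕ → ℕ → Terminal → Place
  terminal p a (plain k)      = node p a k
  terminal p a (gatePort g c) = port (gadget (gateTag g) p) c

  linkAt : ℕ → ℕ → Link → Place × Place
  linkAt p a (k , l) = terminal p a k , node p a l

  linksAt : Cursor → Symbol → List (Place × Place)
  linksAt c x = List.map (linkAt (position c) (nextDish x (dish c))) (links (mode c) x)

network : (w : Word) → List (Place (length w) × Place (length w))
network w = List.map (linkAt (length w) 0 0) firstLinks ++ sweep (linksAt (length w)) origin w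

theSystem : Word → System Door
theSystem w = record
  { copies        = copiesFor (length w)
  ; initialStates = Vec.replicate _ zero
  ; connections   = network w
  }

-- The network and the constructed instances as output words

constant : Word → List Emit
constant = List.map print

tagEmits : Tag → Emit → Fin 4 → List Emit
tagEmits t e c = constant (tagWord t) ++ e ∷ constant (index c ++ semicolon ∷ [])

positionEmit : When → Emit
positionEmit now   = here-no
positionEmit later = next-no

nodeEmits : Node → List Emit
nodeEmits (control w)    = tagEmits placeTag (positionEmit w) 1F
nodeEmits (level w)      = tagEmits placeTag (positionEmit w) 3F
nodeEmits dishNode       = tagEmits dishTag dish-no 1F
nodeEmits void           = constant (location Door (spawner {n = 1}))
nodeEmits start          = constant (location Door (port {n = 1} zero 3F))
nodeEmits end            = constant (location Door (port {n = 1} zero 1F))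

terminalEmits : Terminal → List Emit
terminalEmits (plain k)      = nodeEmits k
terminalEmits (gatePort g c) = tagEmits (gateTag g) here-no c

linkEmits : Link → List Emit
linkEmits (k , l) = terminalEmits k ++ nodeEmits l

expand-constant : ∀ p a w → expand p a (constant w) ≡ w
expand-constant p a []      = refl
expand-constant p a (s ∷ w) = cong (s ∷_) (expand-constant p a w)

expand-++ : ∀ p a es es′ → expand p a (es ++ es′) ≡ expand p a es ++ expand p a es′
expand-++ p a = concatMap-++ (emitted p a)

module _ (N : ℕ) {p a : ℕ} (p≤N : p ≤ N) (a≤N : a ≤ suc N) where

  private
    tag-word : ∀ t e c {n} → n ≤ suc N → emitted p a e ≡ number n →
               expand p a (tagEmits t e c) ≡ location Door (port (gadget N t n) c)
    tag-word t e c {n} n≤ eq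
      rewrite expand-++ p a (constant (tagWord t)) (e ∷ constant (index c ++ semicolon ∷ []))
            | expand-constant p a (tagWord t) | expand-constant p a (index c ++ semicolon ∷ [])
            | eq | toℕ-gadget N t n≤ | number-gadgetNo t n =
      sym (++-assoc (tagWord t) (number n) _)

    position-word : ∀ w → emitted p a (positionEmit w) ≡ number (shifted w p)
    position-word now   = refl
    position-word later = refl

    shifted-≤ : ∀ w → shifted w p ≤ suc N
    shifted-≤ now   = ≤-trans p≤N (n≤1+n N)
    shifted-≤ later = s≤s p≤N

  node-word : ∀ n → expand p a (nodeEmits n) ≡ location Door (node N p a n)
  node-word (control w)    = tag-word placeTag (positionEmit w) 1F (shifted-≤ w) (position-word w)
  node-word (level w)      = tag-word placeTag (positionEmit w) 3F (shifted-≤ w) (position-word w)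
  node-word dishNode       = tag-word dishTag dish-no 1F a≤N refl
  node-word void           = refl
  node-word start          = refl
  node-word end            = refl

  terminal-word : ∀ k → expand p a (terminalEmits k) ≡ location Door (terminal N p a k)
  terminal-word (plain k)      = node-word k
  terminal-word (gatePort g c) = tag-word (gateTag g) here-no c (shifted-≤ now) refl

  link-words : ∀ ls → expand p a (concatMap linkEmits ls) ≡ concatMap (connection Door) (List.map (linkAt N p a) ls)
  link-words []             = refl
  link-words ((k , l) ∷ ls)
    rewrite expand-++ p a (linkEmits (k , l)) (concatMap linkEmits ls)
          | expand-++ p a (terminalEmits k) (nodeEmits l)
          | terminal-word k | node-word l | link-words ls = refl

linkTable : Table
linkTable m x = concatMap linkEmits (links m x)

sweep-links : ∀ {N} c w → dish c ≤ position c → position c + length w ≤ N →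
              concatMap (connection Door) (sweep (linksAt N) c w) ≡ sweep (entryWord linkTable) c w
sweep-links c [] a≤p p≤N = refl
sweep-links {N} c (x ∷ w) a≤p p≤N =
  trans (concatMap-++ (connection Door) (linksAt N c x) _)
        (cong₂ _++_ (sym (link-words N p≤ (≤-trans (nextDish-≤ x a≤p) (s≤s p≤)) (links (mode c) x)))
                    (sweep-links (advance x c) w (nextDish-≤ x a≤p)
                                 (≤-trans (≤-reflexive (sym (+-suc (position c) (length w)))) p≤N)))
  where
  p≤ : position c ≤ N
  p≤ = ≤-trans (m≤m+n _ _) p≤N

network-word : ∀ w → concatMap (connection Door) (network w) ≡
                     expand 0 0 (concatMap linkEmits firstLinks) ++ sweep (entryWord linkTable) origin w
network-word w =
  trans (concatMap-++ (connection Door) (List.map (linkAt (length w) 0 0) firstLinks)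
                     (sweep (linksAt (length w)) origin w))
        (cong₂ _++_ (sym (link-words (length w) z≤n z≤n firstLinks)) (sweep-links origin w z≤n ≤-refl))

repeated : ℕ → Word → Word
repeated zero    v = []
repeated (suc n) v = v ++ repeated n v

repeated-+ : ∀ m n v → repeated (m + n) v ≡ repeated m v ++ repeated n v
repeated-+ zero    n v = refl
repeated-+ (suc m) n v rewrite repeated-+ m n v = sym (++-assoc v _ _)

concatMap-replicate : ∀ {A : Set} (f : A → Word) n x →
                      concatMap f (toList (Vec.replicate n x)) ≡ repeated n (f x)
concatMap-replicate f zero    x = refl
concatMap-replicate f (suc n) x = cong (f x ++_) (concatMap-replicate f n x)

-- The number of gadgets is given by the length of a list, so eight entries per input symbol produce
-- the term `N * 8` of `copiesFor` without computing it.
eightfold : Word → Table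
eightfold v m x = constant (repeated 8 v)

sweep-eightfold : ∀ v c w → sweep (entryWord (eightfold v)) c w ≡ repeated (length w * 8) v
sweep-eightfold v c []      = refl
sweep-eightfold v c (x ∷ w) =
  trans (cong₂ _++_ (expand-constant (position c) (nextDish x (dish c)) (repeated 8 v))
                    (sweep-eightfold v (advance x c) w))
        (sym (repeated-+ 8 (length w * 8) v))

repeatPhase : Word → ℕ → Word → Phase
repeatPhase u n v = record
  { preamble = constant (u ++ repeated n v)
  ; table    = eightfold v
  ; width    = _
  ; bounded  = λ _ _ → ≤-refl
  }

repeatPhase-word : ∀ u n v w → phaseWord (repeatPhase u n v) w ≡ u ++ repeated (n + length w * 8) v
repeatPhase-word u n v w =
  trans (cong₂ _++_ (expand-constant 0 0 (u ++ repeated n v)) (sweep-eightfold v origin w))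
        (trans (++-assoc u _ _) (cong (u ++_) (sym (repeated-+ n (length w * 8) v))))

silent : Table
silent _ _ = []

sweep-silent : ∀ c w → sweep (entryWord silent) c w ≡ []
sweep-silent c []      = refl
sweep-silent c (x ∷ w) = sweep-silent (advance x c) w

constantPhase : Word → Phase
constantPhase u = record
  { preamble = constant u
  ; table    = silent
  ; width    = 0
  ; bounded  = λ _ _ → ≤-refl
  }

constantPhase-word : ∀ u w → phaseWord (constantPhase u) w ≡ u
constantPhase-word u w =
  trans (cong₂ _++_ (expand-constant 0 0 u) (sweep-silent origin w)) (++-identityʳ u)

networkPhase : Phase
networkPhase = record
  { preamble = print semicolon ∷ concatMap linkEmits firstLinks
  ; table    = linkTable
  -- A symbol has at most eleven links, and a link takes at most sixteen emits.
  ; width    = 200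
  ; bounded  = bounded
  }
  where
  bounded : ∀ m x → length (linkTable m x) ≤ 200
  bounded (gathers loop)  digit₁    = ≤ᵇ⇒≤ _ _ tt
  bounded (gathers loop)  digit₂    = ≤ᵇ⇒≤ _ _ tt
  bounded (gathers loop)  comma     = ≤ᵇ⇒≤ _ _ tt
  bounded (gathers loop)  semicolon = ≤ᵇ⇒≤ _ _ tt
  bounded (gathers loop)  bar       = ≤ᵇ⇒≤ _ _ tt
  bounded (gathers once)  digit₁    = ≤ᵇ⇒≤ _ _ tt
  bounded (gathers once)  digit₂    = ≤ᵇ⇒≤ _ _ tt
  bounded (gathers once)  comma     = ≤ᵇ⇒≤ _ _ tt
  bounded (gathers once)  semicolon = ≤ᵇ⇒≤ _ _ tt
  bounded (gathers once)  bar       = ≤ᵇ⇒≤ _ _ tt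
  bounded (scatters loop) digit₁    = ≤ᵇ⇒≤ _ _ tt
  bounded (scatters loop) digit₂    = ≤ᵇ⇒≤ _ _ tt
  bounded (scatters loop) comma     = ≤ᵇ⇒≤ _ _ tt
  bounded (scatters loop) semicolon = ≤ᵇ⇒≤ _ _ tt
  bounded (scatters loop) bar       = ≤ᵇ⇒≤ _ _ tt
  bounded (scatters once) digit₁    = ≤ᵇ⇒≤ _ _ tt
  bounded (scatters once) digit₂    = ≤ᵇ⇒≤ _ _ tt
  bounded (scatters once) comma     = ≤ᵇ⇒≤ _ _ tt
  bounded (scatters once) semicolon = ≤ᵇ⇒≤ _ _ tt
  bounded (scatters once) bar       = ≤ᵇ⇒≤ _ _ tt

networkPhase-word : ∀ w → phaseWord networkPhase w ≡ semicolon ∷ concatMap (connection Door) (network w)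
networkPhase-word w = cong (semicolon ∷_) (sym (network-word w))

statesWord : Word → Word
statesWord w = concatMap index (toList (Vec.replicate (copiesFor (length w)) (zero {1})))

-- Zero has no digits, so the initial state of a door is written as a lone comma.
statesWord-repeated : ∀ w → repeated (24 + length w * 8) [ comma ] ≡ statesWord w
statesWord-repeated w = sym {x = statesWord w} (concatMap-replicate index (24 + length w * 8) (zero {1}))

statesPhase : Word → Phase
statesPhase u = repeatPhase u 24 [ comma ]

statesPhase-word : ∀ u w → phaseWord (statesPhase u) w ≡
                   u ++ statesWord w
statesPhase-word u w =
  trans (repeatPhase-word u 24 [ comma ] w) (cong (u ++_) (statesWord-repeated w))

system-word : ∀ w v → system Door (theSystem w) ++ v ≡
              phaseWord (statesPhase []) w ++ phaseWord networkPhase w ++ bar ∷ v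
system-word w v = begin
  ((X ++ [ semicolon ]) ++ (Y ++ [ bar ])) ++ v  ≡⟨ ++-assoc (X ++ [ semicolon ]) (Y ++ [ bar ]) v ⟩
  (X ++ [ semicolon ]) ++ (Y ++ [ bar ]) ++ v    ≡⟨ cong ((X ++ [ semicolon ]) ++_) (++-assoc Y [ bar ] v) ⟩
  (X ++ [ semicolon ]) ++ Y ++ bar ∷ v           ≡⟨ ++-assoc X [ semicolon ] _ ⟩
  X ++ semicolon ∷ Y ++ bar ∷ v                  ≡⟨ cong₂ _++_ (sym (statesPhase-word [] w))
                                                       (cong (_++ bar ∷ v) (sym (networkPhase-word w))) ⟩
  phaseWord (statesPhase []) w ++ phaseWord networkPhase w ++ bar ∷ v ∎
  where
  open ≡-Reasoning
  X Y : Word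
  X = statesWord w
  Y = concatMap (connection Door) (network w)

startPlace endPlace : ∀ N → Place N
startPlace N = port zero 3F
endPlace   N = port zero 1F

startsWord : Word
startsWord = sequence (location Door {1}) (port zero 3F ∷ [])

after : Word → Cursor → Cursor
after []      c = c
after (x ∷ w) c = after w (advance x c)

after-++ : ∀ u v c → after (u ++ v) c ≡ after v (after u c)
after-++ []      v c = refl
after-++ (x ∷ u) v c = after-++ u v (advance x c)

sweep-++ : ∀ {A : Set} (f : Cursor → Symbol → List A) c u v →
           sweep f c (u ++ v) ≡ sweep f c u ++ sweep f (after u c) v
sweep-++ f c []      v = refl
sweep-++ f c (x ∷ u) v = trans (cong (f c x ++_) (sweep-++ f (advance x c) u v)) (sym (++-assoc (f c x) _ _))

-- The number of the winning gadget consists of the digits of `dishTag` followed by those of the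
-- target, so it can be copied from the input. The mode `gathers once` singles out the target there.
copyTarget : Table
copyTarget (gathers once) digit₁ = print digit₁ ∷ []
copyTarget (gathers once) digit₂ = print digit₂ ∷ []
copyTarget (gathers once) comma  = print comma ∷ []
copyTarget _              _      = []

copied : Cursor → Word → Word
copied = sweep (entryWord copyTarget)

copied-++ : ∀ c u v → copied c (u ++ v) ≡ copied c u ++ copied (after u c) v
copied-++ = sweep-++ (entryWord copyTarget)

copied-number : ∀ k {p a v u} → copied (cursor (gathers once) p a v u) (number k) ≡ number k
copied-number k = copied-digits (Bin.fromℕ k)
  where
  copied-digits : ∀ b {p a v u} → copied (cursor (gathers once) p a v u) (digits b ++ [ comma ]) ≡ digits b ++ [ comma ]
  copied-digits Bin.zero = refl
  copied-digits 1+[2 b ] = cong (digit₁ ∷_) (copied-digits b)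
  copied-digits 2[1+ b ] = cong (digit₂ ∷_) (copied-digits b)

data Before : Mode → Set where
  gathering  : Before (gathers loop)
  scattering : ∀ {s} → Before (scatters s)

record Silent (c : Cursor) (w : Word) (m : Mode) : Set where
  constructor _,_
  field
    nothing-copied : copied c w ≡ []
    mode-after     : mode (after w c) ≡ m

open Silent

silent-++ : ∀ {c u v m m′} → Silent c u m → (mode (after u c) ≡ m → Silent (after u c) v m′) →
            Silent c (u ++ v) m′
silent-++ {c} {u} {v} (e , m) s =
  let e′ , m′ = s m
  in trans (copied-++ c u v) (cong₂ _++_ e e′) , trans (cong mode (after-++ u v c)) m′

silent-digits : ∀ {m} → Before m → ∀ b {p a v u} → Silent (cursor m p a v u) (digits b) m
silent-digits before     Bin.zero = refl , refl
silent-digits gathering  1+[2 b ] = let e , m = silent-digits gathering b in e , m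
silent-digits gathering  2[1+ b ] = let e , m = silent-digits gathering b in e , m
silent-digits scattering 1+[2 b ] = let e , m = silent-digits scattering b in e , m
silent-digits scattering 2[1+ b ] = let e , m = silent-digits scattering b in e , m

silent-symbol : ∀ {m} → Before m → ∀ x {c} → mode c ≡ m → Silent c (x ∷ []) (nextMode x m)
silent-symbol gathering  digit₁    refl = refl , refl
silent-symbol gathering  digit₂    refl = refl , refl
silent-symbol gathering  comma     refl = refl , refl
silent-symbol gathering  semicolon refl = refl , refl
silent-symbol gathering  bar       refl = refl , refl
silent-symbol scattering digit₁    refl = refl , refl
silent-symbol scattering digit₂    refl = refl , refl
silent-symbol scattering comma     refl = refl , refl
silent-symbol scattering semicolon refl = refl , refl
silent-symbol scattering bar       refl = refl , refl

silent-numbers : ∀ {m} → Before m → ∀ {n} (v : Counts n) {c} → mode c ≡ m →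
                 Silent c (numbers v) (nextMode semicolon m)
silent-numbers {m} before v e = silent-++ (silent-entries v e) (silent-symbol before semicolon)
  where
  silent-entries : ∀ {n} (v : Counts n) {c} → mode c ≡ m → Silent c (concatMap number (toList v)) m
  silent-entries []      e    = refl , e
  silent-entries (k ∷ v) refl =
    silent-++ {u = number k} (silent-++ (silent-digits before (Bin.fromℕ k)) (silent-symbol before comma))
              (silent-entries v)

silent-rules : ∀ {n} (rs : List (Rule n)) {c} → mode c ≡ gathers loop →
               Silent c (sequence rule rs) (scatters once)
silent-rules rs e = silent-++ (silent-entries rs e) (silent-symbol gathering bar)
  where
  silent-entries : ∀ {n} (rs : List (Rule n)) {c} → mode c ≡ gathers loop →
                   Silent c (concatMap rule rs) (gathers loop)
  silent-entries []             e = refl , e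
  silent-entries ((u , v) ∷ rs) e =
    silent-++ {u = numbers u ++ numbers v}
              (silent-++ {u = numbers u} (silent-numbers gathering u e) (silent-numbers scattering v))
              (silent-entries rs)

configWord : ∀ {n} → List (Rule n) → Counts n → Word
configWord rs v = sequence rule rs ++ numbers v

copied-target : ∀ {n} (rs : List (Rule n)) (v : Counts n) k →
                copied origin (sequence rule rs ++ numbers v ++ number k) ≡ number k
copied-target rs v k =
  trans (cong (copied origin) (sym (++-assoc (sequence rule rs) (numbers v) (number k))))
  (trans (copied-++ origin (configWord rs v) (number k))
  (cong₂ _++_ (nothing-copied all) (helper (mode-after all))))
  where
  all : Silent origin (configWord rs v) (gathers once)
  all = silent-++ {u = sequence rule rs} (silent-rules rs refl) (silent-numbers scattering v)
  helper : ∀ {c} → mode c ≡ gathers once → copied c (number k) ≡ number k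
  helper refl = copied-number k

copyPhase : Word → Phase
copyPhase u = record
  { preamble = constant u
  ; table    = copyTarget
  ; width    = 1
  ; bounded  = bounded
  }
  where
  bounded : ∀ m x → length (copyTarget m x) ≤ 1
  bounded (gathers once) digit₁    = ≤-refl
  bounded (gathers once) digit₂    = ≤-refl
  bounded (gathers once) comma     = ≤-refl
  bounded (gathers once) semicolon = z≤n
  bounded (gathers once) bar       = z≤n
  bounded (gathers loop) _         = z≤n
  bounded (scatters _)   _         = z≤n

productionWord : ProductionInstance → Word
productionWord = Problem.encode Production

productionReduction : ProductionInstance → RobotReachabilityInstance Door
productionReduction x = record
  { sys    = theSystem w
  ; starts = startPlace (length w) ∷ []
  ; win    = node (length w) 0 (toℕ (ProductionInstance.target x)) dishNode
  }
  where
  w : Word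
  w = productionWord x

productionPhases : List Phase
productionPhases =
  statesPhase [] ∷ networkPhase ∷
  copyPhase (bar ∷ startsWord ++ tagWord dishTag) ∷
  constantPhase (index {4} 1F ++ [ semicolon ]) ∷ []

length-concatMap-number : ∀ {n} (v : Counts n) → n ≤ length (concatMap number (toList v))
length-concatMap-number []      = z≤n
length-concatMap-number (k ∷ v) rewrite length-++ (number k) {concatMap number (toList v)}
                                      | length-++ (digits (Bin.fromℕ k)) {[ comma ]} =
  +-mono-≤ (m≤n+m 1 _) (length-concatMap-number v)

length-numbers : ∀ {n} (v : Counts n) → n ≤ length (numbers v)
length-numbers v rewrite length-++ (concatMap number (toList v)) {[ semicolon ]} =
  ≤-trans (length-concatMap-number v) (m≤m+n _ 1)

length-infix : ∀ {A : Set} (u v w : List A) → length v ≤ length (u ++ v ++ w)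
length-infix u v w rewrite length-++ u {v ++ w} | length-++ v {w} = ≤-trans (m≤m+n _ _) (m≤n+m _ (length u))

-- The initial vector alone spends a symbol on every dish. Hence the number of the winning gadget is
-- within the range where `mod` changes nothing.
dish-≤ : ∀ x → toℕ (ProductionInstance.target x) ≤ suc (length (productionWord x))
dish-≤ x =
  ≤-trans (<⇒≤ (toℕ<n target))
    (≤-trans (length-numbers initial)
      (≤-trans (length-infix (sequence rule rules) (numbers initial) (index target)) (n≤1+n _)))
  where open ProductionInstance x

productionPhases-word : ∀ x → phasesWord productionPhases (productionWord x) ≡
                              Problem.encode (RobotReachability Door) (productionReduction x)
productionPhases-word x = sym (begin
  system Door (theSystem w) ++ startsWord ++ location Door win
    ≡⟨ system-word w (startsWord ++ location Door win) ⟩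
  A ++ B ++ bar ∷ startsWord ++ location Door win
    ≡⟨ cong (λ v → A ++ B ++ bar ∷ startsWord ++ v ++ E) win-number ⟩
  A ++ B ++ bar ∷ startsWord ++ (tagWord dishTag ++ number (toℕ target)) ++ E
    ≡⟨ cong (λ v → A ++ B ++ (bar ∷ startsWord ++ tagWord dishTag) ++ v ++ E)
            (sym (copied-target rules initial (toℕ target))) ⟩
  A ++ B ++ (bar ∷ startsWord ++ tagWord dishTag) ++ copied origin w ++ E
    ≡⟨ cong (λ v → A ++ B ++ (v ++ copied origin w) ++ E)
            (sym (expand-constant 0 0 (bar ∷ startsWord ++ tagWord dishTag))) ⟩
  A ++ B ++ phaseWord (copyPhase (bar ∷ startsWord ++ tagWord dishTag)) w ++ E
    ≡⟨ cong (λ v → A ++ B ++ phaseWord (copyPhase (bar ∷ startsWord ++ tagWord dishTag)) w ++ v)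
            (sym (trans (++-identityʳ _) (constantPhase-word E w))) ⟩
  phasesWord productionPhases w ∎)
  where
  open ProductionInstance x
  open ≡-Reasoning
  w A B E : Word
  w = productionWord x
  A = phaseWord (statesPhase []) w
  B = phaseWord networkPhase w
  E = index {4} 1F ++ [ semicolon ]
  win : Place (length w)
  win = node (length w) 0 (toℕ target) dishNode
  win-number : number (toℕ (gadget (length w) dishTag (toℕ target))) ≡ tagWord dishTag ++ number (toℕ target)
  win-number = trans (cong number (toℕ-gadget (length w) dishTag (dish-≤ x))) (number-gadgetNo dishTag (toℕ target))

reconfigurationWord : ConfigurationReachabilityInstance → Word
reconfigurationWord = Problem.encode ConfigurationReachability

finalRobots : ∀ N → Robots Door (copiesFor N)
finalRobots N = addRobot Door (endPlace N) (noRobots Door (copiesFor N))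

reconfigurationReduction : ConfigurationReachabilityInstance → TargetedReconfigurationInstance Door
reconfigurationReduction x = record
  { sys    = theSystem w
  ; starts = startPlace (length w) ∷ []
  ; target = ⟨ Vec.replicate _ zero , finalRobots (length w) ⟩
  }
  where
  w : Word
  w = reconfigurationWord x

endRow emptyRow : Word
endRow   = numbers (0 ∷ 1 ∷ 0 ∷ 0 ∷ [])
emptyRow = numbers (0 ∷ 0 ∷ 0 ∷ 0 ∷ [])

reconfigurationPhases : List Phase
reconfigurationPhases =
  statesPhase [] ∷ networkPhase ∷
  statesPhase (bar ∷ startsWord) ∷
  -- Gadget 0 has the row with the robot at `end`; 23 of the 24 fixed gadgets remain.
  repeatPhase (semicolon ∷ endRow) 23 emptyRow ∷
  constantPhase [ bar ] ∷ []

finalRobots-word : ∀ N → concatMap numbers (toList (finalRobots N)) ≡ endRow ++ repeated (23 + N * 8) emptyRow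
finalRobots-word N = cong (endRow ++_) (concatMap-replicate numbers (23 + N * 8) (Vec.replicate 4 0))

reconfigurationPhases-word : ∀ x → phasesWord reconfigurationPhases (reconfigurationWord x) ≡
  Problem.encode (TargetedReconfiguration Door) (reconfigurationReduction x)
reconfigurationPhases-word x = sym (begin
  system Door (theSystem w) ++ startsWord ++ (X ++ [ semicolon ]) ++ R ++ [ bar ]
    ≡⟨ system-word w _ ⟩
  A ++ B ++ bar ∷ startsWord ++ (X ++ [ semicolon ]) ++ R ++ [ bar ]
    ≡⟨ cong (λ v → A ++ B ++ bar ∷ startsWord ++ v) (++-assoc X [ semicolon ] (R ++ [ bar ])) ⟩
  A ++ B ++ bar ∷ startsWord ++ X ++ semicolon ∷ R ++ [ bar ]
    ≡⟨ cong (λ v → A ++ B ++ v ++ semicolon ∷ R ++ [ bar ]) (sym (statesPhase-word (bar ∷ startsWord) w)) ⟩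
  A ++ B ++ C ++ (semicolon ∷ R) ++ [ bar ]
    ≡⟨ cong (λ v → A ++ B ++ C ++ v ++ [ bar ])
            (trans (cong (semicolon ∷_) (finalRobots-word (length w)))
                   (sym (repeatPhase-word (semicolon ∷ endRow) 23 emptyRow w))) ⟩
  A ++ B ++ C ++ D ++ [ bar ]
    ≡⟨ cong (λ v → A ++ B ++ C ++ D ++ v) (sym (trans (++-identityʳ _) (constantPhase-word [ bar ] w))) ⟩
  phasesWord reconfigurationPhases w ∎)
  where
  open ≡-Reasoning
  w A B C D X R : Word
  w = reconfigurationWord x
  A = phaseWord (statesPhase []) w
  B = phaseWord networkPhase w
  C = phaseWord (statesPhase (bar ∷ startsWord)) w
  D = phaseWord (repeatPhase (semicolon ∷ endRow) 23 emptyRow) w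
  X = statesWord w
  R = concatMap numbers (toList (finalRobots (length w)))

-- Weights of robots

at-+ : ∀ a v v′ x → at a (v + v′) x ≡ at a v x + at a v′ x
at-+ a v v′ x with a ≡ᵇ x
... | true  = refl
... | false = refl

-- The robot at (control now) stands for what it has gathered, or for what it has
-- still to scatter, in the current vector.
pending : ℕ → ℕ → Word → ℕ → ℕ
pending a v []              x = 0
pending a v (digit₁ ∷ w)    x = at a v x + pending a (v + v) w x
pending a v (digit₂ ∷ w)    x = at a (v + v) x + pending a (v + v) w x
pending a v (comma ∷ w)     x = pending (suc a) 1 w x
pending a v (semicolon ∷ w) x = 0
pending a v (bar ∷ w)       x = 0

controlWeight : Cursor → Word → ℕ → ℕ
controlWeight (cursor (gathers _)  p a v u) w = u
controlWeight (cursor (scatters _) p a v u) w = pending a v w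

levelWeight : Cursor → ℕ → ℕ
levelWeight c = at (dish c) (weight c)

read : Cursor × Word → Cursor × Word
read (c , [])    = c , []
read (c , s ∷ w) = advance s c , w

-- With d ∸ c held by the door between its two passages, each of them preserves the
-- total weight.
data Balanced : Vec ℕ 4 → Set where
  balanced : ∀ {a b c d} → c ≤ d → a + c ≡ b + d → Balanced (a ∷ b ∷ c ∷ d ∷ [])

merge-balanced : ∀ {x y z} → x + y ≡ z → Balanced (x ∷ 0 ∷ y ∷ z ∷ [])
merge-balanced {x} {y} refl = balanced (m≤n+m y x) refl

split-balanced : ∀ {x y z} → x ≡ y + z → Balanced (x ∷ y ∷ 0 ∷ z ∷ [])
split-balanced refl = balanced z≤n (+-identityʳ _)

-- S and E are what the robots at start and end stand for, and Fire u v says that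
-- u may be exchanged for v.
module Weights (S E : ℕ → ℕ) (Fire : (ℕ → ℕ) → (ℕ → ℕ) → Set) where

  -- Within a vector the weights balance at any cursor. Only where two vectors meet, or one meets
  -- `start` or `end`, does something about the instance enter: the two sides form a rule, the
  -- initial vector is `S`, the target is `E`.
  Local : Symbol → Cursor → Word → Set
  Local semicolon (cursor (gathers loop) p a v u) w = Fire u (pending 0 1 w)
  Local semicolon (cursor (gathers once) p a v u) w = ∀ x → u x ≡ E x
  Local bar       (cursor (gathers loop) p a v u) w = ∀ x → pending 0 1 w x ≡ S x
  Local _         _                               w = ⊤

  Valid : Cursor → Word → Set
  Valid c []      = ⊤
  Valid c (s ∷ w) = Local s c w × Valid (advance s c) w

  module _ (c : Cursor) (s : Symbol) (w : Word) (x : ℕ) where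

    nodeWeight : Node → ℕ
    nodeWeight (control now)   = controlWeight c (s ∷ w) x
    nodeWeight (control later) = controlWeight (advance s c) w x
    nodeWeight (level now)     = levelWeight c x
    nodeWeight (level later)   = levelWeight (advance s c) x
    nodeWeight dishNode        = at (nextDish s (dish c)) 1 x
    nodeWeight void            = 0
    nodeWeight start           = S x
    nodeWeight end             = E x

    gateWeights : Gate → Vec ℕ 4
    gateWeights g = Vec.map nodeWeight (wiring g (mode c) s)

    terminalWeight : Terminal → ℕ
    terminalWeight (plain k)      = nodeWeight k
    terminalWeight (gatePort g i) = lookup (gateWeights g) i

    SameWeight : Link → Set
    SameWeight (k , l) = terminalWeight k ≡ nodeWeight l

  direct-same : ∀ c s w x → Local s c w → All (SameWeight c s w x) (directLinks (mode c) s)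
  direct-same c digit₁ w x l = []
  direct-same c digit₂ w x l = []
  direct-same (cursor (gathers s)     p a v u) comma w x l = refl ∷ refl ∷ []
  direct-same (cursor (scatters s)    p a v u) comma w x l = refl ∷ refl ∷ []
  direct-same (cursor (gathers loop)  p a v u) semicolon w x l = refl ∷ []
  direct-same (cursor (gathers once)  p a v u) semicolon w x l = refl ∷ l x ∷ []
  direct-same (cursor (scatters loop) p a v u) semicolon w x l = refl ∷ refl ∷ refl ∷ []
  direct-same (cursor (scatters once) p a v u) semicolon w x l = refl ∷ refl ∷ refl ∷ []
  direct-same (cursor (gathers loop)  p a v u) bar w x l = refl ∷ l x ∷ []
  direct-same (cursor (gathers once)  p a v u) bar w x l = refl ∷ []
  direct-same (cursor (scatters s)    p a v u) bar w x l = refl ∷ []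

  links-same : ∀ c s w x → Local s c w → All (SameWeight c s w x) (links (mode c) s)
  links-same c s w x l =
    all-++ (wires toll refl) (all-++ (wires exchange refl) (direct-same c s w x l))
    where
    -- A port of a gate gets its weight from the node wired to it. Generalising the wiring to `ns`
    -- allows it to be split into its four nodes.
    wires : ∀ g {ns} → wiring g (mode c) s ≡ ns → All (SameWeight c s w x) (wireLinks g ns)
    wires g {k₀ ∷ k₁ ∷ k₂ ∷ k₃ ∷ []} eq = same 0F ∷ same 1F ∷ same 2F ∷ same 3F ∷ []
      where
      same : ∀ i → lookup (gateWeights c s w x g) i ≡
                   lookup (Vec.map (nodeWeight c s w x) (k₀ ∷ k₁ ∷ k₂ ∷ k₃ ∷ [])) i
      same i = cong (λ ns → lookup (Vec.map (nodeWeight c s w x) ns) i) eq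

  -- In the case `firing` the passage from C to D joins two locations of weight 0, so the one-way
  -- door is reset free of charge after each use.
  data Gated (c : Cursor) (s : Symbol) (w : Word) (g : Gate) : Set where
    steady : (∀ x → Balanced (gateWeights c s w x g)) → Gated c s w g
    firing : ∀ {u v} → Fire u v → (∀ x → gateWeights c s w x g ≡ u x ∷ v x ∷ 0 ∷ 0 ∷ []) → Gated c s w g

  private
    idle-balanced : Balanced (0 ∷ 0 ∷ 0 ∷ 0 ∷ [])
    idle-balanced = balanced z≤n refl

  gated : ∀ c s w → Local s c w → ∀ g → Gated c s w g
  gated (cursor (gathers _) p a v u)    digit₁    w l toll     = steady λ x → merge-balanced (+-comm (at a v x) (u x))
  gated (cursor (gathers _) p a v u)    digit₂    w l toll     = steady λ x → merge-balanced (+-comm (at a (v + v) x) (u x))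
  gated (cursor (gathers _) p a v u)    digit₁    w l exchange = steady λ x → merge-balanced (sym (at-+ a v v x))
  gated (cursor (gathers _) p a v u)    digit₂    w l exchange = steady λ x → merge-balanced (sym (at-+ a v v x))
  gated (cursor (scatters _) p a v u)   digit₁    w l toll     = steady λ x → split-balanced (+-comm (at a v x) _)
  gated (cursor (scatters _) p a v u)   digit₂    w l toll     = steady λ x → split-balanced (+-comm (at a (v + v) x) _)
  gated (cursor (scatters _) p a v u)   digit₁    w l exchange = steady λ x → split-balanced (at-+ a v v x)
  gated (cursor (scatters _) p a v u)   digit₂    w l exchange = steady λ x → split-balanced (at-+ a v v x)
  gated (cursor (gathers loop) p a v u) semicolon w l toll     = firing l λ x → refl
  gated (cursor (gathers loop) p a v u) semicolon w l exchange = steady λ x → idle-balanced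
  gated (cursor (gathers once) p a v u) semicolon w l toll     = steady λ x → idle-balanced
  gated (cursor (gathers once) p a v u) semicolon w l exchange = steady λ x → idle-balanced
  gated (cursor (gathers _) p a v u)    comma     w l toll     = steady λ x → idle-balanced
  gated (cursor (gathers _) p a v u)    comma     w l exchange = steady λ x → idle-balanced
  gated (cursor (gathers _) p a v u)    bar       w l toll     = steady λ x → idle-balanced
  gated (cursor (gathers _) p a v u)    bar       w l exchange = steady λ x → idle-balanced
  gated (cursor (scatters _) p a v u)   comma     w l toll     = steady λ x → idle-balanced
  gated (cursor (scatters _) p a v u)   comma     w l exchange = steady λ x → idle-balanced
  gated (cursor (scatters _) p a v u)   semicolon w l toll     = steady λ x → idle-balanced
  gated (cursor (scatters _) p a v u)   semicolon w l exchange = steady λ x → idle-balanced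
  gated (cursor (scatters _) p a v u)   bar       w l toll     = steady λ x → idle-balanced
  gated (cursor (scatters _) p a v u)   bar       w l exchange = steady λ x → idle-balanced

  module _ (word : Word) (valid : Valid origin word) where

    private
      N : ℕ
      N = length word

    -- A gadget is known by its number alone, so its weights are found by replaying the scan up to
    -- the position in that number. Past the end the scan stands still, and the gates there weigh
    -- nothing.
    scanned : ℕ → Cursor × Word
    scanned zero    = origin , word
    scanned (suc p) = read (scanned p)

    scanned-valid : ∀ p → Valid (proj₁ (scanned p)) (proj₂ (scanned p))
    scanned-valid zero = valid
    scanned-valid (suc p) with scanned p | scanned-valid p
    ... | c , []    | _     = tt
    ... | c , s ∷ w | _ , v = v

    module _ (x : ℕ) where

      gateWeightsAt : Gate → Cursor × Word → Vec ℕ 4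
      gateWeightsAt g (c , [])    = Vec.replicate 4 0
      gateWeightsAt g (c , s ∷ w) = gateWeights c s w x g

      placeWeights : Cursor × Word → Vec ℕ 4
      placeWeights (c , w) =
        controlWeight c w x ∷ controlWeight c w x ∷ levelWeight c x ∷ levelWeight c x ∷ []

      -- Decodes `tagged`. A gadget that is no gate has equal weights at both ends of each tunnel,
      -- so its door is covered by the same conservation law as the others, whatever passes through
      -- it.
      portWeights : ℕᵇ → Vec ℕ 4
      portWeights Bin.zero                    = E x ∷ E x ∷ S x ∷ S x ∷ []
      portWeights 1+[2 b ]                    = Vec.replicate 4 (at (Bin.toℕ b) 1 x)
      portWeights 2[1+ 1+[2 b ] ]             = placeWeights (scanned (Bin.toℕ b))
      portWeights 2[1+ 2[1+ 1+[2 b ] ] ]      = gateWeightsAt toll (scanned (Bin.toℕ b))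
      portWeights 2[1+ 2[1+ 2[1+ b ] ] ]      = gateWeightsAt exchange (scanned (Bin.toℕ b))
      portWeights _                           = Vec.replicate 4 0

      gadgetWeights : Fin (copiesFor N) → Vec ℕ 4
      gadgetWeights i = portWeights (Bin.fromℕ (toℕ i))

      locationWeight : Place N → ℕ
      locationWeight (port i k) = lookup (gadgetWeights i) k
      locationWeight spawner    = 0

      gadgetWeights-tagged : ∀ t {n} → n ≤ suc N →
                             gadgetWeights (gadget N t n) ≡ portWeights (tagged t (Bin.fromℕ n))
      gadgetWeights-tagged t {n} n≤ =
        cong portWeights (trans (cong Bin.fromℕ (toℕ-gadget N t n≤)) (fromℕ-toℕ (tagged t (Bin.fromℕ n))))

      place-weights : ∀ {n} → n ≤ suc N → gadgetWeights (gadget N placeTag n) ≡ placeWeights (scanned n)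
      place-weights {n} n≤ =
        trans (gadgetWeights-tagged placeTag n≤) (cong (placeWeights ∘ scanned) (toℕ-fromℕ n))

      dish-weights : ∀ {n} → n ≤ suc N → gadgetWeights (gadget N dishTag n) ≡ Vec.replicate 4 (at n 1 x)
      dish-weights {n} n≤ =
        trans (gadgetWeights-tagged dishTag n≤) (cong (λ a → Vec.replicate 4 (at a 1 x)) (toℕ-fromℕ n))

      gate-weights : ∀ g {n} → n ≤ suc N → gadgetWeights (gadget N (gateTag g) n) ≡ gateWeightsAt g (scanned n)
      gate-weights toll     {n} n≤ =
        trans (gadgetWeights-tagged (gateTag toll) n≤) (cong (gateWeightsAt toll ∘ scanned) (toℕ-fromℕ n))
      gate-weights exchange {n} n≤ =
        trans (gadgetWeights-tagged (gateTag exchange) n≤) (cong (gateWeightsAt exchange ∘ scanned) (toℕ-fromℕ n))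

      control-weight : ∀ {n} → n ≤ suc N →
                       locationWeight (port (gadget N placeTag n) 1F) ≡ lookup (placeWeights (scanned n)) 1F
      control-weight n≤ = cong (λ v → lookup v 1F) (place-weights n≤)

      level-weight : ∀ {n} → n ≤ suc N →
                     locationWeight (port (gadget N placeTag n) 3F) ≡ lookup (placeWeights (scanned n)) 3F
      level-weight n≤ = cong (λ v → lookup v 3F) (place-weights n≤)

      dish-weight : ∀ {n} → n ≤ suc N → locationWeight (port (gadget N dishTag n) 1F) ≡ at n 1 x
      dish-weight n≤ = cong (λ v → lookup v 1F) (dish-weights n≤)

      module _ {p : ℕ} {c : Cursor} {s : Symbol} {w : Word} (p≤ : p ≤ N) (a≤ : nextDish s (dish c) ≤ suc N)
               (here≡ : scanned p ≡ (c , s ∷ w)) where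

        private
          p≤′ : p ≤ suc N
          p≤′ = ≤-trans p≤ (n≤1+n N)

        node-weight : ∀ k → locationWeight (node N p (nextDish s (dish c)) k) ≡ nodeWeight c s w x k
        node-weight (control now)   = trans (control-weight p≤′) (cong (λ y → lookup (placeWeights y) 1F) here≡)
        node-weight (control later) = trans (control-weight (s≤s p≤)) (cong (λ y → lookup (placeWeights (read y)) 1F) here≡)
        node-weight (level now)     = trans (level-weight p≤′) (cong (λ y → lookup (placeWeights y) 3F) here≡)
        node-weight (level later)   = trans (level-weight (s≤s p≤)) (cong (λ y → lookup (placeWeights (read y)) 3F) here≡)
        node-weight dishNode        = dish-weight a≤
        node-weight void            = refl
        node-weight start           = refl
        node-weight end             = refl

        terminal-weight : ∀ k → locationWeight (terminal N p (nextDish s (dish c)) k) ≡ terminalWeight c s w x k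
        terminal-weight (plain k)      = node-weight k
        terminal-weight (gatePort g i) =
          cong (λ v → lookup v i) (trans (gate-weights g p≤′) (cong (gateWeightsAt g) here≡))

      SamePlaceWeight : Place N × Place N → Set
      SamePlaceWeight (l , l′) = locationWeight l ≡ locationWeight l′

      sweep-same : ∀ c w → scanned (position c) ≡ (c , w) → dish c ≤ position c → position c + length w ≤ N →
                   All SamePlaceWeight (sweep (linksAt N) c w)
      sweep-same c []      _     _   _  = []
      sweep-same c (s ∷ w) here≡ a≤p p≤ =
        all-++ (map⁺ (All.map (λ {k} → at-places k) (links-same c s w x (proj₁ valid-here))))
            (sweep-same (advance s c) w (cong read here≡) (nextDish-≤ s a≤p)
                        (≤-trans (≤-reflexive (sym (+-suc (position c) (length w)))) p≤))
        where
        valid-here : Valid c (s ∷ w)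
        valid-here = subst (λ (c , w) → Valid c w) here≡ (scanned-valid (position c))
        p≤N : position c ≤ N
        p≤N = ≤-trans (m≤m+n _ _) p≤
        a≤N : nextDish s (dish c) ≤ suc N
        a≤N = ≤-trans (nextDish-≤ s a≤p) (s≤s p≤N)
        at-places : ∀ k → SameWeight c s w x k → SamePlaceWeight (linkAt N (position c) (nextDish s (dish c)) k)
        at-places (k , l) e =
          trans (terminal-weight p≤N a≤N here≡ k) (trans e (sym (node-weight p≤N a≤N here≡ l)))

      network-same : All SamePlaceWeight (network word)
      network-same =
        control-weight z≤n ∷ trans (level-weight z≤n) (sym (dish-weight z≤n)) ∷
        sweep-same origin word refl z≤n ≤-refl

    data Kind (i : Fin (copiesFor N)) : Set where
      steady : (∀ x → Balanced (gadgetWeights x i)) → Kind i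
      firing : ∀ {u v} → Fire u v → (∀ x → gadgetWeights x i ≡ u x ∷ v x ∷ 0 ∷ 0 ∷ []) → Kind i

    private
      flat : ∀ {v v′} → Balanced (v ∷ v ∷ v′ ∷ v′ ∷ [])
      flat = balanced ≤-refl refl

    kind : ∀ i → Kind i
    kind i = of (Bin.fromℕ (toℕ i)) refl
      where
      gate-kind : ∀ g p → (∀ x → gadgetWeights x i ≡ gateWeightsAt x g (scanned p)) → Kind i
      gate-kind g p eq with scanned p | scanned-valid p
      ... | c , []    | _     = steady λ x → subst Balanced (sym (eq x)) flat
      ... | c , s ∷ w | l , _ with gated c s w l g
      ...   | steady b   = steady λ x → subst Balanced (sym (eq x)) (b x)
      ...   | firing f e = firing f λ x → trans (eq x) (e x)
      of : ∀ b → Bin.fromℕ (toℕ i) ≡ b → Kind i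
      of Bin.zero                eq = steady λ x → subst (Balanced ∘ portWeights x) (sym eq) flat
      of 1+[2 b ]                eq = steady λ x → subst (Balanced ∘ portWeights x) (sym eq) flat
      of 2[1+ Bin.zero ]         eq = steady λ x → subst (Balanced ∘ portWeights x) (sym eq) flat
      of 2[1+ 1+[2 b ] ]         eq = steady λ x → subst (Balanced ∘ portWeights x) (sym eq) flat
      of 2[1+ 2[1+ Bin.zero ] ]  eq = steady λ x → subst (Balanced ∘ portWeights x) (sym eq) flat
      of 2[1+ 2[1+ 1+[2 b ] ] ]  eq = gate-kind toll (Bin.toℕ b) λ x → cong (portWeights x) eq
      of 2[1+ 2[1+ 2[1+ b ] ] ]  eq = gate-kind exchange (Bin.toℕ b) λ x → cong (portWeights x) eq

-- The total weight of a configuration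

dot : ∀ {n} → Vec ℕ n → Vec ℕ n → ℕ
dot []       []       = 0
dot (w ∷ ws) (k ∷ ks) = k * w + dot ws ks

held : Fin 2 → Vec ℕ 4 → ℕ
held 0F _                     = 0
held 1F (_ ∷ _ ∷ c ∷ d ∷ []) = d ∸ c

total : ∀ {n} → (Fin n → Vec ℕ 4) → Vec (Fin 2) n → Vec (Vec ℕ 4) n → ℕ
total f []       []       = 0
total f (q ∷ qs) (r ∷ rs) = held q (f zero) + dot (f zero) r + total (f ∘ suc) qs rs

dot-add : ∀ {n} (ws ks : Vec ℕ n) i → dot ws (updateAt ks i suc) ≡ lookup ws i + dot ws ks
dot-add (w ∷ ws) (k ∷ ks) zero    = +-assoc w (k * w) (dot ws ks)
dot-add (w ∷ ws) (k ∷ ks) (suc i) rewrite dot-add ws ks i =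
  solve 3 (λ a b c → a :+ (b :+ c) := b :+ (a :+ c)) refl (k * w) (lookup ws i) (dot ws ks)

total-add : ∀ {n} (f : Fin n → Vec ℕ 4) qs rs i a →
            total f qs (updateAt rs i λ r → updateAt r a suc) ≡ lookup (f i) a + total f qs rs
total-add f (q ∷ qs) (r ∷ rs) zero a rewrite dot-add (f zero) r a =
  solve 4 (λ h l d t → h :+ (l :+ d) :+ t := l :+ (h :+ d :+ t)) refl
        (held q (f zero)) (lookup (f zero) a) (dot (f zero) r) (total (f ∘ suc) qs rs)
total-add f (q ∷ qs) (r ∷ rs) (suc i) a rewrite total-add (f ∘ suc) qs rs i a =
  solve 3 (λ h l t → h :+ (l :+ t) := l :+ (h :+ t)) refl
        (held q (f zero) + dot (f zero) r) (lookup (f (suc i)) a) (total (f ∘ suc) qs rs)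

-- The old and the new amount held stand on opposite sides, which avoids truncated subtraction.
total-state : ∀ {n} (f : Fin n → Vec ℕ 4) qs rs i s →
              total f (qs [ i ]≔ s) rs + held (lookup qs i) (f i) ≡ total f qs rs + held s (f i)
total-state f (q ∷ qs) (r ∷ rs) zero s =
  solve 4 (λ h h′ d t → h′ :+ d :+ t :+ h := h :+ d :+ t :+ h′) refl
        (held q (f zero)) (held s (f zero)) (dot (f zero) r) (total (f ∘ suc) qs rs)
total-state f (q ∷ qs) (r ∷ rs) (suc i) s =
  trans (+-assoc k _ _) (trans (cong (k +_) (total-state (f ∘ suc) qs rs i s)) (sym (+-assoc k _ _)))
  where
  k : ℕ
  k = held q (f zero) + dot (f zero) r

restore : ∀ {m n} (rs : Vec (Vec ℕ m) n) i a → 1 ≤ lookup (lookup rs i) a →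
          updateAt (updateAt rs i λ r → updateAt r a pred) i (λ r → updateAt r a suc) ≡ rs
restore (r ∷ rs) (suc i) a o = cong (r ∷_) (restore rs i a o)
restore (r ∷ rs) zero    a o = cong (_∷ rs) (restore-row r a o)
  where
  restore-row : ∀ {m} (r : Vec ℕ m) a → 1 ≤ lookup r a → updateAt (updateAt r a pred) a suc ≡ r
  restore-row (suc k ∷ r) zero    o = refl
  restore-row (k ∷ r)     (suc a) o = cong (k ∷_) (restore-row r a o)

dot-zero : ∀ {n} (ws : Vec ℕ n) → dot ws (Vec.replicate n 0) ≡ 0
dot-zero []       = refl
dot-zero (w ∷ ws) = dot-zero ws

total-empty : ∀ {n} (f : Fin n → Vec ℕ 4) → total f (Vec.replicate n zero) (noRobots Door n) ≡ 0
total-empty {zero}  f = refl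
total-empty {suc n} f = cong₂ _+_ (dot-zero (f zero)) (total-empty (f ∘ suc))

pointwise-≤ : ∀ {n} (u d : Counts n) → (∀ i → lookup u i ≤ lookup d i) → Pointwise _≤_ u d
pointwise-≤ []      []      le = []
pointwise-≤ (_ ∷ u) (_ ∷ d) le = le zero ∷ pointwise-≤ u d (le ∘ suc)

-- Weights of encoded numbers and vectors

entries : ∀ {n} → ℕ → Counts n → ℕ → ℕ
entries a []      x = 0
entries a (k ∷ v) x = at a k x + entries (suc a) v x

at-zero : ∀ a x → at a 0 x ≡ 0
at-zero a x with a ≡ᵇ x
... | true  = refl
... | false = refl

entries-below : ∀ {n} (v : Counts n) a → entries (suc a) v 0 ≡ 0
entries-below []      a = refl
entries-below (k ∷ v) a = entries-below v (suc a)

entries-suc : ∀ {n} (v : Counts n) a x → entries (suc a) v (suc x) ≡ entries a v x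
entries-suc []      a x = refl
entries-suc (k ∷ v) a x = cong (at a k x +_) (entries-suc v (suc a) x)

entries-lookup : ∀ {n} (v : Counts n) i → entries 0 v (toℕ i) ≡ lookup v i
entries-lookup (k ∷ v) zero    = trans (cong (k +_) (entries-below v 0)) (+-identityʳ k)
entries-lookup (k ∷ v) (suc i) = trans (entries-suc v 0 (toℕ i)) (entries-lookup v i)

double : ∀ v k → v + (v + v) * k ≡ v * suc (2 * k)
double = solve 2 (λ v k → v :+ (v :+ v) :* k := v :* (con 1 :+ con 2 :* k)) refl

double₂ : ∀ v k → v + v + (v + v) * k ≡ v * (2 * suc k)
double₂ = solve 2 (λ v k → v :+ v :+ (v :+ v) :* k := v :* (con 2 :* (con 1 :+ k))) refl

-- A digit 1 or 2 in front of b denotes 1 + 2b or 2(1 + b), and the doubling of the weight behind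
-- each digit absorbs the factor 2.
pending-digits : ∀ b {a v w} x →
                 pending a v (digits b ++ comma ∷ w) x ≡ at a (v * Bin.toℕ b) x + pending (suc a) 1 w x
pending-digits Bin.zero {a} {v} x rewrite *-zeroʳ v | at-zero a x = refl
pending-digits 1+[2 b ] {a} {v} {w} x =
  trans (cong (at a v x +_) (pending-digits b x))
  (trans (sym (+-assoc (at a v x) _ _))
  (cong (_+ pending (suc a) 1 w x)
    (trans (sym (at-+ a v _ x)) (cong (λ k → at a k x) (double v (Bin.toℕ b))))))
pending-digits 2[1+ b ] {a} {v} {w} x =
  trans (cong (at a (v + v) x +_) (pending-digits b x))
  (trans (sym (+-assoc (at a (v + v) x) _ _))
  (cong (_+ pending (suc a) 1 w x)
    (trans (sym (at-+ a (v + v) _ x)) (cong (λ k → at a k x) (double₂ v (Bin.toℕ b))))))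

pending-numbers : ∀ {n} (u : Counts n) {a w} x → pending a 1 (numbers u ++ w) x ≡ entries a u x
pending-numbers []      x = refl
pending-numbers (k ∷ u) {a} {w} x =
  trans (cong (λ w → pending a 1 w x) rearrange)
  (trans (pending-digits (Bin.fromℕ k) x)
  (cong₂ (λ j e → at a j x + e) (trans (*-identityˡ _) (toℕ-fromℕ k)) (pending-numbers u x)))
  where
  rearrange : numbers (k ∷ u) ++ w ≡ digits (Bin.fromℕ k) ++ comma ∷ numbers u ++ w
  rearrange = trans (cong (_++ w) (trans (++-assoc (number k) _ _) (++-assoc (digits (Bin.fromℕ k)) _ _)))
                    (++-assoc (digits (Bin.fromℕ k)) _ w)

module _ (S E : ℕ → ℕ) (Fire : (ℕ → ℕ) → (ℕ → ℕ) → Set) where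
  open Weights S E Fire

  -- The rest of the word is handled by a continuation, because what has been consumed at that point
  -- is known only pointwise, not as an equal function. Position and weight stay arbitrary there.
  valid-digits : ∀ b {m p a v u w} →
    (∀ {p′ v′ u′} → (∀ x → u′ x ≡ u x + at a (v * Bin.toℕ b) x) → Valid (cursor m p′ a v′ u′) w) →
    Valid (cursor m p a v u) (digits b ++ w)
  valid-digits Bin.zero {a = a} {v} {u} rest =
    rest λ x → sym (trans (cong (u x +_) (trans (cong (λ k → at a k x) (*-zeroʳ v)) (at-zero a x))) (+-identityʳ _))
  valid-digits 1+[2 b ] {a = a} {v} {u} rest = tt , valid-digits b λ e → rest λ x →
    trans (e x) (trans (+-assoc (u x) _ _)
      (cong (u x +_) (trans (sym (at-+ a v _ x)) (cong (λ k → at a k x) (double v (Bin.toℕ b))))))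
  valid-digits 2[1+ b ] {a = a} {v} {u} rest = tt , valid-digits b λ e → rest λ x →
    trans (e x) (trans (+-assoc (u x) _ _)
      (cong (u x +_) (trans (sym (at-+ a (v + v) _ x)) (cong (λ k → at a k x) (double₂ v (Bin.toℕ b))))))

  valid-number : ∀ k {m p a u w} →
    (∀ {p′ u′} → (∀ x → u′ x ≡ u x + at a k x) → Valid (cursor m p′ (suc a) 1 u′) w) →
    Valid (cursor m p a 1 u) (number k ++ w)
  valid-number k {a = a} {u} {w} rest =
    subst (Valid _) (sym (++-assoc (digits (Bin.fromℕ k)) _ w))
      (valid-digits (Bin.fromℕ k) λ e → tt , rest λ x →
        trans (e x) (cong (λ j → u x + at a j x) (trans (*-identityˡ _) (toℕ-fromℕ k))))

  valid-entries : ∀ {n} (v : Counts n) {m p a u w} →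
    (∀ {p′ a′ u′} → (∀ x → u′ x ≡ u x + entries a v x) → Valid (cursor m p′ a′ 1 u′) w) →
    Valid (cursor m p a 1 u) (concatMap number (toList v) ++ w)
  valid-entries []      rest = rest λ x → sym (+-identityʳ _)
  valid-entries (k ∷ v) {m} {p} {a} {u} {w} rest =
    subst (Valid _) (sym (++-assoc (number k) _ w))
      (valid-number k λ e → valid-entries v λ e′ → rest λ x →
        trans (e′ x) (trans (cong (_+ entries (suc a) v x) (e x)) (+-assoc (u x) _ _)))

  valid-numbers : ∀ {n} (v : Counts n) {m p a u w} → (∀ x → u x ≡ 0) →
    (∀ {p′ a′ u′} → (∀ x → u′ x ≡ entries a v x) → Valid (cursor m p′ a′ 1 u′) (semicolon ∷ w)) →
    Valid (cursor m p a 1 u) (numbers v ++ w)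
  valid-numbers v {a = a} {w = w} u≡0 rest =
    subst (Valid _) (sym (++-assoc (concatMap number (toList v)) _ w))
      (valid-entries v λ e → rest λ x → trans (e x) (cong (_+ entries a v x) (u≡0 x)))

-- Soundness: moves of robots followed by the net

module Soundness (net : PetriNet) (S E : ℕ → ℕ) where
  open PetriNet net

  Fire : (ℕ → ℕ) → (ℕ → ℕ) → Set
  Fire u v = ∃[ u′ ] ∃[ v′ ] (u′ , v′) ∈ rules ×
             (∀ i → u (toℕ i) ≡ lookup u′ i) × (∀ i → v (toℕ i) ≡ lookup v′ i)

  open Weights S E Fire

  valid-rules : ∀ rs → (∀ {r} → r ∈ rs → r ∈ rules) → ∀ {p u w} → (∀ x → u x ≡ 0) →
    (∀ {p u} → (∀ x → u x ≡ 0) → Valid (cursor (gathers loop) p 0 1 u) w) →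
    Valid (cursor (gathers loop) p 0 1 u) (concatMap rule rs ++ w)
  valid-rules []             rs⊆ u≡0 rest = rest u≡0
  valid-rules ((l , r) ∷ rs) rs⊆ {w = w} u≡0 rest =
    subst (Valid _) (sym (trans (++-assoc (numbers l ++ numbers r) _ w) (++-assoc (numbers l) (numbers r) _)))
      (valid-numbers S E Fire l u≡0 λ e →
        (l , r , rs⊆ (here refl) ,
         (λ i → trans (e (toℕ i)) (entries-lookup l i)) ,
         (λ i → trans (pending-numbers r (toℕ i)) (entries-lookup r i))) ,
        valid-numbers S E Fire r (λ _ → refl) λ _ →
          tt , valid-rules rs (rs⊆ ∘ there) (λ _ → refl) rest)

  valid-instance : ∀ (initial : Counts dishes) {w} → (∀ x → entries 0 initial x ≡ S x) →
    (∀ {p u} → (∀ x → u x ≡ 0) → Valid (cursor (gathers once) p 0 1 u) w) →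
    Valid origin (sequence rule rules ++ numbers initial ++ w)
  valid-instance initial {w} S≡ rest =
    subst (Valid _) (sym (++-assoc (concatMap rule rules) _ _))
      (valid-rules rules id (λ _ → refl) λ _ →
        (λ x → trans (pending-numbers initial x) (S≡ x)) ,
        valid-numbers S E Fire initial (λ _ → refl) λ _ →
          tt , rest λ _ → refl)

  module _ (word : Word) (valid : Valid origin word) where

    private
      N : ℕ
      N = length word
      gw : ℕ → Fin (copiesFor N) → Vec ℕ 4
      gw = gadgetWeights word valid
      lw : ℕ → Place N → ℕ
      lw = locationWeight word valid

    weigh : ℕ → Configuration Door (copiesFor N) → ℕ
    weigh x ⟨ q , r ⟩ = total (gw x) q r

    weigh-add : ∀ x q r l → weigh x ⟨ q , addRobot Door l r ⟩ ≡ lw x l + weigh x ⟨ q , r ⟩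
    weigh-add x q r (port i a) = total-add (gw x) q r i a
    weigh-add x q r spawner    = refl

    weigh-remove : ∀ x q r l → Occupied Door l r →
                   weigh x ⟨ q , r ⟩ ≡ lw x l + weigh x ⟨ q , removeRobot Door l r ⟩
    weigh-remove x q r (port i a) o =
      trans (cong (total (gw x) q) (sym (restore r i a o))) (total-add (gw x) q _ i a)
    weigh-remove x q r spawner    o = refl

    weigh-move : ∀ x q r l l′ → lw x l ≡ lw x l′ → Occupied Door l r →
                 weigh x ⟨ q , addRobot Door l′ (removeRobot Door l r) ⟩ ≡ weigh x ⟨ q , r ⟩
    weigh-move x q r l l′ e o =
      trans (weigh-add x q _ l′) (trans (cong (_+ _) (sym e)) (sym (weigh-remove x q r l o)))

    Represents : Configuration Door (copiesFor N) → Counts dishes → Set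
    Represents c d = ∀ i → weigh (toℕ i) c ≡ lookup d i

    adjacent-same : ∀ x {l l′} → Adjacent Door (theSystem word) l l′ → lw x l ≡ lw x l′
    adjacent-same x (inj₁ k) = All.lookup (network-same word valid x) k
    adjacent-same x (inj₂ k) = sym (All.lookup (network-same word valid x) k)

    module _ (q : Vec (Fin 2) (copiesFor N)) (r : Robots Door (copiesFor N)) (i : Fin (copiesFor N)) where

      private
        passed : Fin 4 → Fin 4 → Fin 2 → Configuration Door (copiesFor N)
        passed a b s = ⟨ q [ i ]≔ s , addRobot Door (port i b) (removeRobot Door (port i a) r) ⟩

      -- An account of a passage through any door, with nothing cancelled yet. Balanced doors and
      -- the one-way door draw their different conclusions from it.
      weigh-passed : ∀ x a b s {t} → lookup q i ≡ t → Occupied Door (port i a) r →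
        weigh x (passed a b s) + held t (gw x i) + lookup (gw x i) a
          ≡ weigh x ⟨ q , r ⟩ + held s (gw x i) + lookup (gw x i) b
      weigh-passed x a b s refl o = begin
        weigh x (passed a b s) + h + A                    ≡⟨ cong (_+ A) (total-state (gw x) q _ i s) ⟩
        weigh x ⟨ q , addRobot Door (port i b) r′ ⟩ + h′ + A
          ≡⟨ cong (λ k → k + h′ + A) (weigh-add x q r′ (port i b)) ⟩
        B + weigh x ⟨ q , r′ ⟩ + h′ + A
          ≡⟨ solve 4 (λ A B k h → B :+ k :+ h :+ A := A :+ k :+ h :+ B) refl A B (weigh x ⟨ q , r′ ⟩) h′ ⟩
        A + weigh x ⟨ q , r′ ⟩ + h′ + B                   ≡⟨ cong (λ k → k + h′ + B) (sym (weigh-remove x q r (port i a) o)) ⟩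
        weigh x ⟨ q , r ⟩ + h′ + B                        ∎
        where
        open ≡-Reasoning
        h h′ A B : ℕ
        h  = held (lookup q i) (gw x i)
        h′ = held s (gw x i)
        A  = lookup (gw x i) a
        B  = lookup (gw x i) b
        r′ : Robots Door (copiesFor N)
        r′ = removeRobot Door (port i a) r

      private
        conserve-AB : ∀ {W W′ ws} → Balanced ws → W′ + 0 + lookup ws 0F ≡ W + held 1F ws + lookup ws 1F → W′ ≡ W
        conserve-AB {W} {W′} (balanced {a} {b} {c} {d} c≤d a+c≡b+d) e =
          +-cancelʳ-≡ (a + c) W′ W
            (trans (solve 3 (λ w a c → w :+ (a :+ c) := w :+ con 0 :+ a :+ c) refl W′ a c)
            (trans (cong (_+ c) e)
            (trans (solve 4 (λ w h b c → w :+ h :+ b :+ c := w :+ (b :+ (h :+ c))) refl W (d ∸ c) b c)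
            (cong (W +_) (trans (cong (b +_) (m∸n+n≡m c≤d)) (sym a+c≡b+d))))))

        conserve-CD : ∀ {W W′ ws} → Balanced ws → W′ + held 1F ws + lookup ws 2F ≡ W + 0 + lookup ws 3F → W′ ≡ W
        conserve-CD {W} {W′} (balanced {a} {b} {c} {d} c≤d a+c≡b+d) e =
          +-cancelʳ-≡ d W′ W
            (trans (cong (W′ +_) (sym (m∸n+n≡m c≤d)))
            (trans (sym (+-assoc W′ (d ∸ c) c)) (trans e (cong (_+ d) (+-identityʳ W)))))

        fired : ∀ {W W′ u v ws} → ws ≡ u ∷ v ∷ 0 ∷ 0 ∷ [] →
                W′ + 0 + lookup ws 0F ≡ W + held 1F ws + lookup ws 1F → W′ + u ≡ W + v
        fired {W} {W′} {u} {v} refl e =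
          trans (cong (_+ u) (sym (+-identityʳ W′))) (trans e (cong (_+ v) (+-identityʳ W)))

        fired-back : ∀ {W W′ u v ws} → ws ≡ u ∷ v ∷ 0 ∷ 0 ∷ [] →
                     W′ + held 1F ws + lookup ws 2F ≡ W + 0 + lookup ws 3F → W′ ≡ W
        fired-back {W} {W′} refl e =
          +-cancelʳ-≡ 0 W′ W (+-cancelʳ-≡ 0 (W′ + 0) (W + 0) e)

        -- The robot about to enter contributes its own weight `u` to the total, which is why the
        -- rule is applicable at this moment.
        at-least : ∀ {u v ws} x → ws ≡ u ∷ v ∷ 0 ∷ 0 ∷ [] → gw x i ≡ ws → Occupied Door (port i 0F) r →
                   u ≤ weigh x ⟨ q , r ⟩
        at-least x refl e o =
          ≤-trans (≤-reflexive (sym (cong (λ ws → lookup ws 0F) e)))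
                  (≤-trans (m≤m+n _ _) (≤-reflexive (sym (weigh-remove x q r (port i 0F) o))))

      cross-AB : ∀ {d} → lookup q i ≡ 0F → Occupied Door (port i 0F) r → Represents ⟨ q , r ⟩ d →
                 ∃[ d′ ] Star (Fires net) d d′ × Represents (passed 0F 1F 1F) d′
      cross-AB {d} q≡ o rep = by (kind word valid i)
        where
        passing : ∀ x → weigh x (passed 0F 1F 1F) + 0 + lookup (gw x i) 0F
                          ≡ weigh x ⟨ q , r ⟩ + held 1F (gw x i) + lookup (gw x i) 1F
        passing x = weigh-passed x 0F 1F 1F q≡ o
        by : Kind word valid i → ∃[ d′ ] Star (Fires net) d d′ × Represents (passed 0F 1F 1F) d′
        by (steady b) = d , ε , λ j → trans (conserve-AB (b (toℕ j)) (passing (toℕ j))) (rep j)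
        by (firing {u} {v} (u′ , v′ , rule∈ , u≡ , v≡) e) =
          zipWith _+_ (zipWith _∸_ d u′) v′ , fire rule∈ (pointwise-≤ u′ d enough) ◅ ε , new
          where
          enough : ∀ j → lookup u′ j ≤ lookup d j
          enough j = ≤-trans (≤-reflexive (sym (u≡ j)))
                       (≤-trans (at-least (toℕ j) (e (toℕ j)) refl o) (≤-reflexive (rep j)))
          new : Represents (passed 0F 1F 1F) (zipWith _+_ (zipWith _∸_ d u′) v′)
          new j = begin
            weigh (toℕ j) (passed 0F 1F 1F)
              ≡⟨ sym (m+n∸n≡m _ (u (toℕ j))) ⟩
            weigh (toℕ j) (passed 0F 1F 1F) + u (toℕ j) ∸ u (toℕ j)
              ≡⟨ cong (_∸ u (toℕ j)) (fired (e (toℕ j)) (passing (toℕ j))) ⟩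
            weigh (toℕ j) ⟨ q , r ⟩ + v (toℕ j) ∸ u (toℕ j)
              ≡⟨ cong₂ _∸_ (cong₂ _+_ (rep j) (v≡ j)) (u≡ j) ⟩
            lookup d j + lookup v′ j ∸ lookup u′ j
              ≡⟨ +-∸-comm (lookup v′ j) (enough j) ⟩
            lookup d j ∸ lookup u′ j + lookup v′ j
              ≡⟨ cong (_+ lookup v′ j) (sym (lookup-zipWith _∸_ j d u′)) ⟩
            lookup (zipWith _∸_ d u′) j + lookup v′ j
              ≡⟨ sym (lookup-zipWith _+_ j (zipWith _∸_ d u′) v′) ⟩
            lookup (zipWith _+_ (zipWith _∸_ d u′) v′) j ∎
            where open ≡-Reasoning

      cross-CD : ∀ {d} → lookup q i ≡ 1F → Occupied Door (port i 2F) r → Represents ⟨ q , r ⟩ d →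
                 Represents (passed 2F 3F 0F) d
      cross-CD q≡ o rep j = trans (by (kind word valid i)) (rep j)
        where
        passing : weigh (toℕ j) (passed 2F 3F 0F) + held 1F (gw (toℕ j) i) + lookup (gw (toℕ j) i) 2F
                    ≡ weigh (toℕ j) ⟨ q , r ⟩ + 0 + lookup (gw (toℕ j) i) 3F
        passing = weigh-passed (toℕ j) 2F 3F 0F q≡ o
        by : Kind word valid i → weigh (toℕ j) (passed 2F 3F 0F) ≡ weigh (toℕ j) ⟨ q , r ⟩
        by (steady b)   = conserve-CD (b (toℕ j)) passing
        by (firing _ e) = fired-back (e (toℕ j)) passing

    simulate-move : ∀ {c c′ d} → Move Door (theSystem word) c c′ → Represents c d →
                    ∃[ d′ ] Star (Fires net) d d′ × Represents c′ d′
    simulate-move {d = d} (walk {q} {r} {l} {l′} adj o) rep =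
      d , ε , λ j → trans (weigh-move (toℕ j) q r l l′ (adjacent-same (toℕ j) adj) o) (rep j)
    -- Replacing `lookup q i` by a variable makes it possible to match on the equation that
    -- identifies the transition.
    simulate-move (traverse {q} {r} {i} (here e) o) rep = crossed refl e o
      where
      crossed : ∀ {t a b s} → lookup q i ≡ t → ((t , a) , (s , b)) ≡ ((0F , 0F) , (1F , 1F)) → Occupied Door (port i a) r →
                ∃[ d′ ] Star (Fires net) _ d′ × Represents ⟨ q [ i ]≔ s , addRobot Door (port i b) (removeRobot Door (port i a) r) ⟩ d′
      crossed q≡ refl o = cross-AB q r i q≡ o rep
    simulate-move {d = d} (traverse {q} {r} {i} (there (here e)) o) rep = crossed refl e o
      where
      crossed : ∀ {t a b s} → lookup q i ≡ t → ((t , a) , (s , b)) ≡ ((1F , 2F) , (0F , 3F)) → Occupied Door (port i a) r →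
                ∃[ d′ ] Star (Fires net) _ d′ × Represents ⟨ q [ i ]≔ s , addRobot Door (port i b) (removeRobot Door (port i a) r) ⟩ d′
      crossed q≡ refl o = _ , ε , cross-CD q r i {d} q≡ o rep

    simulate : ∀ {c c′ d} → Star (Move Door (theSystem word)) c c′ → Represents c d →
               ∃[ d′ ] Star (Fires net) d d′ × Represents c′ d′
    simulate ε        rep = _ , ε , rep
    simulate (m ◅ ms) rep =
      let _ , fs , rep′  = simulate-move m rep
          d , fs′ , rep″ = simulate ms rep′
      in d , fs ◅◅ fs′ , rep″

    -- Doors in their initial state hold nothing. This evaluates both the first configuration and,
    -- for reconfiguration, the last one.
    weigh-single : ∀ x l → weigh x ⟨ Vec.replicate _ zero , addRobot Door l (noRobots Door (copiesFor N)) ⟩ ≡ lw x l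
    weigh-single x l =
      trans (weigh-add x (Vec.replicate _ zero) (noRobots Door (copiesFor N)) l)
            (trans (cong (lw x l +_) (total-empty (gw x))) (+-identityʳ _))

    represents-start : ∀ (initial : Counts dishes) → (∀ x → entries 0 initial x ≡ S x) →
      Represents ⟨ Vec.replicate _ zero , addRobot Door (startPlace N) (noRobots Door (copiesFor N)) ⟩ initial
    represents-start initial S≡ i =
      trans (weigh-single (toℕ i) (startPlace N)) (trans (sym (S≡ (toℕ i))) (entries-lookup initial i))

-- Playing the rules of the net

module _ {n : ℕ} where

  add remove : Location Door n → Robots Door n → Robots Door n
  add    = addRobot Door
  remove = removeRobot Door

  add-row-comm : ∀ {m} (r : Vec ℕ m) a b → updateAt (updateAt r a suc) b suc ≡ updateAt (updateAt r b suc) a suc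
  add-row-comm (k ∷ r) zero    zero    = refl
  add-row-comm (k ∷ r) zero    (suc b) = refl
  add-row-comm (k ∷ r) (suc a) zero    = refl
  add-row-comm (k ∷ r) (suc a) (suc b) = cong (k ∷_) (add-row-comm r a b)

  add-comm : ∀ l l′ r → add l (add l′ r) ≡ add l′ (add l r)
  add-comm spawner    l′         r = refl
  add-comm (port i a) spawner    r = refl
  add-comm (port i a) (port j b) r = rows r i j
    where
    rows : ∀ {n} (r : Vec (Vec ℕ 4) n) i j →
           updateAt (updateAt r j (λ w → updateAt w b suc)) i (λ w → updateAt w a suc) ≡
           updateAt (updateAt r i (λ w → updateAt w a suc)) j (λ w → updateAt w b suc)
    rows (w ∷ r) zero    zero    = cong (_∷ r) (add-row-comm w b a)
    rows (w ∷ r) zero    (suc j) = refl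
    rows (w ∷ r) (suc i) zero    = refl
    rows (w ∷ r) (suc i) (suc j) = cong (w ∷_) (rows r i j)

  remove-add : ∀ l r → remove l (add l r) ≡ r
  remove-add spawner    r = refl
  remove-add (port i a) r = rows r i
    where
    row : ∀ {m} (w : Vec ℕ m) a → updateAt (updateAt w a suc) a pred ≡ w
    row (k ∷ w) zero    = refl
    row (k ∷ w) (suc a) = cong (k ∷_) (row w a)
    rows : ∀ {n} (r : Vec (Vec ℕ 4) n) i →
           updateAt (updateAt r i (λ w → updateAt w a suc)) i (λ w → updateAt w a pred) ≡ r
    rows (w ∷ r) zero    = cong (_∷ r) (row w a)
    rows (w ∷ r) (suc i) = cong (w ∷_) (rows r i)

  occupied-add : ∀ l r → Occupied Door l (add l r)
  occupied-add spawner    r = tt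
  occupied-add (port i a) r = rows r i
    where
    row : ∀ {m} (w : Vec ℕ m) a → 1 ≤ lookup (updateAt w a suc) a
    row (k ∷ w) zero    = s≤s z≤n
    row (k ∷ w) (suc a) = row w a
    rows : ∀ {n} (r : Vec (Vec ℕ 4) n) i → 1 ≤ lookup (lookup (updateAt r i (λ w → updateAt w a suc)) i) a
    rows (w ∷ r) zero    = row w a
    rows (w ∷ r) (suc i) = rows r i

  occupied-mono : ∀ l l′ r → Occupied Door l r → Occupied Door l (add l′ r)
  occupied-mono spawner    l′         r o = tt
  occupied-mono (port i a) spawner    r o = o
  occupied-mono (port i a) (port j b) r o = rows r i j o
    where
    row : ∀ {m} (w : Vec ℕ m) a b → 1 ≤ lookup w a → 1 ≤ lookup (updateAt w b suc) a
    row (k ∷ w) zero    zero    o = s≤s z≤n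
    row (k ∷ w) zero    (suc b) o = o
    row (k ∷ w) (suc a) zero    o = o
    row (k ∷ w) (suc a) (suc b) o = row w a b o
    rows : ∀ {n} (r : Vec (Vec ℕ 4) n) i j → 1 ≤ lookup (lookup r i) a →
           1 ≤ lookup (lookup (updateAt r j (λ w → updateAt w b suc)) i) a
    rows (w ∷ r) zero    zero    o = row w a b o
    rows (w ∷ r) zero    (suc j) o = o
    rows (w ∷ r) (suc i) zero    o = o
    rows (w ∷ r) (suc i) (suc j) o = rows r i j o

  place : List (Location Door n) → Robots Door n → Robots Door n
  place ls r = foldr add r ls

  place-↭ : ∀ {xs ys} → xs ↭ ys → ∀ r → place xs r ≡ place ys r
  place-↭ unchanged          r = refl
  place-↭ (prep l p)    r = cong (add l) (place-↭ p r)
  place-↭ (swap l l′ p) r = trans (cong (add l ∘ add l′) (place-↭ p r)) (add-comm l l′ _)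
  place-↭ (transitive p p′)  r = trans (place-↭ p r) (place-↭ p′ r)

  occupied-place : ∀ {l xs} → l ∈ xs → ∀ r → Occupied Door l (place xs r)
  occupied-place {xs = x ∷ xs} (here refl) r = occupied-add x (place xs r)
  occupied-place {l} {x ∷ xs}  (there l∈)  r = occupied-mono l x (place xs r) (occupied-place l∈ r)

replicate-+ : ∀ {A : Set} m n (x : A) → replicate (m + n) x ≡ replicate m x ++ replicate n x
replicate-+ zero    n x = refl
replicate-+ (suc m) n x = cong (x ∷_) (replicate-+ m n x)

module Playing (w : Word) where

  N : ℕ
  N = length w

  Step : Configuration Door (copiesFor N) → Configuration Door (copiesFor N) → Set
  Step = Star (Move Door (theSystem w))

  Near : Place N → Place N → Set
  Near = Adjacent Door (theSystem w)

  near-sym : ∀ {l l′} → Near l l′ → Near l′ l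
  near-sym (inj₁ k) = inj₂ k
  near-sym (inj₂ k) = inj₁ k

  closed : Vec (Fin 2) (copiesFor N)
  closed = Vec.replicate _ zero

  infix 4 _⟨_⇒_⟩_ _⟹_

  -- Quantifying over the bystanders `r` builds in a frame rule: a manoeuvre of a few robots remains
  -- possible among any others, which yields `beside` and `under`.
  record _⟨_⇒_⟩_ (xs : List (Place N)) (q q′ : Vec (Fin 2) (copiesFor N)) (ys : List (Place N)) : Set where
    constructor playing
    field
      play : ∀ r → Step ⟨ q , place xs r ⟩ ⟨ q′ , place ys r ⟩

  open _⟨_⇒_⟩_ public

  _⟹_ : List (Place N) → List (Place N) → Set
  xs ⟹ ys = xs ⟨ closed ⇒ closed ⟩ ys

  infixr 5 _then_

  _then_ : ∀ {xs ys zs q q′ q″} → xs ⟨ q ⇒ q′ ⟩ ys → ys ⟨ q′ ⇒ q″ ⟩ zs → xs ⟨ q ⇒ q″ ⟩ zs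
  f then g = playing λ r → play f r ◅◅ play g r

  reorder : ∀ {xs ys q} → xs ↭ ys → xs ⟨ q ⇒ q ⟩ ys
  reorder {xs} {ys} {q} p = playing λ r → subst (λ r′ → Step ⟨ q , place xs r ⟩ ⟨ q , r′ ⟩) (place-↭ p r) ε

  standing : ∀ {xs q} → xs ⟨ q ⇒ q ⟩ xs
  standing = playing λ r → ε

  -- Robots at the spawner are not recorded, so this takes no move at all.
  appear : ∀ {xs} → xs ⟹ spawner ∷ xs
  appear = playing λ r → ε

  vanish : ∀ {xs} → spawner ∷ xs ⟹ xs
  vanish = playing λ r → ε

  beside : ∀ {xs ys q q′} zs → xs ⟨ q ⇒ q′ ⟩ ys → (xs ++ zs) ⟨ q ⇒ q′ ⟩ (ys ++ zs)
  beside {xs} {ys} {q} {q′} zs f = playing λ r →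
    subst₂ (λ r₁ r₂ → Step ⟨ q , r₁ ⟩ ⟨ q′ , r₂ ⟩) (sym (foldr-++ add r xs zs)) (sym (foldr-++ add r ys zs))
           (play f (place zs r))

  under : ∀ {xs ys q q′} zs → xs ⟨ q ⇒ q′ ⟩ ys → (zs ++ xs) ⟨ q ⇒ q′ ⟩ (zs ++ ys)
  under {xs} {ys} zs f = reorder (++-comm zs xs) then beside zs f then reorder (++-comm ys zs)

  walking : ∀ {q l l′} → Near l l′ → (l ∷ []) ⟨ q ⇒ q ⟩ (l′ ∷ [])
  walking {q} {l} {l′} near = playing λ r →
    subst (λ r′ → Step ⟨ q , add l r ⟩ ⟨ q , add l′ r′ ⟩) (remove-add l r) (walk near (occupied-add l r) ◅ ε)

  walkingAll : ∀ {l l′} → Near l l′ → ∀ k → replicate k l ⟹ replicate k l′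
  walkingAll near zero    = standing
  walkingAll {l} {l′} near (suc k) = beside (replicate k l) (walking near) then under (l′ ∷ []) (walkingAll near k)

  crossing : ∀ {q i a s b} → ((lookup q i , a) , (s , b)) ∈ Gadget.transitions Door →
             (port i a ∷ []) ⟨ q ⇒ q [ i ]≔ s ⟩ (port i b ∷ [])
  crossing {q} {i} {a} {s} {b} t∈ = playing λ r →
    subst (λ r′ → Step ⟨ q , add (port i a) r ⟩ ⟨ q [ i ]≔ s , add (port i b) r′ ⟩) (remove-add (port i a) r)
          (traverse t∈ (occupied-add (port i a) r) ◅ ε)

  -- The second robot undoes the change of state caused by the first, so the door is ready for the
  -- next pair.
  operating : ∀ {x x′ y y′} i → Near (port i 0F) x → Near (port i 1F) x′ → Near (port i 2F) y → Near (port i 3F) y′ →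
              (x ∷ y ∷ []) ⟹ (x′ ∷ y′ ∷ [])
  operating {x} {x′} {y} {y′} i nx nx′ ny ny′ =
    beside (y ∷ []) (walking (near-sym nx) then first then walking nx′) then
    under (x′ ∷ []) (walking (near-sym ny) then second then walking ny′)
    where
    first : (port i 0F ∷ []) ⟨ closed ⇒ closed [ i ]≔ 1F ⟩ (port i 1F ∷ [])
    first = crossing (here (cong (λ s → (s , 0F) , (1F , 1F)) (lookup-replicate i zero)))
    second : (port i 2F ∷ []) ⟨ closed [ i ]≔ 1F ⇒ closed ⟩ (port i 3F ∷ [])
    second = subst (λ q → (port i 2F ∷ []) ⟨ closed [ i ]≔ 1F ⇒ q ⟩ (port i 3F ∷ []))
      (trans ([]≔-idempotent closed i)
               (trans (cong (closed [ i ]≔_) (sym (lookup-replicate i zero))) ([]≔-lookup closed i)))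
      (crossing (there (here (cong (λ s → (s , 2F) , (0F , 3F)) (lookup∘update i closed 1F)))))

  -- Stated for a suffix of the word, so that a play can consume the word symbol by symbol and still
  -- use the links of the whole network.
  record Connected (c : Cursor) (v : Word) : Set where
    constructor connects
    field
      included : ∀ {k} → k ∈ sweep (linksAt N) c v → k ∈ network w

  open Connected

  connected-tail : ∀ {c s v} → Connected c (s ∷ v) → Connected (advance s c) v
  connected-tail {c} {s} wired = connects λ k∈ → included wired (∈-++⁺ʳ (linksAt N c s) k∈)

  wire-∈ : ∀ g (ns : Wiring) i → (gatePort g i , lookup ns i) ∈ wireLinks g ns
  wire-∈ g (_ ∷ _ ∷ _ ∷ _ ∷ []) 0F = here refl
  wire-∈ g (_ ∷ _ ∷ _ ∷ _ ∷ []) 1F = there (here refl)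
  wire-∈ g (_ ∷ _ ∷ _ ∷ _ ∷ []) 2F = there (there (here refl))
  wire-∈ g (_ ∷ _ ∷ _ ∷ _ ∷ []) 3F = there (there (there (here refl)))

  Ctl Lvl Dsh : ℕ → Place N
  Ctl p = node N p 0 (control now)
  Lvl p = node N p 0 (level now)
  Dsh a = node N 0 a dishNode

  module _ {c s v} (wired : Connected c (s ∷ v)) where

    private
      p a : ℕ
      p = position c
      a = nextDish s (dish c)

    near-link : ∀ {k l} → (k , l) ∈ links (mode c) s → Near (terminal N p a k) (node N p a l)
    near-link k∈ = inj₁ (included wired (∈-++⁺ˡ (∈-map⁺ (linkAt N p a) k∈)))

    near-direct : ∀ {k l} → (k , l) ∈ directLinks (mode c) s → Near (terminal N p a k) (node N p a l)
    near-direct k∈ =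
      near-link (∈-++⁺ʳ (wireLinks toll (wiring toll (mode c) s))
                        (∈-++⁺ʳ (wireLinks exchange (wiring exchange (mode c) s)) k∈))

    near-wire : ∀ g i → Near (port (gadget N (gateTag g) p) i) (node N p a (lookup (wiring g (mode c) s) i))
    near-wire toll     i = near-link (∈-++⁺ˡ (wire-∈ toll (wiring toll (mode c) s) i))
    near-wire exchange i = near-link (∈-++⁺ʳ (wireLinks toll (wiring toll (mode c) s))
                                             (∈-++⁺ˡ (wire-∈ exchange (wiring exchange (mode c) s) i)))

    gating : ∀ g → let at i = node N p a (lookup (wiring g (mode c) s) i) in
             (at 0F ∷ at 2F ∷ []) ⟹ (at 1F ∷ at 3F ∷ [])
    gating g = operating _ (near-wire g 0F) (near-wire g 1F) (near-wire g 2F) (near-wire g 3F)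

  halve : ∀ {l l′} → (l ∷ l ∷ []) ⟹ (l′ ∷ []) → ∀ k → replicate (2 * k) l ⟹ replicate k l′
  halve f zero = standing
  halve {l} {l′} f (suc k) =
    subst (λ n → replicate n l ⟹ replicate (suc k) l′) (sym (*-suc 2 k))
          (beside (replicate (2 * k) l) f then under (l′ ∷ []) (halve f k))

  unhalve : ∀ {l l′} → (l′ ∷ []) ⟹ (l ∷ l ∷ []) → ∀ k → replicate k l′ ⟹ replicate (2 * k) l
  unhalve f zero = standing
  unhalve {l} {l′} f (suc k) =
    subst (λ n → replicate (suc k) l′ ⟹ replicate n l) (sym (*-suc 2 k))
          (beside (replicate k l′) f then under (l ∷ l ∷ []) (unhalve f k))

  -- Horner's scheme: of 1 + 2k robots one pays the toll and the others pair up into k; 2(1 + k)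
  -- robots pair up into 1 + k, one of which pays. In both cases k robots face the remaining digits
  -- one level higher.
  gather-digits : ∀ b {s p a h u v} → Connected (cursor (gathers s) p a h u) (digits b ++ comma ∷ v) →
    ∃[ p′ ] ∃[ h′ ] ∃[ u′ ] Connected (cursor (gathers s) p′ a h′ u′) (comma ∷ v) ×
                            (Ctl p ∷ replicate (Bin.toℕ b) (Lvl p) ⟹ Ctl p′ ∷ [])
  gather-digits Bin.zero wired = _ , _ , _ , wired , standing
  gather-digits 1+[2 b ] {s} {p} {a} wired =
    let _ , _ , _ , wired′ , rest = gather-digits b (connected-tail wired)
        k = Bin.toℕ b
    in _ , _ , _ , wired′ ,
       (under (Ctl p ∷ Lvl p ∷ []) (halve (gating wired exchange then vanish) k) then
        reorder (swap _ _ unchanged) then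
        beside (replicate k (Lvl (suc p))) (gating wired toll then vanish) then
        rest)
  gather-digits 2[1+ b ] {s} {p} {a} wired =
    let _ , _ , _ , wired′ , rest = gather-digits b (connected-tail wired)
        k = Bin.toℕ b
    in _ , _ , _ , wired′ ,
       (under (Ctl p ∷ []) (halve (gating wired exchange then vanish) (suc k)) then
        reorder (swap _ _ unchanged) then
        beside (replicate k (Lvl (suc p))) (gating wired toll then vanish) then
        rest)

  -- The same scheme backwards: the toll hands out its robot first, the remaining digits supply k
  -- more of the next level, and the splitting down comes last.
  scatter-digits : ∀ b {s p a h u v} → Connected (cursor (scatters s) p a h u) (digits b ++ comma ∷ v) →
    ∃[ p′ ] ∃[ h′ ] ∃[ u′ ] Connected (cursor (scatters s) p′ a h′ u′) (comma ∷ v) ×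
                            (Ctl p ∷ [] ⟹ Ctl p′ ∷ replicate (Bin.toℕ b) (Lvl p))
  scatter-digits Bin.zero wired = _ , _ , _ , wired , standing
  scatter-digits 1+[2 b ] {s} {p} wired =
    let p′ , _ , _ , wired′ , rest = scatter-digits b (connected-tail wired)
        k = Bin.toℕ b
    in _ , _ , _ , wired′ ,
       (appear then reorder (swap _ _ unchanged) then gating wired toll then
        reorder (swap _ _ unchanged) then
        under (Lvl p ∷ []) (rest then under (Ctl p′ ∷ []) (unhalve (appear then reorder (swap _ _ unchanged) then gating wired exchange) k)) then
        reorder (swap _ _ unchanged))
  scatter-digits 2[1+ b ] {s} {p} wired =
    let p′ , _ , _ , wired′ , rest = scatter-digits b (connected-tail wired)
        k = Bin.toℕ b
    in _ , _ , _ , wired′ ,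
       (appear then reorder (swap _ _ unchanged) then gating wired toll then
        reorder (swap _ _ unchanged) then
        under (Lvl (suc p) ∷ []) rest then
        reorder (swap _ _ unchanged) then
        under (Ctl p′ ∷ []) (unhalve (appear then reorder (swap _ _ unchanged) then gating wired exchange) (suc k)))

  number-++ : ∀ k v → number k ++ v ≡ digits (Bin.fromℕ k) ++ comma ∷ v
  number-++ k v = ++-assoc (digits (Bin.fromℕ k)) (comma ∷ []) v

  near-dish : ∀ {m p a h u v} → Connected (cursor m p a h u) (comma ∷ v) → Near (Lvl (suc p)) (Dsh (suc a))
  near-dish wired = near-direct wired (here refl)

  near-next : ∀ {m p a h u v} → Connected (cursor m p a h u) (comma ∷ v) → Near (Ctl p) (Ctl (suc p))
  near-next wired = near-direct wired (there (here refl))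

  gather-number : ∀ k {s p a h u v} → Connected (cursor (gathers s) p a h u) (number k ++ v) → Near (Lvl p) (Dsh a) →
    ∃[ p′ ] ∃[ u′ ] Connected (cursor (gathers s) p′ (suc a) 1 u′) v × Near (Lvl p′) (Dsh (suc a)) ×
                    (Ctl p ∷ replicate k (Dsh a) ⟹ Ctl p′ ∷ [])
  gather-number k {s} {p} {a} {h} {u} {v} wired near =
    let p′ , _ , _ , wired′ , pay = gather-digits (Bin.fromℕ k)
                                    (subst (Connected (cursor (gathers s) p a h u)) (number-++ k v) wired)
    in _ , _ , connected-tail wired′ , near-dish wired′ ,
       (under (Ctl p ∷ []) (walkingAll (near-sym near) k) then
        subst (λ n → Ctl p ∷ replicate n (Lvl p) ⟹ Ctl p′ ∷ []) (toℕ-fromℕ k) pay then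
        walking (near-next wired′))

  scatter-number : ∀ k {s p a h u v} → Connected (cursor (scatters s) p a h u) (number k ++ v) → Near (Lvl p) (Dsh a) →
    ∃[ p′ ] ∃[ u′ ] Connected (cursor (scatters s) p′ (suc a) 1 u′) v × Near (Lvl p′) (Dsh (suc a)) ×
                    (Ctl p ∷ [] ⟹ Ctl p′ ∷ replicate k (Dsh a))
  scatter-number k {s} {p} {a} {h} {u} {v} wired near =
    let p′ , _ , _ , wired′ , pay = scatter-digits (Bin.fromℕ k)
                                    (subst (Connected (cursor (scatters s) p a h u)) (number-++ k v) wired)
    in _ , _ , connected-tail wired′ , near-dish wired′ ,
       (subst (λ n → Ctl p ∷ [] ⟹ Ctl p′ ∷ replicate n (Lvl p)) (toℕ-fromℕ k) pay then
        under (Ctl p′ ∷ []) (walkingAll near k) then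
        beside (replicate k (Dsh a)) (walking (near-next wired′)))

  tokens : ∀ {n} → ℕ → Counts n → List (Place N)
  tokens a []      = []
  tokens a (k ∷ v) = replicate k (Dsh a) ++ tokens (suc a) v

  gather-entries : ∀ {n} (d : Counts n) {s p a h u v} →
    Connected (cursor (gathers s) p a h u) (concatMap number (toList d) ++ v) → Near (Lvl p) (Dsh a) →
    ∃[ p′ ] ∃[ a′ ] ∃[ h′ ] ∃[ u′ ] Connected (cursor (gathers s) p′ a′ h′ u′) v ×
                                    (Ctl p ∷ tokens a d ⟹ Ctl p′ ∷ [])
  gather-entries []      wired near = _ , _ , _ , _ , wired , standing
  gather-entries (k ∷ d) {s} {p} {a} {h} {u} {v} wired near =
    let _ , _ , wired′ , near′ , pay =
          gather-number k (subst (Connected (cursor (gathers s) p a h u)) (++-assoc (number k) _ v) wired) near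
        _ , _ , _ , _ , wired″ , pay′ = gather-entries d wired′ near′
    in _ , _ , _ , _ , wired″ , (beside (tokens (suc a) d) pay then pay′)

  scatter-entries : ∀ {n} (d : Counts n) {s p a h u v} →
    Connected (cursor (scatters s) p a h u) (concatMap number (toList d) ++ v) → Near (Lvl p) (Dsh a) →
    ∃[ p′ ] ∃[ a′ ] ∃[ h′ ] ∃[ u′ ] Connected (cursor (scatters s) p′ a′ h′ u′) v ×
                                    (Ctl p ∷ [] ⟹ Ctl p′ ∷ tokens a d)
  scatter-entries []      wired near = _ , _ , _ , _ , wired , standing
  scatter-entries (k ∷ d) {s} {p} {a} {h} {u} {v} wired near =
    let _ , _ , wired′ , near′ , pay =
          scatter-number k (subst (Connected (cursor (scatters s) p a h u)) (++-assoc (number k) _ v) wired) near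
        p″ , _ , _ , _ , wired″ , pay′ = scatter-entries d wired′ near′
        rest = tokens (suc a) d
    in _ , _ , _ , _ , wired″ ,
       (pay then beside (replicate k (Dsh a)) pay′ then
        under (Ctl p″ ∷ []) (reorder (++-comm rest (replicate k (Dsh a)))))

  gather-numbers : ∀ {n} (d : Counts n) {s p a h u v} →
    Connected (cursor (gathers s) p a h u) (numbers d ++ v) → Near (Lvl p) (Dsh a) →
    ∃[ p′ ] ∃[ a′ ] ∃[ h′ ] ∃[ u′ ] Connected (cursor (gathers s) p′ a′ h′ u′) (semicolon ∷ v) ×
                                    (Ctl p ∷ tokens a d ⟹ Ctl p′ ∷ [])
  gather-numbers d {v = v} wired = gather-entries d (subst (Connected _) (++-assoc (concatMap number (toList d)) _ v) wired)

  scatter-numbers : ∀ {n} (d : Counts n) {s p a h u v} →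
    Connected (cursor (scatters s) p a h u) (numbers d ++ v) → Near (Lvl p) (Dsh a) →
    ∃[ p′ ] ∃[ a′ ] ∃[ h′ ] ∃[ u′ ] Connected (cursor (scatters s) p′ a′ h′ u′) (semicolon ∷ v) ×
                                    (Ctl p ∷ [] ⟹ Ctl p′ ∷ tokens a d)
  scatter-numbers d {v = v} wired = scatter-entries d (subst (Connected _) (++-assoc (concatMap number (toList d)) _ v) wired)

  -- The situation where a vector to be gathered begins. A control robot that has gathered nothing
  -- weighs nothing, so it can be fetched from the spawner.
  record Opening (s : Stage) (v : Word) : Set where
    constructor opening
    field
      {p}       : ℕ
      {u}       : ℕ → ℕ
      connected : Connected (cursor (gathers s) p 0 1 u) v
      entrance  : Near spawner (Ctl p)
      first     : Near (Lvl p) (Dsh 0)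

  reopening : ∀ {s p a h u v} → Connected (cursor (scatters s) p a h u) (semicolon ∷ v) →
              Near (Ctl p) spawner × Near spawner (Ctl (suc p)) × Near (Lvl (suc p)) (Dsh 0)
  reopening wired =
    near-direct wired (there (here refl)) , near-sym (near-direct wired (there (there (here refl)))) ,
    near-direct wired (here refl)

  play-rules : ∀ {n} (rs : List (Rule n)) {v} → Opening loop (concatMap rule rs ++ v) →
               (∀ {l r} → (l , r) ∈ rs → tokens 0 l ⟹ tokens 0 r) × Opening loop v
  play-rules []             o = (λ ()) , o
  play-rules ((l , r) ∷ rs) {v} (opening wired entrance first) =
    let _ , _ , _ , _ , wired₁ , pay = gather-numbers l (subst (Connected _) reassociate wired) first
        _ , _ , _ , _ , wired₂ , gain = scatter-numbers r (connected-tail wired₁) (near-direct wired₁ (here refl))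
        way-out , entrance′ , first′ = reopening wired₂
        others , o = play-rules rs (opening (connected-tail wired₂) entrance′ first′)
    in (λ { (here refl) →
              appear then beside (tokens 0 l) (walking entrance) then pay then
              -- The rule fires here; the second robot from the spawner passes from void to void and
              -- resets the one-way door.
              appear then reorder (swap _ _ unchanged) then gating wired₁ toll then
              reorder (swap _ _ unchanged) then vanish then
              gain then beside (tokens 0 r) (walking way-out) then vanish
          ; (there r∈) → others r∈ }) , o
    where
    reassociate : concatMap rule ((l , r) ∷ rs) ++ v ≡ numbers l ++ numbers r ++ concatMap rule rs ++ v
    reassociate = trans (++-assoc (numbers l ++ numbers r) _ v) (++-assoc (numbers l) (numbers r) _)

  play-initial : ∀ {n} (d : Counts n) {v} → Opening loop (bar ∷ numbers d ++ v) →
                 (startPlace N ∷ [] ⟹ tokens 0 d) × Opening once v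
  play-initial d (opening wired _ _) =
    let _ , _ , _ , _ , wired₁ , gain = scatter-numbers d (connected-tail wired) (near-direct wired (here refl))
        way-out , entrance , first = reopening wired₁
    in (walking (near-sym (near-direct wired (there (here refl)))) then gain then
        beside (tokens 0 d) (walking way-out) then vanish) ,
       opening (connected-tail wired₁) entrance first

  play-target : ∀ {n} (d : Counts n) {v} → Opening once (numbers d ++ v) → tokens 0 d ⟹ endPlace N ∷ []
  play-target d (opening wired entrance first) =
    let _ , _ , _ , _ , wired₁ , pay = gather-numbers d wired first
    in appear then beside (tokens 0 d) (walking entrance) then pay then
       walking (near-direct wired₁ (there (here refl)))

  tokens-+ : ∀ {n} a (d e : Counts n) → tokens a (zipWith _+_ d e) ↭ tokens a d ++ tokens a e
  tokens-+ a []      []      = unchanged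
  tokens-+ a (j ∷ d) (k ∷ e) =
    transitive (++⁺ (↭-reflexive (replicate-+ j k (Dsh a))) (tokens-+ (suc a) d e))
    (transitive (↭-reflexive (++-assoc (replicate j (Dsh a)) (replicate k (Dsh a)) _))
    (transitive (++⁺ˡ (replicate j (Dsh a)) (shifts (replicate k (Dsh a)) (tokens (suc a) d)))
           (↭-reflexive (sym (++-assoc (replicate j (Dsh a)) (tokens (suc a) d) _)))))

  restoring : ∀ {n} {u d : Counts n} → Pointwise _≤_ u d → zipWith _+_ u (zipWith _∸_ d u) ≡ d
  restoring []        = refl
  restoring (le ∷ ls) = cong₂ _∷_ (m+[n∸m]≡n le) (restoring ls)

  module _ (net : PetriNet) where
    open PetriNet net

    play-fires : (∀ {l r} → (l , r) ∈ rules → tokens 0 l ⟹ tokens 0 r) →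
                 ∀ {d d′} → Star (Fires net) d d′ → tokens 0 d ⟹ tokens 0 d′
    play-fires rule-play ε = standing
    play-fires rule-play (fire {u} {v} {d} r∈ u≤d ◅ fs) =
      reorder (transitive (↭-reflexive (cong (tokens 0) (sym (restoring u≤d)))) (tokens-+ 0 u (zipWith _∸_ d u))) then
      beside (tokens 0 (zipWith _∸_ d u)) (rule-play r∈) then
      reorder (transitive (++-comm (tokens 0 v) _) (↭-sym (tokens-+ 0 (zipWith _∸_ d u) v))) then
      play-fires rule-play fs

    play-instance : ∀ initial {v} → w ≡ sequence rule rules ++ numbers initial ++ v →
      (∀ {d} → Star (Fires net) initial d → startPlace N ∷ [] ⟹ tokens 0 d) × Opening once v
    play-instance initial {v} w≡ =
      let rule-play , o   = play-rules rules
                              (opening {p = 0} (subst (Connected origin) reassociate (connects (∈-++⁺ʳ (List.map (linkAt N 0 0) firstLinks))))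
                                       -- These are the `firstLinks`: no earlier symbol exists that
                                       -- could open the first vector.
                                       (inj₂ (here refl)) (inj₁ (there (here refl))))
          start-play , o′ = play-initial initial o
      in (λ fs → start-play then play-fires rule-play fs) , o′
      where
      reassociate : w ≡ concatMap rule rules ++ bar ∷ numbers initial ++ v
      reassociate = trans w≡ (++-assoc (concatMap rule rules) (bar ∷ []) _)

-- The two reductions

lookup-injective : ∀ {n} {u v : Counts n} → (∀ i → lookup u i ≡ lookup v i) → u ≡ v
lookup-injective {u = u} {v} e = trans (sym (tabulate∘lookup u)) (trans (tabulate-cong e) (tabulate∘lookup v))

at-self : ∀ a v → at a v a ≡ v
at-self zero    v = refl
at-self (suc a) v = at-self a v

module _ (x : ProductionInstance) where
  open ProductionInstance x

  private
    w : Word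
    w = productionWord x
    S : ℕ → ℕ
    S = entries 0 initial
    open Playing w using (tokens; Dsh; play; play-instance)
    open Soundness net S (λ _ → 0)
    open Weights S (λ _ → 0) Fire
    module Game = RobotReachabilityInstance (productionReduction x)

  dish-token : ∀ {n} a (d : Counts n) i → 1 ≤ lookup d i → Dsh (a + toℕ i) ∈ tokens a d
  dish-token a (suc k ∷ d) zero    o rewrite +-identityʳ a = here refl
  dish-token a (k ∷ d)     (suc i) o rewrite +-suc a (toℕ i) = ∈-++⁺ʳ (replicate k (Dsh a)) (dish-token (suc a) d i o)

  -- The index of the target is scanned like an entry to be gathered. As no semicolon follows it, no
  -- condition on `end` arises, and 0 can serve as its weight.
  production-valid : Valid origin w
  production-valid = valid-instance initial (λ _ → refl) λ _ →
    subst (Valid _) (++-identityʳ (index target)) (valid-number S (λ _ → 0) Fire (toℕ target) λ _ → tt)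

  production-complete : Problem.Yes Production x → Problem.Yes (RobotReachability Door) (productionReduction x)
  production-complete (d , fires , enough) =
    _ , play (proj₁ (play-instance net initial refl) fires) (noRobots Door _) ,
    occupied-place (dish-token 0 d target enough) (noRobots Door _)

  -- A robot on the target dish weighs one token of that dish, and the total is the number of such
  -- tokens that the simulating net has.
  production-sound : Problem.Yes (RobotReachability Door) (productionReduction x) → Problem.Yes Production x
  production-sound (⟨ q , r ⟩ , moves , won) =
    let d , fires , rep = simulate w production-valid moves (represents-start w production-valid initial λ _ → refl)
    in d , fires , (begin
      1                                 ≡⟨ sym (at-self (toℕ target) 1) ⟩
      at (toℕ target) 1 (toℕ target)    ≡⟨ sym (dish-weight w production-valid (toℕ target) (dish-≤ x)) ⟩
      locationWeight w production-valid (toℕ target) Game.win  ≤⟨ m≤m+n _ _ ⟩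
      _                                 ≡⟨ sym (weigh-remove w production-valid (toℕ target) q r Game.win won) ⟩
      weigh w production-valid (toℕ target) ⟨ q , r ⟩ ≡⟨ rep target ⟩
      lookup d target ∎)
    where
    open ≤-Reasoning

production-reduces : Production ≤ₚ RobotReachability Door
production-reduces =
  productionReduction ,
  (λ x → mk⇔ (production-complete x) (production-sound x)) ,
  phases-polynomialTime productionWord (Problem.encode (RobotReachability Door)) productionReduction
    productionPhases productionPhases-word

module _ (x : ConfigurationReachabilityInstance) where
  open ConfigurationReachabilityInstance x

  private
    w : Word
    w = reconfigurationWord x
    S E : ℕ → ℕ
    S = entries 0 initial
    E = entries 0 target
    open Playing w using (play; _then_; play-instance; play-target)
    open Soundness net S E
    open Weights S E Fire

    padded : numbers target ++ [] ≡ numbers target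
    padded = ++-identityʳ (numbers target)

  reconfiguration-valid : Valid origin w
  reconfiguration-valid = valid-instance initial (λ _ → refl) λ u≡0 →
    subst (Valid _) padded (valid-numbers S E Fire target u≡0 λ e → e , tt)

  reconfiguration-complete : Problem.Yes ConfigurationReachability x →
                             Problem.Yes (TargetedReconfiguration Door) (reconfigurationReduction x)
  reconfiguration-complete fires =
    let reached , o = play-instance net initial (cong (λ v → sequence rule rules ++ numbers initial ++ v) (sym padded))
    in play (reached fires then play-target target o) (noRobots Door _)

  -- The target configuration weighs exactly what its only robot at `end` stands for. This
  -- determines every entry of the configuration that the simulating net has reached.
  reconfiguration-sound : Problem.Yes (TargetedReconfiguration Door) (reconfigurationReduction x) →
                          Problem.Yes ConfigurationReachability x
  reconfiguration-sound moves =
    let d , fires , rep = simulate w reconfiguration-valid moves (represents-start w reconfiguration-valid initial λ _ → refl)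
    in subst (Star (Fires net) initial)
         (lookup-injective λ i →
           trans (sym (rep i))
                 (trans (weigh-single w reconfiguration-valid (toℕ i) (endPlace (length w))) (entries-lookup target i)))
         fires

reconfiguration-reduces : ConfigurationReachability ≤ₚ TargetedReconfiguration Door
reconfiguration-reduces =
  reconfigurationReduction ,
  (λ x → mk⇔ (reconfiguration-complete x) (reconfiguration-sound x)) ,
  phases-polynomialTime reconfigurationWord (Problem.encode (TargetedReconfiguration Door)) reconfigurationReduction
    reconfigurationPhases reconfigurationPhases-word

lemma4p4 : (Production ≤ₚ RobotReachability symmetricSelfClosingDoor) ×
    (ConfigurationReachability ≤ₚ TargetedReconfiguration symmetricSelfClosingDoor)
lemma4p4 = production-reduces , reconfiguration-reduces
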